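{- Assume that $m$ is finite and $m>2$. Then: (1) For finite $n\ge m+3$, the class $\mathsf{CAB}_{m,n}$ is not elementary. (2) For finite $n\ge m+3$, the class $\mathsf{CAF}_{m,n}$ is not elementary.
   Context: $\mathsf{CA}_m$ is the class of cylindric algebras of dimension $m$. $\mathsf{CAB}_{m,n}$ is the class of (atomic) algebras in $\mathsf{CA}_m$ having an $n$-dimensional basis. For atomic $\mathfrak B\in\mathsf{CA}_m$, an $n$-dimensional network is $N:{}^mn\to\mathrm{At}\mathfrak B$ with $N(\delta[i\to\delta_j])\le d_{ij}$ and $N(\delta[i\to d])\le c_iN(\delta)$ for all $\delta\in{}^mn$, $i,j<m$, $d<n$ ($\delta[i\to d]$ is $\delta$ with $i$th entry replaced by $d$). An $n$-dimensional basis for $\mathfrak B$ is a set $H$ of such networks such that every atom $a$ is $N(0,\dots,m-1)$ for some $N\in H$, and whenever $N\in H$, $\bar x\in{}^mn$, $i<m$, $N(\bar x)\le c_ia$ with $a$ an atom, and $z\in n\setminus\{x_j:j\ne i\}$, there is $M\in H$ agreeing with $N$ on all tuples avoiding $z$ with $M(\bar x[i\to z])=a$. $\mathsf{CAF}_{m,n}$ is the class of algebras in $\mathsf{CA}_m$ having a complete $n$-flat relativized representation. A relativized representation of $\mathfrak A\in\mathsf{CA}_m$ is a set $M$ with $V\subseteq{}^mM$, $M=\bigcup_{s\in V}\mathrm{rng}(s)$, and an injective homomorphism $f:\mathfrak A\to\wp(V)$ (Boolean operations relative to $V$, $c_iX=\{s\in V:\exists t\in X,\ t_j=s_j\ \forall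 j\ne i\}$, $d_{ij}=\{s\in V:s_i=s_j\}$); $M\models a(\bar s)$ means $\bar s\in f(a)$. It is complete if $f$ carries arbitrary existing suprema to unions. A clique is $C\subseteq M$ with ${}^mC\subseteq V$; $C^n(M)$ is the set of $n$-tuples of $M$ whose range is a clique. $M$ is $n$-square if whenever $\bar x\in C^n(M)$, $a\in A$, $i<m$, $l:m\to n$, $k\in n\setminus\{l(j):j\ne i\}$ and $M\models c_ia(x_{l(0)},\dots,x_{l(m-1)})$, there is $\bar y\in C^n(M)$ agreeing with $\bar x$ off $k$ such that $M\models a(y_{l'(0)},\dots,y_{l'(m-1)})$, where $l'$ is $l$ changed so that $l'(i)=k$. $M$ is $n$-flat if it is $n$-square and for every first order formula $\phi$ with variables $x_0,\dots,x_{n-1}$ in the language with an $m$-ary relation symbol for each $a\in A$, all $\bar a\in C^n(M)$, $i,j<n$: $M\models_C\exists x_i\exists x_j\phi(\bar a)$ iff $M\models_C\exists x_j\exists x_i\phi(\bar a)$, where $\models_C$ is clique-guarded satisfaction for $\bar a\in C^n(M)$: usual for atomic formulas and Boolean connectives, and $M\models_C\exists x_i\phi(\bar a)$ iff $M\models_C\phi(\bar b)$ for some $\bar b\in C^n(M)$ agreeing with $\bar a$ off $i$. -}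

module Defs where

open import Algebra.Core using (Op₁; Op₂)
open import Algebra.Lattice.Structures using (IsBooleanAlgebra)
open import Data.Fin using (Fin; inject≤)
open import Data.Nat using (ℕ; suc; _≤_)
open import Data.Product using (Σ-syntax; ∃-syntax; _×_; proj₁)
open import Data.Sum using (_⊎_)
open import Data.Vec using (Vec; _∷_; lookup; map; tabulate; _[_]≔_)
open import Data.Vec.Membership.Propositional renaming (_∈_ to _∈ᵥ_) using ()
open import Data.Vec.Relation.Unary.All using (All)
open import Function.Bundles using (_⇔_)
open import Level using (0ℓ) renaming (suc to lsuc)
open import Relation.Binary using (Rel; IsEquivalence)
open import Relation.Binary.PropositionalEquality using (_≡_; _≢_)
open import Relation.Nullary using (¬_)
open import Relation.Unary using (Pred; _∈_; _⊆_; _≐_; ∅; _∪_; _∩_; _∖_)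

-- Sets of tuples ᵐX are predicates on Vec X m.

AgreeOff : {X : Set} {k : ℕ} → Fin k → Rel (Vec X k) 0ℓ
AgreeOff i s t = ∀ j → j ≢ i → lookup s j ≡ lookup t j

------------------------------------------------------------------------
-- Structures for the signature of m-dimensional cylindric algebras

-- As usual in the standard library, equality of the structure is an
-- equivalence relation _≈_ respected by the operations.
record CylindricStructure (m : ℕ) : Set₁ where
  infix  8 -_
  infixr 7 _∧_
  infixr 6 _∨_
  infix  4 _≈_ _≉_ _≼_
  field
    Carrier       : Set
    _≈_           : Rel Carrier 0ℓ
    _∨_ _∧_       : Op₂ Carrier
    -_            : Op₁ Carrier
    𝟙 𝟘           : Carrier
    c             : Fin m → Op₁ Carrier
    d             : Fin m → Fin m → Carrier
    isEquivalence : IsEquivalence _≈_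
    ∨-cong        : ∀ {x x′ y y′} → x ≈ x′ → y ≈ y′ → (x ∨ y) ≈ (x′ ∨ y′)
    ∧-cong        : ∀ {x x′ y y′} → x ≈ x′ → y ≈ y′ → (x ∧ y) ≈ (x′ ∧ y′)
    -‿cong        : ∀ {x x′} → x ≈ x′ → (- x) ≈ (- x′)
    c-cong        : ∀ i {x x′} → x ≈ x′ → c i x ≈ c i x′

  _≉_ : Rel Carrier 0ℓ
  x ≉ y = ¬ (x ≈ y)

  -- The order of Algebra.Lattice.Properties.Lattice.
  _≼_ : Rel Carrier 0ℓ
  x ≼ y = x ≈ x ∧ y

  IsAtom : Pred Carrier 0ℓ
  IsAtom a = a ≉ 𝟘 × (∀ x → x ≼ a → x ≈ 𝟘 ⊎ x ≈ a)

  Atom : Set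
  Atom = Σ[ a ∈ Carrier ] IsAtom a

  Atomic : Set
  Atomic = ∀ x → x ≉ 𝟘 → ∃[ a ] (IsAtom a × a ≼ x)

  IsSupremum : Pred Carrier 0ℓ → Pred Carrier 0ℓ
  IsSupremum X s = (∀ x → x ∈ X → x ≼ s)
                 × (∀ u → (∀ x → x ∈ X → x ≼ u) → s ≼ u)

record IsCylindricAlgebra {m : ℕ} (𝔄 : CylindricStructure m) : Set where
  open CylindricStructure 𝔄
  field
    isBooleanAlgebra : IsBooleanAlgebra _≈_ _∨_ _∧_ -_ 𝟙 𝟘
    c-𝟘              : ∀ i → c i 𝟘 ≈ 𝟘
    c-increasing     : ∀ i x → x ≼ c i x
    c-∧              : ∀ i x y → c i (x ∧ c i y) ≈ c i x ∧ c i y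
    c-comm           : ∀ i j x → c i (c j x) ≈ c j (c i x)
    d-refl           : ∀ i → d i i ≈ 𝟙
    d-trans          : ∀ i j k → k ≢ i → k ≢ j → d i j ≈ c k (d i k ∧ d k j)
    d-subst          : ∀ i j x → i ≢ j →
                       c i (d i j ∧ x) ∧ c i (d i j ∧ (- x)) ≈ 𝟘

Class : ℕ → Set₂
Class m = Pred (CylindricStructure m) (lsuc 0ℓ)

------------------------------------------------------------------------
-- First order logic (with equality) over that signature

-- De Bruijn variables; the other connectives and ∀ are abbreviations.

infix 5 _≃_

data Term (m k : ℕ) : Set where
  var : Fin k → Term m k
  join meet : Term m k → Term m k → Term m k
  compl : Term m k → Term m k
  one zero : Term m k
  cyl : Fin m → Term m k → Term m k
  diag : Fin m → Fin m → Term m k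

data Formula (m k : ℕ) : Set where
  _≃_ : Term m k → Term m k → Formula m k
  neg : Formula m k → Formula m k
  and : Formula m k → Formula m k → Formula m k
  ex  : Formula m (suc k) → Formula m k

Sentence : ℕ → Set
Sentence m = Formula m 0

module _ {m : ℕ} (𝔄 : CylindricStructure m) where
  open CylindricStructure 𝔄

  eval : ∀ {k} → Vec Carrier k → Term m k → Carrier
  eval ρ (var x)    = lookup ρ x
  eval ρ (join s t) = eval ρ s ∨ eval ρ t
  eval ρ (meet s t) = eval ρ s ∧ eval ρ t
  eval ρ (compl t)  = - eval ρ t
  eval ρ one        = 𝟙
  eval ρ zero       = 𝟘
  eval ρ (cyl i t)  = c i (eval ρ t)
  eval ρ (diag i j) = d i j

  Sat : ∀ {k} → Vec Carrier k → Formula m k → Set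
  Sat ρ (s ≃ t)   = eval ρ s ≈ eval ρ t
  Sat ρ (neg φ)   = ¬ Sat ρ φ
  Sat ρ (and φ ψ) = Sat ρ φ × Sat ρ ψ
  Sat ρ (ex φ)    = ∃[ x ] Sat (x ∷ ρ) φ

infix 4 _⊨_

_⊨_ : {m : ℕ} → CylindricStructure m → Pred (Sentence m) 0ℓ → Set
𝔄 ⊨ T = ∀ σ → σ ∈ T → Sat 𝔄 Vec.[] σ

Elementary : {m : ℕ} → Class m → Set₁
Elementary {m} K = Σ[ T ∈ Pred (Sentence m) 0ℓ ] (∀ 𝔄 → 𝔄 ∈ K ⇔ 𝔄 ⊨ T)

------------------------------------------------------------------------
-- n-dimensional networks and bases

module _ {m : ℕ} (𝔅 : CylindricStructure m) (n : ℕ) where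
  open CylindricStructure 𝔅

  record Network : Set where
    field
      label   : Vec (Fin n) m → Atom

    ⟦_⟧ : Vec (Fin n) m → Carrier
    ⟦ δ ⟧ = proj₁ (label δ)

    field
      label-d : ∀ δ i j → ⟦ δ [ i ]≔ lookup δ j ⟧ ≼ d i j
      label-c : ∀ δ i k → ⟦ δ [ i ]≔ k ⟧ ≼ c i ⟦ δ ⟧

  open Network

  -- The hypothesis m ≤ n makes (0,…,m-1) an m-tuple of elements of n.
  record IsBasis (m≤n : m ≤ n) (H : Pred Network 0ℓ) : Set where
    field
      atoms  : ∀ a → IsAtom a →
               ∃[ N ] (N ∈ H × ⟦ N ⟧ (tabulate (λ i → inject≤ i m≤n)) ≈ a)
      extend : ∀ N → N ∈ H → ∀ x i a → IsAtom a → ⟦ N ⟧ x ≼ c i a →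
               ∀ z → (∀ j → j ≢ i → lookup x j ≢ z) →
               ∃[ M ] (M ∈ H
                     × (∀ y → (∀ j → lookup y j ≢ z) → ⟦ M ⟧ y ≈ ⟦ N ⟧ y)
                     × ⟦ M ⟧ (x [ i ]≔ z) ≈ a)

CAB : (m n : ℕ) → m ≤ n → Class m
CAB m n m≤n 𝔅 = IsCylindricAlgebra 𝔅
              × CylindricStructure.Atomic 𝔅
              × (Σ[ H ∈ Pred (Network 𝔅 n) 0ℓ ] IsBasis 𝔅 n m≤n H)

------------------------------------------------------------------------
-- Relativized representations

module _ {M : Set} {m : ℕ} (V : Pred (Vec M m) 0ℓ) where

  Cyl : Fin m → Pred (Vec M m) 0ℓ → Pred (Vec M m) 0ℓ
  Cyl i X s = s ∈ V × ∃[ t ] (t ∈ X × AgreeOff i t s)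

  Diag : Fin m → Fin m → Pred (Vec M m) 0ℓ
  Diag i j s = s ∈ V × lookup s i ≡ lookup s j

record RelativizedRepresentation {m : ℕ} (𝔄 : CylindricStructure m) : Set₁ where
  open CylindricStructure 𝔄
  field
    M         : Set
    V         : Pred (Vec M m) 0ℓ
    covers    : ∀ x → ∃[ s ] (s ∈ V × x ∈ᵥ s)
    f         : Carrier → Pred (Vec M m) 0ℓ
    f-⊆V      : ∀ x → f x ⊆ V
    f-cong    : ∀ {x y} → x ≈ y → f x ≐ f y
    f-∨       : ∀ x y → f (x ∨ y) ≐ f x ∪ f y
    f-∧       : ∀ x y → f (x ∧ y) ≐ f x ∩ f y
    f--       : ∀ x → f (- x) ≐ V ∖ f x
    f-𝟙       : f 𝟙 ≐ V
    f-𝟘       : f 𝟘 ≐ ∅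
    f-c       : ∀ i x → f (c i x) ≐ Cyl V i (f x)
    f-d       : ∀ i j → f (d i j) ≐ Diag V i j
    injective : ∀ {x y} → f x ≐ f y → x ≈ y

-- The first order formulas with variables x₀,…,xₙ₋₁ (and equality) in the
-- language with an m-ary relation symbol for each a ∈ A.
data LFormula (A : Set) (m n : ℕ) : Set where
  rel : A → Vec (Fin n) m → LFormula A m n
  eq  : Fin n → Fin n → LFormula A m n
  neg : LFormula A m n → LFormula A m n
  and : LFormula A m n → LFormula A m n → LFormula A m n
  ex  : Fin n → LFormula A m n → LFormula A m n

module _ {m : ℕ} {𝔄 : CylindricStructure m} (R : RelativizedRepresentation 𝔄) where
  open CylindricStructure 𝔄
  open RelativizedRepresentation R

  Complete : Set₁
  Complete = ∀ X s → IsSupremum X s → f s ≐ (λ t → ∃[ x ] (x ∈ X × t ∈ f x))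

  IsClique : Pred M 0ℓ → Set
  IsClique C = ∀ s → All C s → s ∈ V

  -- Cⁿ(M)
  CliqueTuple : (n : ℕ) → Pred (Vec M n) 0ℓ
  CliqueTuple n x = IsClique (_∈ᵥ x)

  Square : ℕ → Set
  Square n = ∀ x → x ∈ CliqueTuple n → ∀ a i (l : Vec (Fin n) m) k →
             (∀ j → j ≢ i → lookup l j ≢ k) →
             map (lookup x) l ∈ f (c i a) →
             ∃[ y ] (y ∈ CliqueTuple n × AgreeOff k y x
                   × map (lookup y) (l [ i ]≔ k) ∈ f a)

  CliqueSat : ∀ {n} → Vec M n → LFormula Carrier m n → Set
  CliqueSat         x (rel a l) = map (lookup x) l ∈ f a
  CliqueSat         x (eq i j)  = lookup x i ≡ lookup x j
  CliqueSat         x (neg φ)   = ¬ CliqueSat x φ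
  CliqueSat         x (and φ ψ) = CliqueSat x φ × CliqueSat x ψ
  CliqueSat {n = n} x (ex i φ)  =
    ∃[ y ] (y ∈ CliqueTuple n × AgreeOff i y x × CliqueSat y φ)

  Flat : ℕ → Set
  Flat n = Square n
         × (∀ φ x → x ∈ CliqueTuple n → ∀ i j →
            CliqueSat x (ex i (ex j φ)) ⇔ CliqueSat x (ex j (ex i φ)))

CAF : (m n : ℕ) → Class m
CAF m n 𝔄 = IsCylindricAlgebra 𝔄
          × (Σ[ R ∈ RelativizedRepresentation 𝔄 ] (Complete R × Flat R n))

{-# OPTIONS --safe #-}
module Submission where

-- A rainbow construction in the style of Hirsch and Hodkinson. Structures have base nodes of m - 1
-- sorts and apexes with a tint in ℕ. Two apexes of different tints above a common base (one node of
-- each sort) are joined by a red edge labelled with a number, and along red edges z w, w u of a red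
-- triangle of increasing tints the label decreases. The algebra 𝔸 consists of all sets of types of
-- m-tuples. In an n-dimensional basis of 𝔸 with n ≥ m + 2 one can place apexes of tints 0, 1, 2, …
-- over a single base, using three nodes in turn, and read off an infinite descent of red labels. A
-- complete n-square representation of 𝔸 would provide such a basis, so 𝔸 lies in neither class.
--
-- But any finite number of moves can be answered, by leaving gaps of size 2 ^ k between the indices
-- when k moves remain, and by letting a base that is formed under existing apexes admit only their
-- tints. So the partial plays are finitely consistent with the theory of 𝔸, and a Henkin construction
-- over them, which replaces an ultrapower and needs no choice, gives 𝔹 ≡ 𝔸 together with a complete
-- representation of 𝔹 on all m-tuples of natural numbers. Hence 𝔹 lies in both classes.

open import Defs
open import Axiom.ExcludedMiddle using (ExcludedMiddle)
open import Data.Nat using (ℕ; _+_; _≤_; _<_)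
open import Data.Nat.Properties using (≤-trans; m≤m+n)
open import Data.Product using (_×_)
open import Relation.Nullary using (¬_)

open import Data.Bool using (Bool; true; false; if_then_else_; _∧_; _∨_; not)
import Data.Bool.Properties as Bool
open import Data.Empty using (⊥)
open import Data.Fin using (Fin; toℕ; fromℕ; fromℕ<; inject₁; inject≤; punchOut) renaming (zero to fzero; suc to fsuc)
import Data.Fin as Fin
import Data.Fin.Properties as Fin
open import Data.List using (List; []; _∷_; allFin)
open import Data.List.Membership.Propositional using () renaming (_∈_ to _∈ₗ_)
open import Data.List.Membership.Propositional.Properties using (∈-allFin)
open import Data.List.Relation.Unary.Any using (here; there)
open import Data.Nat using (zero; suc; _^_; _∸_; _⊔_; _<?_; z≤n; s≤s)
open import Data.Nat.Induction using (<-rec)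
import Data.Nat.Properties as ℕ
open import Data.Product using (Σ-syntax; ∃-syntax; _,_; proj₁; proj₂)
open import Data.Sum using (_⊎_; inj₁; inj₂; [_,_]′)
open import Data.Unit using (⊤; tt)
open import Data.Vec using (Vec; []; _∷_; lookup; map; tabulate; replicate; _[_]≔_)
open import Data.Vec.Membership.Propositional using () renaming (_∈_ to _∈ᵥ_)
open import Data.Vec.Membership.Propositional.Properties using (∈-lookup)
open import Data.Vec.Properties
  using (lookup-map; lookup∘tabulate; tabulate∘lookup; tabulate-cong; lookup∘update; lookup∘update′;
         lookup-replicate; []≔-commutes; []≔-idempotent; []≔-lookup)
import Data.Vec.Relation.Unary.All.Properties as All
import Data.Vec.Relation.Unary.Any as Any
import Data.Vec.Relation.Unary.Any.Properties as Any
open import Function using (_∘_; case_of_; id)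
open import Function.Bundles using (_⇔_; mk⇔; Equivalence)
open import Level using (0ℓ)
open import Relation.Binary using (IsEquivalence; tri<; tri≈; tri>)
open import Relation.Binary.PropositionalEquality
  using (_≡_; _≢_; refl; sym; trans; cong; cong₂; subst; subst₂)
open import Relation.Nullary using (Dec; yes; no; contradiction; does)
open import Relation.Unary using (Pred; _∈_)

-- White labels keep the red constraints local. Apexes of different tints may be joined by `white c`
-- unless they share a base node of sort `c`, so red is enforced only when they share a node of
-- every sort. A new node is linked only inside the `m`-tuple it was created for; hence a new apex
-- has at most one base, and all demands on its red edges come from there.
--
-- The obstacle is the opposite case, a new base node that completes a base under several old
-- apexes. The labels between these were chosen without regard to that base and need not follow any
-- indices. This is why `tints` belongs to a structure and to the type of a tuple: the new base is
-- closed to further tints, and later apexes over it copy the edges of an old one. The base of the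
-- infinite descent admits all tints, so it cannot be closed in this way.
--
-- The powers of two come from inserting a tint between two neighbours, which halves the gap between
-- their indices. No single play need go on forever: the Henkin theory keeps only conditions that
-- hold, for each `k`, in some play with `k` moves left, and of a condition and its negation one can
-- always be kept.

module Structures (em : {P : Set} → Dec P) (m′ : ℕ) where

  m₁ m : ℕ
  m₁ = suc (suc m′)
  m  = suc m₁

  -- Truth values of propositions and finite combinatorics

  opaque
    -- The carrier of `𝔸` has to be a `Set`, so sets of types are `Bool`-valued; excluded middle
    -- turns a proposition into such a value.
    is : Set → Bool
    is P = does (em {P})

    is⁺ : {P : Set} → P → is P ≡ true
    is⁺ {P} p with em {P}
    ... | yes _ = refl
    ... | no ¬p = contradiction p ¬p

    is⁻ : {P : Set} → is P ≡ true → P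
    is⁻ {P} eqn with em {P}
    ... | yes p = p

    is-false : {P : Set} → ¬ P → is P ≡ false
    is-false {P} ¬p with em {P}
    ... | yes p = contradiction p ¬p
    ... | no _  = refl

  dne : {P : Set} → ¬ ¬ P → P
  dne {P} ¬¬p with em {P}
  ... | yes p = p
  ... | no ¬p = contradiction ¬p ¬¬p

  lookup-ext : {A : Set} {n : ℕ} {xs ys : Vec A n} → (∀ i → lookup xs i ≡ lookup ys i) → xs ≡ ys
  lookup-ext {xs = xs} {ys} eqn =
    trans (sym (tabulate∘lookup xs)) (trans (tabulate-cong eqn) (tabulate∘lookup ys))

  update-copies : {A : Set} {n : ℕ} (v : Vec A n) (i j : Fin n) →
                  lookup (v [ i ]≔ lookup v j) i ≡ lookup (v [ i ]≔ lookup v j) j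
  update-copies v i j with j Fin.≟ i
  ... | yes refl = refl
  ... | no j≢i   = trans (lookup∘update i v _) (sym (lookup∘update′ j≢i v _))

  map-lookup-copies : {A B : Set} {n : ℕ} (f : A → B) (v : Vec A n) (i j : Fin n) →
                      lookup (map f (v [ i ]≔ lookup v j)) i ≡ lookup (map f (v [ i ]≔ lookup v j)) j
  map-lookup-copies f v i j = trans (lookup-map i f (v [ i ]≔ lookup v j))
    (trans (cong f (update-copies v i j)) (sym (lookup-map j f (v [ i ]≔ lookup v j))))

  map-lookup-off : {A B : Set} {n : ℕ} (f : A → B) (v : Vec A n) (i : Fin n) (x : A) →
                   ∀ j → j ≢ i → lookup (map f v) j ≡ lookup (map f (v [ i ]≔ x)) j
  map-lookup-off f v i x j j≢i = trans (lookup-map j f v)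
    (trans (cong f (sym (lookup∘update′ j≢i v x))) (sym (lookup-map j f (v [ i ]≔ x))))

  least : (P : ℕ → Set) → ∀ n → P n → ∃[ k ] (P k × (∀ j → j < k → ¬ P j))
  least P = <-rec _ go
    where
    go : ∀ n → (∀ {k} → k < n → P k → ∃[ k ] (P k × (∀ j → j < k → ¬ P j))) →
         P n → ∃[ k ] (P k × (∀ j → j < k → ¬ P j))
    go n rec p with em {∃[ k ] (k < n × P k)}
    ... | yes (k , k<n , pk) = rec k<n pk
    ... | no none = n , p , λ j j<n pj → none (j , j<n , pj)

  -- Pigeonhole: if `l` were missed too, adding `j` to the values of `f` would inject `suc n` points
  -- into what remains of `Fin (suc n)` without `l`.
  injective-covers : ∀ {n} (f : Fin n → Fin (suc n)) → (∀ {c c′} → f c ≡ f c′ → c ≡ c′) →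
                     ∀ j → (∀ c → f c ≢ j) → ∀ l → l ≢ j → ∃[ c ] f c ≡ l
  injective-covers {n} f inj j avoid l l≢j with Fin.any? (λ c → f c Fin.≟ l)
  ... | yes hit = hit
  ... | no miss = contradiction (Fin.injective⇒≤ {f = g} g-inj) ℕ.1+n≰n
    where
    f⁺ : Fin (suc n) → Fin (suc n)
    f⁺ fzero    = j
    f⁺ (fsuc c) = f c
    f⁺-inj : ∀ {c c′} → f⁺ c ≡ f⁺ c′ → c ≡ c′
    f⁺-inj {fzero}  {fzero}   _  = refl
    f⁺-inj {fzero}  {fsuc c′} eqn = contradiction (sym eqn) (avoid c′)
    f⁺-inj {fsuc c} {fzero}   eqn = contradiction eqn (avoid c)
    f⁺-inj {fsuc c} {fsuc c′} eqn = cong fsuc (inj eqn)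
    l≢f⁺ : ∀ c → l ≢ f⁺ c
    l≢f⁺ fzero    = l≢j
    l≢f⁺ (fsuc c) eqn = miss (c , sym eqn)
    g : Fin (suc n) → Fin n
    g c = punchOut (l≢f⁺ c)
    g-inj : ∀ {c c′} → g c ≡ g c′ → c ≡ c′
    g-inj {c} {c′} eqn = f⁺-inj (Fin.punchOut-injective (l≢f⁺ c) (l≢f⁺ c′) eqn)

  -- Structures, their validity, and types of tuples

  data Sort : Set where
    base : Fin m₁ → Sort
    apex : ℕ → Sort

  data Label : Set where
    white : Fin m₁ → Label
    red   : ℕ → Label

  base-injective : ∀ {c c′} → base c ≡ base c′ → c ≡ c′
  base-injective refl = refl

  apex-injective : ∀ {a b} → apex a ≡ apex b → a ≡ b
  apex-injective refl = refl

  base≢apex : ∀ {c a} → base c ≢ apex a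
  base≢apex ()

  red-injective : ∀ {p q} → red p ≡ red q → p ≡ q
  red-injective refl = refl

  not-white⇒red : ∀ ℓ → (∀ c → ℓ ≢ white c) → ∃[ p ] ℓ ≡ red p
  not-white⇒red (white c) nw = contradiction refl (nw c)
  not-white⇒red (red p)   _  = p , refl

  -- Stated for bare functions because cones of an extended structure are needed before its labels
  -- are chosen.
  record ConeOf (sort : ℕ → Sort) (link : ℕ → ℕ → Bool) (F : Vec ℕ m₁) (z a : ℕ) : Set where
    constructor cone
    field
      apex≡  : sort z ≡ apex a
      linked : ∀ c → link (lookup F c) z ≡ true

  record Structure : Set where
    field
      sort  : ℕ → Sort
      link  : ℕ → ℕ → Bool
      label : ℕ → ℕ → Label
      tints : Vec ℕ m₁ → ℕ → Bool

    Base : Vec ℕ m₁ → Set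
    Base F = ∀ c → sort (lookup F c) ≡ base c

    Cone : Vec ℕ m₁ → ℕ → ℕ → Set
    Cone = ConeOf sort link

    record Valid : Set where
      field
        allowed  : ∀ F z a → Base F → Cone F z a → tints F a ≡ true
        nonwhite : ∀ {x z w c a b} → sort x ≡ base c → sort z ≡ apex a → sort w ≡ apex b → a < b →
                   link x z ≡ true → link x w ≡ true → label z w ≢ white c
        descend  : ∀ {z w u a b c p q r} → sort z ≡ apex a → sort w ≡ apex b → sort u ≡ apex c →
                   a < b → b < c → label z w ≡ red p → label w u ≡ red q → label z u ≡ red r → q < p

      cone-red : ∀ {F z w a b} → Base F → Cone F z a → Cone F w b → a < b → ∃[ p ] label z w ≡ red p
      cone-red {F} {z} {w} bs (cone sz lz) (cone sw lw) a<b =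
        not-white⇒red _ (λ c → nonwhite (bs c) sz sw a<b (lz c) (lw c))

    Saturated : Vec ℕ m₁ → Set
    Saturated F = ∀ a → tints F a ≡ true → ∃[ z ] Cone F z a

    -- The index h b of an apex of tint b is what a red edge from a lower tint to b displays.
    record Indexed (k : ℕ) (F : Vec ℕ m₁) : Set where
      field
        h     : ℕ → ℕ
        shown : ∀ {z w a b} → Cone F z a → Cone F w b → a < b → label z w ≡ red (h b)
        gap   : ∀ {z w a b} → Cone F z a → Cone F w b → a < b → 2 ^ k + h b ≤ h a
        room  : ∀ {z a} → Cone F z a → 2 ^ k ≤ h a

    -- Enough to answer k more moves: a base forbids new tints or leaves room for k more indices.
    Good : ℕ → Set
    Good k = ∀ F → Base F → Saturated F ⊎ Indexed k F

    Fresh : ℕ → Set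
    Fresh J = ∀ p q → J ≤ p → link p q ≡ false × link q p ≡ false

  open Structure

  2^-suc : ∀ k → 2 ^ suc k ≡ 2 ^ k + 2 ^ k
  2^-suc k = cong (2 ^ k +_) (ℕ.+-identityʳ (2 ^ k))

  2^-mono : ∀ k → 2 ^ k ≤ 2 ^ suc k
  2^-mono k = ℕ.m≤m+n _ _

  Indexed-pred : ∀ {G k F} → Indexed G (suc k) F → Indexed G k F
  Indexed-pred {G} {k} ix = record
    { h = h ; shown = shown
    ; gap = λ p q r → ℕ.≤-trans (ℕ.+-monoˡ-≤ _ (2^-mono k)) (gap p q r)
    ; room = λ p → ℕ.≤-trans (2^-mono k) (room p) }
    where open Indexed ix

  Good-pred : ∀ {G k} → Good G (suc k) → Good G k
  Good-pred g F b with g F b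
  ... | inj₁ s  = inj₁ s
  ... | inj₂ ix = inj₂ (Indexed-pred ix)

  -- The isomorphism type of a tuple at the positions in `D`, including the tints of all
  -- `m - 1`-tuples of its entries. `D` will be everything, for atoms, or everything but `i`, for
  -- the equivalence relation behind the `i`th cylindrification.
  record Same (D : Fin m → Set) (G : Structure) (s : Vec ℕ m) (G* : Structure) (s* : Vec ℕ m) : Set where
    field
      eq⇒   : ∀ {j l} → D j → D l → lookup s j ≡ lookup s l → lookup s* j ≡ lookup s* l
      eq⇐   : ∀ {j l} → D j → D l → lookup s* j ≡ lookup s* l → lookup s j ≡ lookup s l
      sort≡  : ∀ {j} → D j → sort G (lookup s j) ≡ sort G* (lookup s* j)
      link≡  : ∀ {j l} → D j → D l → link G (lookup s j) (lookup s l) ≡ link G* (lookup s* j) (lookup s* l)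
      label≡ : ∀ {j l} → D j → D l → label G (lookup s j) (lookup s l) ≡ label G* (lookup s* j) (lookup s* l)
      tints≡ : ∀ (v : Vec (Fin m) m₁) → (∀ c → D (lookup v c)) → ∀ a →
               tints G (map (lookup s) v) a ≡ tints G* (map (lookup s*) v) a
  open Same

  Same-refl : ∀ {D G s} → Same D G s G s
  Same-refl = record { eq⇒ = λ _ _ e → e ; eq⇐ = λ _ _ e → e ; sort≡ = λ _ → refl
                     ; link≡ = λ _ _ → refl ; label≡ = λ _ _ → refl ; tints≡ = λ _ _ _ → refl }

  Same-sym : ∀ {D G s G* s*} → Same D G s G* s* → Same D G* s* G s
  Same-sym S = record { eq⇒ = eq⇐ S ; eq⇐ = eq⇒ S ; sort≡ = λ d → sym (sort≡ S d)
                      ; link≡ = λ d e → sym (link≡ S d e) ; label≡ = λ d e → sym (label≡ S d e)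
                      ; tints≡ = λ v d a → sym (tints≡ S v d a) }

  Same-trans : ∀ {D G s G* s* G° s°} → Same D G s G* s* → Same D G* s* G° s° → Same D G s G° s°
  Same-trans S T = record
    { eq⇒ = λ d e p → eq⇒ T d e (eq⇒ S d e p) ; eq⇐ = λ d e p → eq⇐ S d e (eq⇐ T d e p)
    ; sort≡ = λ d → trans (sort≡ S d) (sort≡ T d)
    ; link≡ = λ d e → trans (link≡ S d e) (link≡ T d e)
    ; label≡ = λ d e → trans (label≡ S d e) (label≡ T d e)
    ; tints≡ = λ v d a → trans (tints≡ S v d a) (tints≡ T v d a) }

  Same-weaken : ∀ {D E : Fin m → Set} {G s G* s*} → (∀ {j} → E j → D j) → Same D G s G* s* → Same E G s G* s*
  Same-weaken w S = record
    { eq⇒ = λ d e → eq⇒ S (w d) (w e) ; eq⇐ = λ d e → eq⇐ S (w d) (w e) ; sort≡ = λ d → sort≡ S (w d)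
    ; link≡ = λ d e → link≡ S (w d) (w e) ; label≡ = λ d e → label≡ S (w d) (w e)
    ; tints≡ = λ v d → tints≡ S v (λ c → w (d c)) }

  record Agree (Q : ℕ → Set) (G G′ : Structure) : Set where
    field
      sort≡  : ∀ {p} → Q p → sort G p ≡ sort G′ p
      link≡  : ∀ {p q} → Q p → Q q → link G p q ≡ link G′ p q
      label≡ : ∀ {p q} → Q p → Q q → label G p q ≡ label G′ p q
      tints≡ : ∀ F → (∀ c → Q (lookup F c)) → ∀ a → tints G F a ≡ tints G′ F a

  Agree-refl : ∀ {Q G} → Agree Q G G
  Agree-refl = record { sort≡ = λ _ → refl ; link≡ = λ _ _ → refl ; label≡ = λ _ _ → refl ; tints≡ = λ _ _ _ → refl }

  Agree-sym : ∀ {Q G G′} → Agree Q G G′ → Agree Q G′ G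
  Agree-sym A = record { sort≡ = λ p → sym (A.sort≡ p) ; link≡ = λ p q → sym (A.link≡ p q)
                       ; label≡ = λ p q → sym (A.label≡ p q) ; tints≡ = λ F p a → sym (A.tints≡ F p a) }
    where module A = Agree A

  Agree-trans : ∀ {Q G G′ G″} → Agree Q G G′ → Agree Q G′ G″ → Agree Q G G″
  Agree-trans A B = record { sort≡ = λ p → trans (A.sort≡ p) (B.sort≡ p) ; link≡ = λ p q → trans (A.link≡ p q) (B.link≡ p q)
                       ; label≡ = λ p q → trans (A.label≡ p q) (B.label≡ p q)
                       ; tints≡ = λ F p a → trans (A.tints≡ F p a) (B.tints≡ F p a) }
    where
    module A = Agree A
    module B = Agree B

  Agree-weaken : ∀ {P Q : ℕ → Set} {G G′} → (∀ {p} → P p → Q p) → Agree Q G G′ → Agree P G G′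
  Agree-weaken w A = record { sort≡ = λ p → A.sort≡ (w p) ; link≡ = λ p q → A.link≡ (w p) (w q)
                       ; label≡ = λ p q → A.label≡ (w p) (w q)
                       ; tints≡ = λ F p → A.tints≡ F (λ c → w (p c)) }
    where module A = Agree A

  Agree⇒Same : ∀ {Q G G′ D} s → (∀ j → Q (lookup s j)) → Agree Q G G′ → Same D G s G′ s
  Agree⇒Same {Q} s qs A = record
    { eq⇒ = λ _ _ e → e ; eq⇐ = λ _ _ e → e ; sort≡ = λ _ → A.sort≡ (qs _)
    ; link≡ = λ _ _ → A.link≡ (qs _) (qs _) ; label≡ = λ _ _ → A.label≡ (qs _) (qs _)
    ; tints≡ = λ v _ → A.tints≡ _ (λ c → subst Q (sym (lookup-map c (lookup s) v)) (qs _)) }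
    where module A = Agree A

-- Answering one move by a new node

module Extensions (em : {P : Set} → Dec P) (m′ : ℕ) where

  open Structures em m′
  open Structure
  open Same
  open ConeOf

  -- The fresh node `J` becomes entry `i` of `s`, and the new tuple is to have the type of `s*`.
  -- Inside the tuple everything is copied from `G*`, away from `J` everything stays as in `G`, and
  -- `same` makes the two agree where they overlap. Left to decide are the pairs and bases that
  -- contain both `J` and a node outside the tuple.
  module Extend
    (G : Structure) (valid : Valid G) (k : ℕ) (good : Good G (suc k)) (J : ℕ) (fresh : Fresh G J)
    (s : Vec ℕ m) (s<J : ∀ l → lookup s l < J) (i : Fin m)
    (G* : Structure) (valid* : Valid G*) (s* : Vec ℕ m)
    (same : Same (_≢ i) G s G* s*) (proper : ∀ l → l ≢ i → lookup s* l ≢ lookup s* i) where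

    opaque
      s⁺ : Vec ℕ m
      s⁺ = s [ i ]≔ J

      s⁺-def : s⁺ ≡ s [ i ]≔ J
      s⁺-def = refl

      s⁺-new : lookup s⁺ i ≡ J
      s⁺-new = lookup∘update i s J

      s⁺-old : ∀ {l} → l ≢ i → lookup s⁺ l ≡ lookup s l
      s⁺-old l≢i = lookup∘update′ l≢i s J

    s⁺≢J : ∀ {l} → l ≢ i → lookup s⁺ l ≢ J
    s⁺≢J {l} l≢i eqn = ℕ.<⇒≢ (s<J l) (trans (sym (s⁺-old l≢i)) eqn)

    pattern⇒ : ∀ {j l} → lookup s⁺ j ≡ lookup s⁺ l → lookup s* j ≡ lookup s* l
    pattern⇒ {j} {l} eqn with j Fin.≟ i | l Fin.≟ i
    ... | yes refl | yes refl = refl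
    ... | yes refl | no l≢i = contradiction (trans (sym eqn) s⁺-new) (s⁺≢J l≢i)
    ... | no j≢i | yes refl = contradiction (trans eqn s⁺-new) (s⁺≢J j≢i)
    ... | no j≢i | no l≢i = eq⇒ same j≢i l≢i (trans (sym (s⁺-old j≢i)) (trans eqn (s⁺-old l≢i)))

    pattern⇐ : ∀ {j l} → lookup s* j ≡ lookup s* l → lookup s⁺ j ≡ lookup s⁺ l
    pattern⇐ {j} {l} eqn with j Fin.≟ i | l Fin.≟ i
    ... | yes refl | yes refl = refl
    ... | yes refl | no l≢i = contradiction (sym eqn) (proper l l≢i)
    ... | no j≢i | yes refl = contradiction eqn (proper j j≢i)
    ... | no j≢i | no l≢i = trans (s⁺-old j≢i) (trans (eq⇐ same j≢i l≢i eqn) (sym (s⁺-old l≢i)))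

    In : ℕ → Set
    In p = ∃[ l ] lookup s⁺ l ≡ p

    locate : {p : ℕ} → Dec (In p) → ℕ
    locate (yes (l , _)) = lookup s* l
    locate (no _)        = 0

    opaque
      π : ℕ → ℕ
      π p = locate (em {In p})

      π-s⁺ : ∀ l → π (lookup s⁺ l) ≡ lookup s* l
      π-s⁺ l with em {In (lookup s⁺ l)}
      ... | yes (l′ , eqn) = pattern⇒ eqn
      ... | no ¬in        = contradiction (l , refl) ¬in

    In-J : In J
    In-J = i , s⁺-new

    In-old : ∀ {p} → In p → p ≢ J → ∃[ l ] (l ≢ i × lookup s⁺ l ≡ p)
    In-old (l , eqn) p≢J = l , (λ { refl → p≢J (trans (sym eqn) s⁺-new) }) , eqn

    opaque
      sort⁺ : ℕ → Sort
      sort⁺ p = if is (In p) then sort G* (π p) else sort G p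

      sort-in : ∀ {p} → In p → sort⁺ p ≡ sort G* (π p)
      sort-in ip rewrite is⁺ ip = refl

      sort-old : ∀ {p} → p ≢ J → sort⁺ p ≡ sort G p
      sort-old {p} p≢J with is (In p) in eqn
      ... | false = refl
      ... | true with In-old (is⁻ eqn) p≢J
      ...   | l , l≢i , refl = trans (cong (sort G*) (π-s⁺ l)) (trans (sym (sort≡ same l≢i)) (cong (sort G) (sym (s⁺-old l≢i))))

    opaque
      link⁺ : ℕ → ℕ → Bool
      link⁺ p q = if is (In p × In q) then link G* (π p) (π q)
                  else (if is (p ≡ J ⊎ q ≡ J) then false else link G p q)

      link-in : ∀ {p q} → In p → In q → link⁺ p q ≡ link G* (π p) (π q)
      link-in ip iq rewrite is⁺ (ip , iq) = refl

      link-old : ∀ {p q} → p ≢ J → q ≢ J → link⁺ p q ≡ link G p q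
      link-old {p} {q} p≢J q≢J with is (In p × In q) in eqn
      ... | false rewrite is-false {p ≡ J ⊎ q ≡ J} [ p≢J , q≢J ]′ = refl
      ... | true with In-old (proj₁ (is⁻ eqn)) p≢J | In-old (proj₂ (is⁻ eqn)) q≢J
      ...   | l , l≢i , refl | l′ , l′≢i , refl =
        trans (cong₂ (link G*) (π-s⁺ l) (π-s⁺ l′))
          (trans (sym (link≡ same l≢i l′≢i)) (cong₂ (link G) (sym (s⁺-old l≢i)) (sym (s⁺-old l′≢i))))

      link-J : ∀ {p q} → link⁺ p q ≡ true → p ≡ J ⊎ q ≡ J → In p × In q
      link-J {p} {q} eqn pq with is (In p × In q) in e
      ... | true = is⁻ e
      ... | false rewrite is⁺ pq = case eqn of λ ()

    linked-to-J : ∀ {p} → link⁺ p J ≡ true → In p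
    linked-to-J eqn = proj₁ (link-J eqn (inj₂ refl))

    linked-from-J : ∀ {p} → link⁺ J p ≡ true → In p
    linked-from-J eqn = proj₂ (link-J eqn (inj₁ refl))

    Base⁺ : Vec ℕ m₁ → Set
    Base⁺ F = ∀ c → sort⁺ (lookup F c) ≡ base c

    Cone⁺ : Vec ℕ m₁ → ℕ → ℕ → Set
    Cone⁺ = ConeOf sort⁺ link⁺

    -- m - 1 nodes of different sorts and an apex exhaust the m nodes of s⁺.
    cover : ∀ F → Base⁺ F → (∀ c → In (lookup F c)) → ∀ {z a} → In z → sort⁺ z ≡ apex a →
            ∀ {p} → In p → p ≢ z → ∃[ c ] lookup F c ≡ p
    cover F bs F-in {z} {a} (lz , lz≡) sz {p} (l , l≡) p≢z with
      injective-covers (λ c → proj₁ (F-in c))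
        (λ {c} {c′} eqn → base-injective (trans (sym (bs c)) (trans (cong sort⁺
            (trans (sym (proj₂ (F-in c))) (trans (cong (lookup s⁺) eqn) (proj₂ (F-in c′))))) (bs c′))))
        lz
        (λ c eqn → base≢apex (trans (sym (bs c)) (trans (cong sort⁺
            (trans (sym (proj₂ (F-in c))) (trans (cong (lookup s⁺) eqn) lz≡))) sz)))
        l (λ { refl → p≢z (trans (sym l≡) lz≡) })
    ... | c , eqn = c , trans (sym (proj₂ (F-in c))) (trans (cong (lookup s⁺) eqn) l≡)

    map-s⁺ : ∀ {F} {ls : Vec (Fin m) m₁} → (∀ c → lookup s⁺ (lookup ls c) ≡ lookup F c) →
             map (lookup s*) ls ≡ map π F
    map-s⁺ {F} {ls} eqn = lookup-ext λ c →
      trans (lookup-map c (lookup s*) ls)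
        (trans (sym (π-s⁺ (lookup ls c))) (trans (cong π (eqn c)) (sym (lookup-map c π F))))

    opaque
      -- A base that contains `J` and leaves the tuple admits exactly the tints of the apexes it
      -- already has. The edges between those were labelled earlier and may fit no system of
      -- indices; with its tints frozen the base needs none.
      tints⁺ : Vec ℕ m₁ → ℕ → Bool
      tints⁺ F a = if is (∀ c → In (lookup F c)) then tints G* (map π F) a
                   else (if is (∃[ c ] lookup F c ≡ J) then is (∃[ z ] Cone⁺ F z a) else tints G F a)

      tints-in : ∀ {F} → (∀ c → In (lookup F c)) → ∀ a → tints⁺ F a ≡ tints G* (map π F) a
      tints-in F-in a rewrite is⁺ F-in = refl

      tints-old : ∀ {F} → (∀ c → lookup F c ≢ J) → ∀ a → tints⁺ F a ≡ tints G F a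
      tints-old {F} F≢J a with is (∀ c → In (lookup F c)) in eqn
      ... | false rewrite is-false {∃[ c ] lookup F c ≡ J} (λ { (c , e) → F≢J c e }) = refl
      ... | true = trans (cong (λ v → tints G* v a) (sym (map-s⁺ {ls = ls} at)))
                     (trans (sym (tints≡ same ls old a)) (cong (λ v → tints G v a) (lookup-ext λ c →
                       trans (lookup-map c (lookup s) ls) (trans (sym (s⁺-old (old c))) (at c)))))
        where
        found : ∀ c → ∃[ l ] (l ≢ i × lookup s⁺ l ≡ lookup F c)
        found c = In-old (is⁻ eqn c) (F≢J c)
        ls : Vec (Fin m) m₁
        ls = tabulate (λ c → proj₁ (found c))
        old : ∀ c → lookup ls c ≢ i
        old c rewrite lookup∘tabulate (λ c → proj₁ (found c)) c = proj₁ (proj₂ (found c))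
        at : ∀ c → lookup s⁺ (lookup ls c) ≡ lookup F c
        at c rewrite lookup∘tabulate (λ c → proj₁ (found c)) c = proj₂ (proj₂ (found c))

      tints-new : ∀ {F} → ¬ (∀ c → In (lookup F c)) → ∃[ c ] lookup F c ≡ J → ∀ a →
                  tints⁺ F a ≡ is (∃[ z ] Cone⁺ F z a)
      tints-new {F} F-out J∈F a rewrite is-false {∀ c → In (lookup F c)} F-out | is⁺ J∈F = refl

    Cone⁺-In : ∀ {F z a} → Cone⁺ F z a → ∃[ c ] lookup F c ≡ J → In z
    Cone⁺-In (cone _ lz) (c , refl) = linked-from-J (lz c)

    Cone⁺-J-In : ∀ {F a} → Cone⁺ F J a → ∀ c → In (lookup F c)
    Cone⁺-J-In (cone _ lz) c = linked-to-J (lz c)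

    Base⁺≢J : ∀ F {a} → Base⁺ F → sort⁺ J ≡ apex a → ∀ c → lookup F c ≢ J
    Base⁺≢J F bs sJ c eqn = base≢apex (trans (sym (bs c)) (trans (cong sort⁺ eqn) sJ))

    -- Nodes linked to `J` lie in the tuple, whose `m` positions are used up by `J` and the first
    -- base. So the second base consists of nodes of the first, matched by their sorts.
    unique-base : ∀ {F F′ a b} → Base⁺ F → Cone⁺ F J a → Base⁺ F′ → Cone⁺ F′ J b → F′ ≡ F
    unique-base {F} {F′} bs cn bs′ cn′ = lookup-ext λ c → same-node c
      where
      same-node : ∀ c → lookup F′ c ≡ lookup F c
      same-node c with cover F bs (Cone⁺-J-In cn) In-J (apex≡ cn) (Cone⁺-J-In cn′ c) (Base⁺≢J F′ bs′ (apex≡ cn) c)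
      ... | c′ , eqn with base-injective (trans (sym (bs c′)) (trans (cong sort⁺ eqn) (bs′ c)))
      ... | refl = sym eqn

    old-Base : ∀ F → (∀ c → lookup F c ≢ J) → Base⁺ F → Base G F
    old-Base F F≢J bs c = trans (sym (sort-old (F≢J c))) (bs c)

    Cone≢J : ∀ {F z a} → Cone G F z a → z ≢ J
    Cone≢J (cone _ lz) refl = case trans (sym (lz fzero)) (proj₂ (fresh J _ ℕ.≤-refl)) of λ ()

    new-Cone : ∀ {F z a} → (∀ c → lookup F c ≢ J) → Cone G F z a → Cone⁺ F z a
    new-Cone {F} {z} F≢J (cone sz lz) = cone (trans (sort-old z≢J) sz) λ c → trans (link-old (F≢J c) z≢J) (lz c)
      where z≢J = Cone≢J {F} (cone sz lz)

    old-Cone : ∀ {F z a} → (∀ c → lookup F c ≢ J) → z ≢ J → Cone⁺ F z a → Cone G F z a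
    old-Cone F≢J z≢J (cone sz lz) = cone (trans (sym (sort-old z≢J)) sz) λ c → trans (sym (link-old (F≢J c) z≢J)) (lz c)

    -- Under this condition `nonwhite` leaves no white label for an edge between apexes `J` and `w`
    -- of different tints.
    Forced : ℕ → Set
    Forced w = ∀ c → ∃[ x ] (sort⁺ x ≡ base c × link⁺ x J ≡ true × link⁺ x w ≡ true)

    Forced-base : ∀ {w a} → sort⁺ J ≡ apex a → Forced w → ∃[ F ] (Base⁺ F × Cone⁺ F J a × (∀ c → link⁺ (lookup F c) w ≡ true))
    Forced-base {w} sJ fw = F , (λ c → at (λ x → sort⁺ x ≡ base c) c (proj₁ (proj₂ (fw c)))) ,
      cone sJ (λ c → at (λ x → link⁺ x J ≡ true) c (proj₁ (proj₂ (proj₂ (fw c))))) ,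
      (λ c → at (λ x → link⁺ x w ≡ true) c (proj₂ (proj₂ (proj₂ (fw c)))))
      where
      F = tabulate (λ c → proj₁ (fw c))
      at : (P : ℕ → Set) → ∀ c → P (proj₁ (fw c)) → P (lookup F c)
      at P c p = subst P (sym (lookup∘tabulate (λ c → proj₁ (fw c)) c)) p

    Unforced : Fin m₁ → ℕ → Set
    Unforced c w = ∀ x → sort⁺ x ≡ base c → link⁺ x J ≡ true → ¬ link⁺ x w ≡ true

    -- What `Indexed` will demand over `F` once `J` is present with tint `a`, expressed through `G`
    -- and the intended labels, as the new structure is not yet defined.
    record Indexing (up down : ℕ → Label) (F : Vec ℕ m₁) (a : ℕ) : Set where
      field
        old : Indexed G k F
      open Indexed old public
      field
        roomᵃ : 2 ^ k ≤ h a
        upᵃ   : ∀ {w b} → Cone G F w b → a < b → up w ≡ red (h b) × 2 ^ k + h b ≤ h a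
        downᵃ : ∀ {w b} → Cone G F w b → b < a → down w ≡ red (h a) × 2 ^ k + h a ≤ h b

    -- The labels imposed on the edges between J and the apexes of the base of J:
    -- up w for the edge from J to w, down w for the edge from w to J.
    record Plan (up down : ℕ → Label) (F : Vec ℕ m₁) (a : ℕ) : Set where
      field
        up-red    : ∀ {w b} → Cone G F w b → a < b → ∃[ p ] up w ≡ red p
        down-red  : ∀ {w b} → Cone G F w b → b < a → ∃[ p ] down w ≡ red p
        lowest    : ∀ {w u b c p q} → Cone G F w b → Cone G F u c → a < b → b < c →
                    up w ≡ red p → label G w u ≡ red q → q < p
        between   : ∀ {w u b c p q} → Cone G F w b → Cone G F u c → b < a → a < c →
                    down w ≡ red p → up u ≡ red q → q < p
        highest   : ∀ {w u b c p q} → Cone G F w b → Cone G F u c → b < c → c < a →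
                    label G w u ≡ red p → down u ≡ red q → q < p
        outcome   : (∀ b → tints G F b ≡ true → b ≡ a ⊎ ∃[ z ] Cone G F z b) ⊎
                    Indexing up down F a

    Base-π : ∀ F → Base⁺ F → (∀ c → In (lookup F c)) → Base G* (map π F)
    Base-π F bs F-in c = trans (cong (sort G*) (lookup-map c π F)) (trans (sym (sort-in (F-in c))) (bs c))

    Cone-π : ∀ {F z a} → Cone⁺ F z a → (∀ c → In (lookup F c)) → In z → Cone G* (map π F) (π z) a
    Cone-π {F} {z} (cone sz lz) F-in iz = cone (trans (sym (sort-in iz)) sz)
      λ c → trans (cong (λ p → link G* p (π z)) (lookup-map c π F)) (trans (sym (link-in (F-in c) iz)) (lz c))

    module Labelled (up down : ℕ → Label)
      (plan : ∀ F a → Base⁺ F → Cone⁺ F J a → Plan up down F a) where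

      forced : ∀ {w} → ¬ (∃[ c ] Unforced c w) → Forced w
      forced none c = dne λ no-x → none (c , λ x sx xJ xw → no-x (x , sx , xJ , xw))

      choose : {w : ℕ} → Dec (∃[ c ] Unforced c w) → Label → Label
      choose (yes (c , _)) _ = white c
      choose (no _)        ℓ = ℓ

      opaque
        unless-white : ℕ → Label → Label
        unless-white w = choose (em {∃[ c ] Unforced c w})

        unless-white-spec : ∀ w ℓ → (∃[ c ] (Unforced c w × unless-white w ℓ ≡ white c)) ⊎ (Forced w × unless-white w ℓ ≡ ℓ)
        unless-white-spec w ℓ with em {∃[ c ] Unforced c w}
        ... | yes (c , uf) = inj₁ (c , uf , refl)
        ... | no none      = inj₂ (forced none , refl)

      opaque
        -- Towards a node outside the tuple a white is taken whenever some white is harmless, and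
        -- the planned label otherwise. Thus a red edge between an apex `J` and an apex outside the
        -- tuple betrays a base common to both.
        label⁺ : ℕ → ℕ → Label
        label⁺ p q = if is (In p × In q) then label G* (π p) (π q)
                     else (if is (p ≡ J) then unless-white q (up q)
                     else (if is (q ≡ J) then unless-white p (down p)
                     else label G p q))

        label-in : ∀ {p q} → In p → In q → label⁺ p q ≡ label G* (π p) (π q)
        label-in ip iq rewrite is⁺ (ip , iq) = refl

        label-old : ∀ {p q} → p ≢ J → q ≢ J → label⁺ p q ≡ label G p q
        label-old {p} {q} p≢J q≢J with is (In p × In q) in eqn
        ... | false rewrite is-false p≢J | is-false q≢J = refl
        ... | true with In-old (proj₁ (is⁻ eqn)) p≢J | In-old (proj₂ (is⁻ eqn)) q≢J
        ...   | l , l≢i , refl | l′ , l′≢i , refl =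
          trans (cong₂ (label G*) (π-s⁺ l) (π-s⁺ l′))
            (trans (sym (label≡ same l≢i l′≢i)) (cong₂ (label G) (sym (s⁺-old l≢i)) (sym (s⁺-old l′≢i))))

        label-up : ∀ {w} → ¬ In w → (∃[ c ] (Unforced c w × label⁺ J w ≡ white c)) ⊎ (Forced w × label⁺ J w ≡ up w)
        label-up {w} w-out rewrite is-false {In J × In w} (w-out ∘ proj₂) | is⁺ {J ≡ J} refl = unless-white-spec w (up w)

        label-down : ∀ {w} → ¬ In w → (∃[ c ] (Unforced c w × label⁺ w J ≡ white c)) ⊎ (Forced w × label⁺ w J ≡ down w)
        label-down {w} w-out rewrite is-false {In w × In J} (w-out ∘ proj₁) | is-false {w ≡ J} (λ { refl → w-out In-J })
          | is⁺ {J ≡ J} refl = unless-white-spec w (down w)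

      G⁺ : Structure
      G⁺ = record { sort = sort⁺ ; link = link⁺ ; label = label⁺ ; tints = tints⁺ }

      agree : Agree (_≢ J) G G⁺
      agree = record { sort≡ = sym ∘ sort-old ; link≡ = λ p q → sym (link-old p q)
                     ; label≡ = λ p q → sym (label-old p q) ; tints≡ = λ F p a → sym (tints-old p a) }

      same⁺ : ∀ {D} → Same D G⁺ s⁺ G* s*
      same⁺ = record
        { eq⇒ = λ _ _ → pattern⇒ ; eq⇐ = λ _ _ → pattern⇐
        ; sort≡ = λ {j} _ → trans (sort-in (j , refl)) (cong (sort G*) (π-s⁺ j))
        ; link≡ = λ {j} {l} _ _ → trans (link-in (j , refl) (l , refl)) (cong₂ (link G*) (π-s⁺ j) (π-s⁺ l))
        ; label≡ = λ {j} {l} _ _ → trans (label-in (j , refl) (l , refl)) (cong₂ (label G*) (π-s⁺ j) (π-s⁺ l))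
        ; tints≡ = λ v _ a → trans
            (tints-in (λ c → lookup v c , sym (lookup-map c (lookup s⁺) v)) a)
            (cong (λ u → tints G* u a) (sym (map-s⁺ {ls = v} (λ c → sym (lookup-map c (lookup s⁺) v))))) }

      fresh⁺ : Fresh G⁺ (suc J)
      fresh⁺ p q J<p = off (λ e → out (proj₁ (link-J⊎ e))) , off (λ e → out (proj₂ (link-J⊎′ e)))
        where
        off : ∀ {b} → ¬ b ≡ true → b ≡ false
        off {false} _ = refl
        off {true} n = contradiction refl n
        p≢J : p ≢ J
        p≢J refl = ℕ.1+n≰n J<p
        out : ¬ In p
        out ip with In-old ip p≢J
        ... | l , l≢i , refl = ℕ.<-asym J<p (subst (_< J) (sym (s⁺-old l≢i)) (s<J l))
        link-J⊎ : link⁺ p q ≡ true → In p × In q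
        link-J⊎ e with em {q ≡ J}
        ... | yes refl = link-J e (inj₂ refl)
        ... | no q≢J = case trans (sym e) (trans (link-old p≢J q≢J) (proj₁ (fresh p q (ℕ.<⇒≤ J<p)))) of λ ()
        link-J⊎′ : link⁺ q p ≡ true → In q × In p
        link-J⊎′ e with em {q ≡ J}
        ... | yes refl = link-J e (inj₁ refl)
        ... | no q≢J = case trans (sym e) (trans (link-old q≢J p≢J) (proj₂ (fresh p q (ℕ.<⇒≤ J<p)))) of λ ()

      module Apex {a} (sJ : sort⁺ J ≡ apex a) where

        forced-cone : ∀ {w b} → w ≢ J → sort⁺ w ≡ apex b → Forced w →
                      ∃[ F ] (Base⁺ F × Cone⁺ F J a × Cone G F w b)
        forced-cone w≢J sw fw with Forced-base sJ fw
        ... | F , bs , cJ , cw = F , bs , cJ , old-Cone (Base⁺≢J F bs sJ) w≢J (cone sw cw)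

        outside : ∀ {F w b} → Base⁺ F → Cone⁺ F J a → Cone G F w b → ¬ In w
        outside {F} bs cJ cw iw with cover F bs (Cone⁺-J-In cJ) In-J sJ iw (Cone≢J cw)
        ... | c , eqn = base≢apex (trans (sym (bs c)) (trans (cong sort⁺ eqn) (trans (sort-old (Cone≢J cw)) (apex≡ cw))))

        must-up : ∀ {F w b} → Base⁺ F → Cone⁺ F J a → Cone G F w b → label⁺ J w ≡ up w
        must-up {F} bs cJ cw with label-up (outside bs cJ cw)
        ... | inj₁ (c , uf , _) = contradiction (linked (new-Cone (Base⁺≢J F bs sJ) cw) c) (uf _ (bs c) (linked cJ c))
        ... | inj₂ (_ , eqn) = eqn

        must-down : ∀ {F w b} → Base⁺ F → Cone⁺ F J a → Cone G F w b → label⁺ w J ≡ down w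
        must-down {F} bs cJ cw with label-down (outside bs cJ cw)
        ... | inj₁ (c , uf , _) = contradiction (linked (new-Cone (Base⁺≢J F bs sJ) cw) c) (uf _ (bs c) (linked cJ c))
        ... | inj₂ (_ , eqn) = eqn

        apex-out : ∀ {F v b} → Base⁺ F → Cone⁺ F J a → v ≢ J → sort⁺ v ≡ apex b → ¬ In v
        apex-out {F} bs cJ v≢J sv iv with cover F bs (Cone⁺-J-In cJ) In-J sJ iv v≢J
        ... | c , eqn = base≢apex (trans (sym (bs c)) (trans (cong sort⁺ eqn) sv))

        RedTo : ℕ → Set
        RedTo w = (∃[ p ] label⁺ J w ≡ red p) ⊎ (∃[ p ] label⁺ w J ≡ red p)

        red⇒cone : ∀ {w b} → w ≢ J → sort⁺ w ≡ apex b → RedTo w → ¬ In w →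
                   ∃[ F ] (Base⁺ F × Cone⁺ F J a × Cone G F w b)
        red⇒cone w≢J sw (inj₁ (_ , eqn)) w-out with label-up w-out
        ... | inj₁ (_ , _ , eq′) = case trans (sym eqn) eq′ of λ ()
        ... | inj₂ (fw , _)      = forced-cone w≢J sw fw
        red⇒cone w≢J sw (inj₂ (_ , eqn)) w-out with label-down w-out
        ... | inj₁ (_ , _ , eq′) = case trans (sym eqn) eq′ of λ ()
        ... | inj₂ (fw , _)      = forced-cone w≢J sw fw

        -- For the two vertices other than `J` of a red triangle. A red edge that leaves the tuple
        -- yields a base of `J`, which together with `J` exhausts the tuple, so the other apex is
        -- outside as well. The two bases obtained are equal by `unique-base`.
        red-pair : ∀ {w u b c} → w ≢ J → sort⁺ w ≡ apex b → RedTo w → u ≢ J → sort⁺ u ≡ apex c → RedTo u →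
                   ¬ (In w × In u) → ∃[ F ] (Base⁺ F × Cone⁺ F J a × Cone G F w b × Cone G F u c)
        red-pair {w} {u} {b} {c} w≢J sw rw u≢J su ru out = combine (red⇒cone w≢J sw rw w-out) (red⇒cone u≢J su ru u-out)
          where
          w-out : ¬ In w
          w-out iw = let F , bs , cJ , _ = red⇒cone u≢J su ru (λ iu → out (iw , iu)) in apex-out bs cJ w≢J sw iw
          u-out : ¬ In u
          u-out iu = let F , bs , cJ , _ = red⇒cone w≢J sw rw w-out in apex-out bs cJ u≢J su iu
          combine : ∃[ F ] (Base⁺ F × Cone⁺ F J a × Cone G F w b) → ∃[ F ] (Base⁺ F × Cone⁺ F J a × Cone G F u c) →
                 ∃[ F ] (Base⁺ F × Cone⁺ F J a × Cone G F w b × Cone G F u c)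
          combine (F , bs , cJ , cw) (F′ , bs′ , cJ′ , cu) with unique-base bs cJ bs′ cJ′
          ... | refl = F , bs , cJ , cw , cu

      open Valid

      allowed⁺ : ∀ F z a → Base⁺ F → Cone⁺ F z a → tints⁺ F a ≡ true
      allowed⁺ F z a bs cz with em {∃[ c ] lookup F c ≡ J}
      ... | yes J∈F = case em {∀ c → In (lookup F c)} of λ
        { (yes F-in) → trans (tints-in F-in a) (allowed valid* _ _ a (Base-π F bs F-in) (Cone-π cz F-in (Cone⁺-In cz J∈F)))
        ; (no F-out) → trans (tints-new F-out J∈F a) (is⁺ (z , cz)) }
      ... | no J∉F = case em {z ≡ J} of λ
        { (yes refl) → trans (tints-in (Cone⁺-J-In cz) a)
            (allowed valid* _ _ a (Base-π F bs (Cone⁺-J-In cz)) (Cone-π cz (Cone⁺-J-In cz) In-J))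
        ; (no z≢J) → trans (tints-old F≢J a) (allowed valid F z a (old-Base F F≢J bs) (old-Cone F≢J z≢J cz)) }
        where
        F≢J : ∀ c → lookup F c ≢ J
        F≢J c eqn = J∉F (c , eqn)

      old-sort : ∀ {p r} → p ≢ J → sort⁺ p ≡ r → sort G p ≡ r
      old-sort p≢J eqn = trans (sym (sort-old p≢J)) eqn

      in-sort : ∀ {p r} → In p → sort⁺ p ≡ r → sort G* (π p) ≡ r
      in-sort ip eqn = trans (sym (sort-in ip)) eqn

      -- A label chosen here occurs only if one of `z`, `w` is `J` and the other lies outside the
      -- tuple. If it is white, its sort was chosen for having no common neighbour such as `x`; if
      -- it is planned, the plan makes it red.
      nonwhite⁺ : ∀ {x z w c a b} → sort⁺ x ≡ base c → sort⁺ z ≡ apex a → sort⁺ w ≡ apex b → a < b →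
                  link⁺ x z ≡ true → link⁺ x w ≡ true → label⁺ z w ≢ white c
      nonwhite⁺ {x} {z} {w} sx sz sw a<b xz xw eqn with em {In z} | em {In w} | em {In x} | em {x ≡ J} | em {z ≡ J} | em {w ≡ J}
      ... | yes iz | yes iw | yes ix | _ | _ | _ =
        nonwhite valid* (in-sort ix sx) (in-sort iz sz) (in-sort iw sw) a<b
          (trans (sym (link-in ix iz)) xz) (trans (sym (link-in ix iw)) xw) (trans (sym (label-in iz iw)) eqn)
      ... | no z-out | _ | _ | yes refl | _ | _ = z-out (linked-from-J xz)
      ... | no z-out | _ | _ | no x≢J | yes refl | _ = z-out In-J
      ... | no z-out | _ | _ | no x≢J | no z≢J | yes refl with label-down z-out
      ...   | inj₁ (c , uf , eq′) = case trans (sym eqn) eq′ of λ { refl → uf x sx xw xz }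
      ...   | inj₂ (fz , eq′) with Apex.forced-cone sw z≢J sz fz
      ...     | F , bs , cJ , cz with Plan.down-red (plan F _ bs cJ) cz a<b
      ...       | p , eq″ = case trans (sym eqn) (trans eq′ eq″) of λ ()
      nonwhite⁺ {x} {z} {w} sx sz sw a<b xz xw eqn | _ | no w-out | _ | yes refl | _ | _ = w-out (linked-from-J xw)
      nonwhite⁺ {x} {z} {w} sx sz sw a<b xz xw eqn | _ | no w-out | _ | _ | _ | yes refl = w-out In-J
      nonwhite⁺ {x} {z} {w} sx sz sw a<b xz xw eqn | _ | no w-out | _ | no x≢J | yes refl | no w≢J with label-up w-out
      ...   | inj₁ (c , uf , eq′) = case trans (sym eqn) eq′ of λ { refl → uf x sx xz xw }
      ...   | inj₂ (fw , eq′) with Apex.forced-cone sz w≢J sw fw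
      ...     | F , bs , cJ , cw with Plan.up-red (plan F _ bs cJ) cw a<b
      ...       | p , eq″ = case trans (sym eqn) (trans eq′ eq″) of λ ()
      nonwhite⁺ {x} {z} {w} sx sz sw a<b xz xw eqn | yes iz | yes iw | no x-out | yes refl | _ | _ = x-out In-J
      nonwhite⁺ {x} {z} {w} sx sz sw a<b xz xw eqn | yes iz | yes iw | no x-out | no x≢J | yes refl | _ = x-out (linked-to-J xz)
      nonwhite⁺ {x} {z} {w} sx sz sw a<b xz xw eqn | yes iz | yes iw | no x-out | no x≢J | no z≢J | yes refl = x-out (linked-to-J xw)
      nonwhite⁺ {x} {z} {w} sx sz sw a<b xz xw eqn | _ | _ | _ | no x≢J | no z≢J | no w≢J =
        nonwhite valid (old-sort x≢J sx) (old-sort z≢J sz) (old-sort w≢J sw) a<b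
          (trans (sym (link-old x≢J z≢J)) xz) (trans (sym (link-old x≢J w≢J)) xw) (trans (sym (label-old z≢J w≢J)) eqn)

      apex≢ : ∀ {p q a b} → sort⁺ p ≡ apex a → sort⁺ q ≡ apex b → a < b → p ≢ q
      apex≢ sp sq a<b refl = ℕ.<⇒≢ a<b (apex-injective (trans (sym sp) sq))

      -- Triangles inside the tuple come from `G*` and those without `J` from `G`. In the others the
      -- place of `J` among the three tints selects a clause of the plan for the base found by
      -- `red-pair`.
      descend⁺ : ∀ {z w u a b c p q r} → sort⁺ z ≡ apex a → sort⁺ w ≡ apex b → sort⁺ u ≡ apex c → a < b → b < c →
                 label⁺ z w ≡ red p → label⁺ w u ≡ red q → label⁺ z u ≡ red r → q < p
      descend⁺ {z} {w} {u} {a} {b} {c} {p} {q} {r} sz sw su a<b b<c zw wu zu with em {In z × In w × In u}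
      ... | yes (iz , iw , iu) = descend valid* (in-sort iz sz) (in-sort iw sw) (in-sort iu su) a<b b<c
          (trans (sym (label-in iz iw)) zw) (trans (sym (label-in iw iu)) wu) (trans (sym (label-in iz iu)) zu)
      ... | no some-out with em {z ≡ J} | em {w ≡ J} | em {u ≡ J}
      ...   | no z≢J | no w≢J | no u≢J = descend valid (old-sort z≢J sz) (old-sort w≢J sw) (old-sort u≢J su) a<b b<c
          (trans (sym (label-old z≢J w≢J)) zw) (trans (sym (label-old w≢J u≢J)) wu) (trans (sym (label-old z≢J u≢J)) zu)
      ...   | yes refl | _ | _ =
        let open Apex sz
            w≢J = λ e → apex≢ sz sw a<b (sym e)
            u≢J = λ e → apex≢ sz su (ℕ.<-trans a<b b<c) (sym e)
            F , bs , cJ , cw , cu = red-pair w≢J sw (inj₁ (_ , zw)) u≢J su (inj₁ (_ , zu)) (λ io → some-out (In-J , io))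
        in Plan.lowest (plan F _ bs cJ) cw cu a<b b<c (trans (sym (must-up bs cJ cw)) zw)
             (trans (sym (label-old w≢J u≢J)) wu)
      ...   | no z≢J | yes refl | _ =
        let open Apex sw
            u≢J = λ e → apex≢ sw su b<c (sym e)
            F , bs , cJ , cz , cu = red-pair z≢J sz (inj₂ (_ , zw)) u≢J su (inj₁ (_ , wu))
                                      (λ io → some-out (proj₁ io , In-J , proj₂ io))
        in Plan.between (plan F _ bs cJ) cz cu a<b b<c (trans (sym (must-down bs cJ cz)) zw)
             (trans (sym (must-up bs cJ cu)) wu)
      ...   | no z≢J | no w≢J | yes refl =
        let open Apex su
            F , bs , cJ , cz , cw = red-pair z≢J sz (inj₂ (_ , zu)) w≢J sw (inj₂ (_ , wu))
                                      (λ io → some-out (proj₁ io , proj₂ io , In-J))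
        in Plan.highest (plan F _ bs cJ) cz cw a<b b<c (trans (sym (label-old z≢J w≢J)) zw)
             (trans (sym (must-down bs cJ cw)) wu)

      valid⁺ : Valid G⁺
      valid⁺ = record { allowed = allowed⁺ ; nonwhite = nonwhite⁺ ; descend = descend⁺ }

      good⁺ : Good G⁺ k
      good⁺ F bs with em {∃[ c ] lookup F c ≡ J}
      ... | yes J∈F = case em {∀ c → In (lookup F c)} of λ
        { (no F-out) → inj₁ (λ a t → is⁻ (trans (sym (tints-new F-out J∈F a)) t))
        -- Apexes over a base that contains `J` lie in the tuple, and next to `F` the tuple has room
        -- for only one. No gap has to be respected, and the constant `2 ^ k` provides the room.
        ; (yes F-in) → inj₂ (record
          { h = λ _ → 2 ^ k
          ; shown = λ cz cw a<b → contradiction a<b (lone F-in cz cw)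
          ; gap = λ cz cw a<b → contradiction a<b (lone F-in cz cw)
          ; room = λ _ → ℕ.≤-refl }) }
        where
        lone : (∀ c → In (lookup F c)) → ∀ {z w a b} → Cone⁺ F z a → Cone⁺ F w b → ¬ a < b
        lone F-in cz cw a<b with cover F bs F-in (Cone⁺-In cz J∈F) (apex≡ cz) (Cone⁺-In cw J∈F)
                                   (λ e → apex≢ (apex≡ cz) (apex≡ cw) a<b (sym e))
        ... | c , eqn = base≢apex (trans (sym (bs c)) (trans (cong sort⁺ eqn) (apex≡ cw)))
      ... | no J∉F with em {∃[ a ] Cone⁺ F J a}
      ...   | no J-off = case good F (old-Base F F≢J bs) of λ
        { (inj₁ sat) → inj₁ λ a t → case sat a (trans (sym (tints-old F≢J a)) t) of λ
            { (z , cz) → z , new-Cone F≢J cz }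
        ; (inj₂ ix) → let open Indexed (Indexed-pred ix) in inj₂ (record
            { h = h
            ; shown = λ cz cw a<b → trans (label-old (z≢J cz) (z≢J cw)) (shown (oldC cz) (oldC cw) a<b)
            ; gap = λ cz cw a<b → gap (oldC cz) (oldC cw) a<b
            ; room = λ cz → room (oldC cz) }) }
        where
        F≢J : ∀ c → lookup F c ≢ J
        F≢J c eqn = J∉F (c , eqn)
        z≢J : ∀ {z a} → Cone⁺ F z a → z ≢ J
        z≢J cz refl = J-off (_ , cz)
        oldC : ∀ {z a} → Cone⁺ F z a → Cone G F z a
        oldC cz = old-Cone F≢J (z≢J cz) cz
      ...   | yes (a , cJ) = case outcome of λ
        { (inj₁ sat) → inj₁ λ b t → case sat b (trans (sym (tints-old F≢J b)) t) of λ
            { (inj₁ refl) → J , cJ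
            ; (inj₂ (z , cz)) → z , new-Cone F≢J cz }
        ; (inj₂ ix) → let open Indexing ix in inj₂ (record
            { h = h
            ; shown = λ {z} {w} cz cw b<c → case (em {z ≡ J} , em {w ≡ J}) of λ
                { (yes refl , yes refl) → contradiction refl (apex≢ (apex≡ cz) (apex≡ cw) b<c)
                ; (yes refl , no w≢J) → let cw′ = old-Cone F≢J w≢J cw in
                    trans (must-up bs cJ cw′) (proj₁ (upᵃ cw′ (subst (_< _) (tint cz) b<c)))
                ; (no z≢J , yes refl) → let cz′ = old-Cone F≢J z≢J cz in
                    trans (must-down bs cJ cz′) (trans (proj₁ (downᵃ cz′ (subst (_ <_) (tint cw) b<c))) (cong (red ∘ h) (sym (tint cw))))
                ; (no z≢J , no w≢J) → trans (label-old z≢J w≢J) (shown (old-Cone F≢J z≢J cz) (old-Cone F≢J w≢J cw) b<c) }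
            ; gap = λ {z} {w} cz cw b<c → case (em {z ≡ J} , em {w ≡ J}) of λ
                { (yes refl , yes refl) → contradiction refl (apex≢ (apex≡ cz) (apex≡ cw) b<c)
                ; (yes refl , no w≢J) → let cw′ = old-Cone F≢J w≢J cw in
                    ℕ.≤-trans (proj₂ (upᵃ cw′ (subst (_< _) (tint cz) b<c))) (ℕ.≤-reflexive (cong h (sym (tint cz))))
                ; (no z≢J , yes refl) → let cz′ = old-Cone F≢J z≢J cz in
                    ℕ.≤-trans (ℕ.≤-reflexive (cong (λ b → 2 ^ k + h b) (tint cw))) (proj₂ (downᵃ cz′ (subst (_ <_) (tint cw) b<c)))
                ; (no z≢J , no w≢J) → gap (old-Cone F≢J z≢J cz) (old-Cone F≢J w≢J cw) b<c }
            ; room = λ {z} cz → case em {z ≡ J} of λ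
                { (yes refl) → ℕ.≤-trans roomᵃ (ℕ.≤-reflexive (cong h (sym (tint cz))))
                ; (no z≢J) → room (old-Cone F≢J z≢J cz) } }) }
        where
        open Apex (apex≡ cJ)
        open Plan (plan F a bs cJ)
        F≢J : ∀ c → lookup F c ≢ J
        F≢J c eqn = J∉F (c , eqn)
        tint : ∀ {b} → Cone⁺ F J b → b ≡ a
        tint c′ = apex-injective (trans (sym (apex≡ c′)) (apex≡ cJ))

    open Valid

    Extension : Set
    Extension = ∃[ G⁺ ] (Valid G⁺ × Good G⁺ k × Fresh G⁺ (suc J) × Agree (_≢ J) G G⁺ × Same (λ _ → ⊤) G⁺ (s [ i ]≔ J) G* s*)

    extension : ∀ up down → (∀ F a → Base⁺ F → Cone⁺ F J a → Plan up down F a) → Extension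
    extension up down plan = G⁺ , valid⁺ , good⁺ , fresh⁺ , agree , subst (λ v → Same _ G⁺ v G* s*) s⁺-def same⁺
      where open Labelled up down plan

    -- `J` becomes a twin of `w₀`. Each triangle at `J` is then a triangle of `G` at `w₀`, and the
    -- third red edge that `descend` asks for exists because all three apexes share the base `F`.
    copy-plan : ∀ F a → Base⁺ F → Cone⁺ F J a → ∀ w₀ → Cone G F w₀ a →
                Plan (λ w → label G w₀ w) (λ w → label G w w₀) F a
    copy-plan F a bs cJ w₀ c₀ = record
      { up-red = λ cw a<b → cone-red valid bs′ c₀ cw a<b
      ; down-red = λ cw b<a → cone-red valid bs′ cw c₀ b<a
      ; lowest = λ cw cu a<b b<c eqn eq′ → descend valid (apex≡ c₀) (apex≡ cw) (apex≡ cu) a<b b<c eqn eq′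
                   (proj₂ (cone-red valid bs′ c₀ cu (ℕ.<-trans a<b b<c)))
      ; between = λ cw cu b<a a<c eqn eq′ → descend valid (apex≡ cw) (apex≡ c₀) (apex≡ cu) b<a a<c eqn eq′
                   (proj₂ (cone-red valid bs′ cw cu (ℕ.<-trans b<a a<c)))
      ; highest = λ cw cu b<c c<a eqn eq′ → descend valid (apex≡ cw) (apex≡ cu) (apex≡ c₀) b<c c<a eqn eq′
                   (proj₂ (cone-red valid bs′ cw c₀ (ℕ.<-trans b<c c<a)))
      ; outcome = case good F bs′ of λ
          { (inj₁ sat) → inj₁ λ b t → inj₂ (sat b t)
          ; (inj₂ ix) → let open Indexed (Indexed-pred ix) in inj₂ (record
              { old = Indexed-pred ix
              ; roomᵃ = room c₀
              ; upᵃ = λ cw a<b → shown c₀ cw a<b , gap c₀ cw a<b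
              ; downᵃ = λ cw b<a → shown cw c₀ b<a , gap cw c₀ b<a }) } }
      where
      bs′ : Base G F
      bs′ = old-Base F (Base⁺≢J F bs (apex≡ cJ)) bs

    -- The index of the new tint a is 2 ^ k above that of the next tint.
    module Insert (F : Vec ℕ m₁) (a : ℕ) (ix : Indexed G (suc k) F) (new : ∀ {w} → ¬ Cone G F w a) where
      open Indexed ix

      Above : ℕ → Set
      Above b = a < b × ∃[ w ] Cone G F w b

      next-index : Dec (∃[ b ] (Above b × (∀ c → c < b → ¬ Above c))) → ℕ
      next-index (yes (b , _)) = h b
      next-index (no _)        = 0

      next? : Dec (∃[ b ] (Above b × (∀ c → c < b → ¬ Above c)))
      next? = em

      hᵃ : ℕ
      hᵃ = 2 ^ k + next-index next?

      -- Indices decrease as tints grow, so among the tints above `a` the next one has the largest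
      -- index.
      above : ∀ {w b} → Cone G F w b → a < b → 2 ^ k + h b ≤ hᵃ
      above {w} {b} cw a<b = ℕ.+-monoʳ-≤ (2 ^ k) (go next?)
        where
        go : ∀ d → h b ≤ next-index d
        go (no none) = contradiction (least Above b (a<b , w , cw)) none
        go (yes (b′ , (a<b′ , w′ , cw′) , min)) with ℕ.<-cmp b b′
        ... | tri< b<b′ _ _ = contradiction (a<b , w , cw) (min b b<b′)
        ... | tri≈ _ refl _ = ℕ.≤-refl
        ... | tri> _ _ b′<b = ℕ.≤-trans (ℕ.m≤n+m _ _) (gap cw′ cw b′<b)

      -- The gap `2 ^ suc k` around the place of `a` splits into two halves `2 ^ k`, one on either
      -- side of the new index. If no tint lies above `a`, `room` takes the part of the gap.
      below : ∀ {w b} → Cone G F w b → b < a → 2 ^ k + hᵃ ≤ h b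
      below {w} {b} cw b<a = subst (_≤ h b) (trans (cong (_+ next-index next?) (2^-suc k)) (ℕ.+-assoc (2 ^ k) (2 ^ k) _)) (go next?)
        where
        go : ∀ d → 2 ^ suc k + next-index d ≤ h b
        go (no _) = subst (_≤ h b) (sym (ℕ.+-identityʳ _)) (room cw)
        go (yes (b′ , (a<b′ , w′ , cw′) , _)) = gap cw cw′ (ℕ.<-trans b<a a<b′)

      h⁺ : ℕ → ℕ
      h⁺ b = if is (b ≡ a) then hᵃ else h b

      h⁺-a : h⁺ a ≡ hᵃ
      h⁺-a rewrite is⁺ {a ≡ a} refl = refl

      h⁺-old : ∀ {w b} → Cone G F w b → h⁺ b ≡ h b
      h⁺-old {w} {b} cw rewrite is-false {b ≡ a} (λ { refl → new cw }) = refl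

      red-of : Sort → Label
      red-of (apex b) = red (h⁺ b)
      red-of (base _) = red 0

      up down : ℕ → Label
      up w   = red-of (sort G w)
      down _ = red (h⁺ a)

      up≡ : ∀ {w b} → Cone G F w b → up w ≡ red (h⁺ b)
      up≡ cw = cong red-of (apex≡ cw)

      strict : ∀ {x y} → 2 ^ k + x ≤ y → x < y
      strict {x} = ℕ.≤-trans (ℕ.+-monoˡ-≤ x (ℕ.m^n>0 2 k))

      above⁺ : ∀ {w b} → Cone G F w b → a < b → 2 ^ k + h⁺ b ≤ h⁺ a
      above⁺ cw a<b = subst₂ (λ x y → 2 ^ k + x ≤ y) (sym (h⁺-old cw)) (sym h⁺-a) (above cw a<b)

      below⁺ : ∀ {w b} → Cone G F w b → b < a → 2 ^ k + h⁺ a ≤ h⁺ b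
      below⁺ cw b<a = subst₂ (λ x y → 2 ^ k + x ≤ y) (sym h⁺-a) (sym (h⁺-old cw)) (below cw b<a)

      ix⁻ : Indexed G k F
      ix⁻ = Indexed-pred ix

      indexed⁺ : Indexed G k F
      indexed⁺ = record
        { h = h⁺
        ; shown = λ cz cw b<c → trans (shown cz cw b<c) (cong red (sym (h⁺-old cw)))
        ; gap = λ cz cw b<c → subst₂ (λ x y → 2 ^ k + x ≤ y) (sym (h⁺-old cw)) (sym (h⁺-old cz)) (Indexed.gap ix⁻ cz cw b<c)
        ; room = λ cz → subst (2 ^ k ≤_) (sym (h⁺-old cz)) (Indexed.room ix⁻ cz) }

      insert-plan : Plan up down F a
      insert-plan = record
        { up-red = λ cw _ → _ , up≡ cw
        ; down-red = λ _ _ → _ , refl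
        ; lowest = λ cw cu a<b b<c eqn eq′ →
            subst₂ _<_ (red-injective (trans (sym (shown cw cu b<c)) eq′))
                       (trans (sym (h⁺-old cw)) (red-injective (trans (sym (up≡ cw)) eqn))) (strict (Indexed.gap ix⁻ cw cu b<c))
        ; between = λ cw cu b<a a<c eqn eq′ →
            subst₂ _<_ (red-injective (trans (sym (up≡ cu)) eq′)) (red-injective eqn) (strict (above⁺ cu a<c))
        ; highest = λ cw cu b<c c<a eqn eq′ →
            subst₂ _<_ (red-injective eq′) (trans (h⁺-old cu) (red-injective (trans (sym (shown cw cu b<c)) eqn))) (strict (below⁺ cu c<a))
        ; outcome = inj₂ (record
            { old = indexed⁺
            ; roomᵃ = subst (2 ^ k ≤_) (sym h⁺-a) (ℕ.m≤m+n _ _)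
            ; upᵃ = λ cw a<b → up≡ cw , above⁺ cw a<b
            ; downᵃ = λ cw b<a → refl , below⁺ cw b<a }) }

    extend : Extension
    extend with em {∃[ F ] ∃[ a ] (Base⁺ F × Cone⁺ F J a)}
    ... | no none = extension (λ _ → red 0) (λ _ → red 0) (λ F a bs cJ → contradiction (F , a , bs , cJ) none)
    ... | yes (F , a , bs , cJ) = case em {∃[ w ] Cone G F w a} of λ
      { (yes (w₀ , c₀)) → only _ _ (copy-plan F a bs cJ w₀ c₀)
      ; (no new) → case good F bs′ of λ
        { (inj₁ sat) → contradiction (sat a (trans (sym (tints-old F≢J a)) tinted)) new
        ; (inj₂ ix) → let open Insert F a ix (λ {w} cw → new (w , cw)) in only up down insert-plan } }
      where
      F≢J : ∀ c → lookup F c ≢ J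
      F≢J = Base⁺≢J F bs (apex≡ cJ)
      bs′ : Base G F
      bs′ = old-Base F F≢J bs
      F-in = Cone⁺-J-In cJ
      tinted : tints⁺ F a ≡ true
      tinted = trans (tints-in F-in a) (allowed valid* _ _ a (Base-π F bs F-in) (Cone-π cJ F-in In-J))
      only : ∀ up down → Plan up down F a → Extension
      only up down plan = extension up down λ F′ a′ bs′ cJ′ → case (unique-base bs cJ bs′ cJ′ , apex-injective (trans (sym (apex≡ cJ)) (apex≡ cJ′))) of λ
        { (refl , refl) → plan }

-- The algebra 𝔸 of sets of types

module ComplexAlgebra (em : {P : Set} → Dec P) (m′ : ℕ) where

  open Structures em m′
  open Structure
  open Same
  open Valid

  is-cong : {P Q : Set} → (P → Q) → (Q → P) → is P ≡ is Q
  is-cong {P} f g with em {P}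
  ... | yes p = trans (is⁺ p) (sym (is⁺ (f p)))
  ... | no ¬p = trans (is-false ¬p) (sym (is-false (¬p ∘ g)))

  ⇔⇒≡ : ∀ {b b′} → (b ≡ true → b′ ≡ true) → (b′ ≡ true → b ≡ true) → b ≡ b′
  ⇔⇒≡ {true}  {b′}    f g = sym (f refl)
  ⇔⇒≡ {false} {true}  f g = g refl
  ⇔⇒≡ {false} {false} f g = refl

  record Point : Set where
    constructor point
    field
      str   : Structure
      valid : Valid str
      tup   : Vec ℕ m
  open Point

  Type≡ : (Fin m → Set) → Point → Point → Set
  Type≡ D t u = Same D (str t) (tup t) (str u) (tup u)

  infix 4 _≋_ _∼[_]_
  _≋_ : Point → Point → Set
  _≋_ = Type≡ (λ _ → ⊤)

  _∼[_]_ : Point → Fin m → Point → Set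
  t ∼[ i ] u = Type≡ (_≢ i) t u

  ≋⇒∼ : ∀ t u {i} → t ≋ u → t ∼[ i ] u
  ≋⇒∼ t u = Same-weaken (λ _ → tt)

  Element : Set
  Element = Σ[ x ∈ (Point → Bool) ] (∀ {t u} → t ≋ u → x t ≡ x u)

  infix 4 _∋_
  _∋_ : Element → Point → Set
  x ∋ t = proj₁ x t ≡ true

  cylᴬ : Fin m → Element → Element
  cylᴬ i x = (λ t → is (∃[ u ] (t ∼[ i ] u × x ∋ u))) , λ {t} {t′} t≋t′ → is-cong
    (λ (u , t∼u , xu) → u , Same-trans (Same-sym (≋⇒∼ t t′ t≋t′)) t∼u , xu)
    (λ (u , t∼u , xu) → u , Same-trans (≋⇒∼ t t′ t≋t′) t∼u , xu)

  diagᴬ : Fin m → Fin m → Element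
  diagᴬ i j = (λ t → is (lookup (tup t) i ≡ lookup (tup t) j)) , λ t≋u →
    is-cong (eq⇒ t≋u tt tt) (eq⇐ t≋u tt tt)

  𝔸 : CylindricStructure m
  𝔸 = record
    { Carrier = Element
    ; _≈_ = λ x y → ∀ t → proj₁ x t ≡ proj₁ y t
    ; _∨_ = λ x y → (λ t → proj₁ x t ∨ proj₁ y t) , λ e → cong₂ _∨_ (proj₂ x e) (proj₂ y e)
    ; _∧_ = λ x y → (λ t → proj₁ x t ∧ proj₁ y t) , λ e → cong₂ _∧_ (proj₂ x e) (proj₂ y e)
    ; -_ = λ x → (λ t → not (proj₁ x t)) , λ e → cong not (proj₂ x e)
    ; 𝟙 = (λ _ → true) , λ _ → refl
    ; 𝟘 = (λ _ → false) , λ _ → refl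
    ; c = cylᴬ
    ; d = diagᴬ
    ; isEquivalence = record { refl = λ _ → refl ; sym = λ e t → sym (e t) ; trans = λ e f t → trans (e t) (f t) }
    ; ∨-cong = λ e f t → cong₂ _∨_ (e t) (f t)
    ; ∧-cong = λ e f t → cong₂ _∧_ (e t) (f t)
    ; -‿cong = λ e t → cong not (e t)
    ; c-cong = λ i e t → is-cong (λ (u , t∼u , xu) → u , t∼u , trans (sym (e u)) xu)
                                  (λ (u , t∼u , xu) → u , t∼u , trans (e u) xu)
    }

  open CylindricStructure 𝔸 using (_≈_; _≼_; IsAtom)

  ≼⇒ : ∀ {x y} → x ≼ y → ∀ {t} → x ∋ t → y ∋ t
  ≼⇒ {x} {y} le {t} xt with proj₁ x t | proj₁ y t | le t
  ≼⇒ le refl | true | true | _ = refl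

  ⇒≼ : ∀ x y → (∀ t → x ∋ t → y ∋ t) → x ≼ y
  ⇒≼ x y f t with proj₁ x t | proj₁ y t | f t
  ... | true  | _ | g = sym (g refl)
  ... | false | _ | _ = refl

  ∋-resp : ∀ x {t u} → t ≋ u → x ∋ t → x ∋ u
  ∋-resp x e xt = trans (sym (proj₂ x e)) xt

  ⟨_⟩ : Point → Element
  ⟨ t ⟩ = (λ u → is (t ≋ u)) , λ e → is-cong (λ f → Same-trans f e) (λ f → Same-trans f (Same-sym e))

  ⟨⟩-self : ∀ t → ⟨ t ⟩ ∋ t
  ⟨⟩-self t = is⁺ {t ≋ t} Same-refl

  ⟨⟩∋⇒≋ : ∀ t u → ⟨ t ⟩ ∋ u → t ≋ u
  ⟨⟩∋⇒≋ t u = is⁻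

  cyl⟨⟩⇐ : ∀ i t u → u ∼[ i ] t → cylᴬ i ⟨ t ⟩ ∋ u
  cyl⟨⟩⇐ i t u u∼t = is⁺ (t , u∼t , ⟨⟩-self t)

  cyl⟨⟩⇒ : ∀ i t u → cylᴬ i ⟨ t ⟩ ∋ u → u ∼[ i ] t
  cyl⟨⟩⇒ i t u e with is⁻ e
  ... | v , u∼v , tv = Same-trans u∼v (≋⇒∼ v t (Same-sym (⟨⟩∋⇒≋ t v tv)))

  ∋⇒⟨⟩≼ : ∀ {x t} → x ∋ t → ⟨ t ⟩ ≼ x
  ∋⇒⟨⟩≼ {x} {t} xt = ⇒≼ ⟨ t ⟩ x (λ u e → ∋-resp x (is⁻ e) xt)

  ⟨⟩≼⇒∋ : ∀ {x t} → ⟨ t ⟩ ≼ x → x ∋ t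
  ⟨⟩≼⇒∋ {x} {t} le = ≼⇒ {⟨ t ⟩} {x} le (⟨⟩-self t)

  ≋⇒≈ : ∀ {t u} → t ≋ u → ⟨ t ⟩ ≈ ⟨ u ⟩
  ≋⇒≈ e v = is-cong (Same-trans (Same-sym e)) (Same-trans e)

  ≈𝟘 : ∀ x → (∀ t → ¬ x ∋ t) → ∀ t → proj₁ x t ≡ false
  ≈𝟘 x none t with proj₁ x t | none t
  ... | true  | n = contradiction refl n
  ... | false | _ = refl

  inhabited : ∀ x → ¬ (∀ t → proj₁ x t ≡ false) → ∃[ t ] x ∋ t
  inhabited x x≉𝟘 = dne λ none → x≉𝟘 (≈𝟘 x (λ t xt → none (t , xt)))

  ⟨⟩-atom : ∀ t → IsAtom ⟨ t ⟩
  ⟨⟩-atom t = (λ e → case trans (sym (⟨⟩-self t)) (e t) of λ ()) , split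
    where
    split : ∀ x → x ≼ ⟨ t ⟩ → x ≈ CylindricStructure.𝟘 𝔸 ⊎ x ≈ ⟨ t ⟩
    split x le with em {x ∋ t}
    ... | yes xt = inj₂ λ u → ⇔⇒≡ (≼⇒ {x} {⟨ t ⟩} le) (λ e → ∋-resp x (is⁻ e) xt)
    ... | no ¬xt = inj₁ (≈𝟘 x (λ u xu → ¬xt (∋-resp x (Same-sym (is⁻ (≼⇒ {x} {⟨ t ⟩} le xu))) xu)))

  atom⇒⟨⟩ : ∀ {a} → IsAtom a → ∃[ t ] (a ≈ ⟨ t ⟩)
  atom⇒⟨⟩ {a} (a≉𝟘 , min) with inhabited a a≉𝟘
  ... | t , at with min ⟨ t ⟩ (∋⇒⟨⟩≼ {a} at)
  ...   | inj₁ e = contradiction e (proj₁ (⟨⟩-atom t))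
  ...   | inj₂ e = t , λ u → sym (e u)

  cyls : List (Fin m) → Element → Element
  cyls []       x = x
  cyls (i ∷ L) x = cylᴬ i (cyls L x)

  -- 𝔸 is simple because any two types are realised side by side in a disjoint union of structures.
  inˡ inʳ : ℕ → ℕ
  inˡ p = p + p
  inʳ p = suc (p + p)

  bump : ℕ ⊎ ℕ → ℕ ⊎ ℕ
  bump (inj₁ p) = inj₁ (suc p)
  bump (inj₂ p) = inj₂ (suc p)

  side : ℕ → ℕ ⊎ ℕ
  side zero          = inj₁ 0
  side (suc zero)    = inj₂ 0
  side (suc (suc n)) = bump (side n)

  side-inˡ : ∀ p → side (inˡ p) ≡ inj₁ p
  side-inˡ zero = refl
  side-inˡ (suc p) rewrite ℕ.+-suc p p = cong bump (side-inˡ p)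

  side-inʳ : ∀ p → side (inʳ p) ≡ inj₂ p
  side-inʳ zero = refl
  side-inʳ (suc p) rewrite ℕ.+-suc p p = cong bump (side-inʳ p)

  module Union (G : Structure) (validᴳ : Valid G) (H : Structure) (validᴴ : Valid H) where

    join-sort : ℕ ⊎ ℕ → Sort
    join-sort = [ sort G , sort H ]′

    join-link : ℕ ⊎ ℕ → ℕ ⊎ ℕ → Bool
    join-link (inj₁ p) (inj₁ q) = link G p q
    join-link (inj₂ p) (inj₂ q) = link H p q
    join-link _        _        = false

    join-label : ℕ ⊎ ℕ → ℕ ⊎ ℕ → Label
    join-label (inj₁ p) (inj₁ q) = label G p q
    join-label (inj₂ p) (inj₂ q) = label H p q
    join-label _        _        = white fzero

    Left Right : Vec ℕ m₁ → Vec ℕ m₁ → Set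
    Left F E = ∀ c → side (lookup F c) ≡ inj₁ (lookup E c)
    Right F E = ∀ c → side (lookup F c) ≡ inj₂ (lookup E c)

    join-tints : Vec ℕ m₁ → ℕ → Bool
    join-tints F a = is ((∀ E → Left F E → tints G E a ≡ true) × (∀ E → Right F E → tints H E a ≡ true))

    U : Structure
    U = record { sort = join-sort ∘ side ; link = λ p q → join-link (side p) (side q)
               ; label = λ p q → join-label (side p) (side q) ; tints = join-tints }

    nonwhiteᵁ : ∀ x z w {c a b} → join-sort x ≡ base c → join-sort z ≡ apex a → join-sort w ≡ apex b → a < b →
                join-link x z ≡ true → join-link x w ≡ true → join-label z w ≢ white c
    nonwhiteᵁ (inj₁ _) (inj₁ _) (inj₁ _) = nonwhite validᴳ
    nonwhiteᵁ (inj₂ _) (inj₂ _) (inj₂ _) = nonwhite validᴴ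

    descendᵁ : ∀ z w u {a b c p q r} → join-sort z ≡ apex a → join-sort w ≡ apex b → join-sort u ≡ apex c →
               a < b → b < c → join-label z w ≡ red p → join-label w u ≡ red q → join-label z u ≡ red r → q < p
    descendᵁ (inj₁ _) (inj₁ _) (inj₁ _) = descend validᴳ
    descendᵁ (inj₂ _) (inj₂ _) (inj₂ _) = descend validᴴ

    allowedᵁ : ∀ F z a → Base U F → Cone U F z a → join-tints F a ≡ true
    allowedᵁ F z a bs (cone sz lz) with side z
    ... | inj₁ z′ = is⁺ ((λ E left → allowed validᴳ E z′ a
                           (λ c → trans (cong join-sort (sym (left c))) (bs c))
                           (cone sz λ c → trans (cong (λ p → join-link p (inj₁ z′)) (sym (left c))) (lz c)))
                       , λ E right → case trans (sym (lz fzero)) (cong (λ p → join-link p (inj₁ z′)) (right fzero)) of λ ())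
    ... | inj₂ z′ = is⁺ ((λ E left → case trans (sym (lz fzero)) (cong (λ p → join-link p (inj₂ z′)) (left fzero)) of λ ())
                       , λ E right → allowed validᴴ E z′ a
                           (λ c → trans (cong join-sort (sym (right c))) (bs c))
                           (cone sz λ c → trans (cong (λ p → join-link p (inj₂ z′)) (sym (right c))) (lz c)))

    validᵁ : Valid U
    validᵁ = record
      { allowed = allowedᵁ
      ; nonwhite = λ {x} {z} {w} → nonwhiteᵁ (side x) (side z) (side w)
      ; descend = λ {z} {w} {u} → descendᵁ (side z) (side w) (side u) }

    private
      at : (f : ℕ → ℕ) (g : ℕ → ℕ ⊎ ℕ) → (∀ p → side (f p) ≡ g p) → (s : Vec ℕ m) → ∀ j →
           side (lookup (map f s) j) ≡ g (lookup s j)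
      at f g eqn s j = trans (cong side (lookup-map j f s)) (eqn _)

      to-base : (f : ℕ → ℕ) (g : ℕ → ℕ ⊎ ℕ) → (∀ p → side (f p) ≡ g p) → (s : Vec ℕ m) (v : Vec (Fin m) m₁) → ∀ c →
                side (lookup (map (lookup (map f s)) v) c) ≡ g (lookup (map (lookup s) v) c)
      to-base f g eqn s v c = trans (cong side (lookup-map c _ v))
        (trans (at f g eqn s (lookup v c)) (cong g (sym (lookup-map c (lookup s) v))))

    leftᵁ : ∀ s → Same (λ _ → ⊤) U (map inˡ s) G s
    leftᵁ s = record
      { eq⇒ = λ {j} {l} _ _ e → inj₁-inj (trans (sym (at′ j)) (trans (cong side e) (at′ l)))
      ; eq⇐ = λ {j} {l} _ _ e → trans (lookup-map j inˡ s) (trans (cong inˡ e) (sym (lookup-map l inˡ s)))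
      ; sort≡ = λ {j} _ → cong join-sort (at′ j)
      ; link≡ = λ {j} {l} _ _ → cong₂ join-link (at′ j) (at′ l)
      ; label≡ = λ {j} {l} _ _ → cong₂ join-label (at′ j) (at′ l)
      ; tints≡ = λ v _ a → ⇔⇒≡ (λ t → proj₁ (is⁻ t) _ (base′ v))
          (λ t → is⁺ ((λ E left → subst (λ E → tints G E a ≡ true)
                          (lookup-ext (λ c → inj₁-inj (trans (sym (base′ v c)) (left c)))) t)
                     , λ E right → case trans (sym (base′ v fzero)) (right fzero) of λ ())) }
      where
      at′ = at inˡ inj₁ side-inˡ s
      base′ = to-base inˡ inj₁ side-inˡ s
      inj₁-inj : ∀ {p q : ℕ} → inj₁ {B = ℕ} p ≡ inj₁ q → p ≡ q
      inj₁-inj refl = refl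

    rightᵁ : ∀ s → Same (λ _ → ⊤) U (map inʳ s) H s
    rightᵁ s = record
      { eq⇒ = λ {j} {l} _ _ e → inj₂-inj (trans (sym (at′ j)) (trans (cong side e) (at′ l)))
      ; eq⇐ = λ {j} {l} _ _ e → trans (lookup-map j inʳ s) (trans (cong inʳ e) (sym (lookup-map l inʳ s)))
      ; sort≡ = λ {j} _ → cong join-sort (at′ j)
      ; link≡ = λ {j} {l} _ _ → cong₂ join-link (at′ j) (at′ l)
      ; label≡ = λ {j} {l} _ _ → cong₂ join-label (at′ j) (at′ l)
      ; tints≡ = λ v _ a → ⇔⇒≡ (λ t → proj₂ (is⁻ t) _ (base′ v))
          (λ t → is⁺ ((λ E left → case trans (sym (base′ v fzero)) (left fzero) of λ ())
                     , λ E right → subst (λ E → tints H E a ≡ true)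
                          (lookup-ext (λ c → inj₂-inj (trans (sym (base′ v c)) (right c)))) t)) }
      where
      at′ = at inʳ inj₂ side-inʳ s
      base′ = to-base inʳ inj₂ side-inʳ s
      inj₂-inj : ∀ {p q : ℕ} → inj₂ {A = ℕ} p ≡ inj₂ q → p ≡ q
      inj₂-inj refl = refl

  lookup≡⇒∼ : ∀ {G valid valid′ s s′ i} → (∀ j → j ≢ i → lookup s j ≡ lookup s′ j) → point G valid s ∼[ i ] point G valid′ s′
  lookup≡⇒∼ {G} {s = s} {s′} {i} eqn = record
    { eq⇒ = λ j≢i l≢i e → trans (sym (eqn _ j≢i)) (trans e (eqn _ l≢i))
    ; eq⇐ = λ j≢i l≢i e → trans (eqn _ j≢i) (trans e (sym (eqn _ l≢i)))
    ; sort≡ = λ j≢i → cong (sort G) (eqn _ j≢i)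
    ; link≡ = λ j≢i l≢i → cong₂ (link G) (eqn _ j≢i) (eqn _ l≢i)
    ; label≡ = λ j≢i l≢i → cong₂ (label G) (eqn _ j≢i) (eqn _ l≢i)
    ; tints≡ = λ v d a → cong (λ F → tints G F a) (lookup-ext λ c →
        trans (lookup-map c (lookup s) v) (trans (eqn _ (d c)) (sym (lookup-map c (lookup s′) v)))) }

  -- In the union, the copy of the tuple of `u` is exchanged for that of `t` one coordinate at a
  -- time, and each exchange is paid for by one cylindrification. `mix L` is the intermediate tuple
  -- in which the coordinates in `L` still belong to `u`.
  simple : ∀ x → ∃[ t ] x ∋ t → ∀ u → cyls (allFin m) x ∋ u
  simple x (point H validᴴ s* , xt) (point G validᴳ s) =
    ∋-resp (cyls (allFin m) x) {point U validᵁ (mixed (allFin m))} {point G validᴳ s} whole (reach (allFin m))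
    where
    open Union G validᴳ H validᴴ
    mix : List (Fin m) → Fin m → ℕ
    mix L l = if is (l ∈ₗ L) then inˡ (lookup s l) else inʳ (lookup s* l)
    mixed : List (Fin m) → Vec ℕ m
    mixed L = tabulate (mix L)
    mix-step : ∀ i L j → j ≢ i → mix (i ∷ L) j ≡ mix L j
    mix-step i L j j≢i rewrite is-cong {j ∈ₗ (i ∷ L)} {j ∈ₗ L} (λ { (here e) → contradiction e j≢i ; (there k) → k }) there = refl
    reach : ∀ L → cyls L x ∋ point U validᵁ (mixed L)
    reach [] = ∋-resp x (subst (λ v → point H validᴴ s* ≋ point U validᵁ v) eqn (Same-sym (rightᵁ s*))) xt
      where
      none : ∀ l → mix [] l ≡ inʳ (lookup s* l)
      none l rewrite is-false {l ∈ₗ []} (λ ()) = refl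
      eqn : map inʳ s* ≡ mixed []
      eqn = lookup-ext λ l → trans (lookup-map l inʳ s*) (trans (sym (none l)) (sym (lookup∘tabulate (mix []) l)))
    reach (i ∷ L) = is⁺ (point U validᵁ (mixed L) , lookup≡⇒∼ {U} {validᵁ} {validᵁ} {mixed (i ∷ L)} {mixed L}
      (λ j j≢i → trans (lookup∘tabulate (mix (i ∷ L)) j) (trans (mix-step i L j j≢i) (sym (lookup∘tabulate (mix L) j)))) , reach L)
    all : ∀ l → mix (allFin m) l ≡ inˡ (lookup s l)
    all l rewrite is⁺ (∈-allFin l) = refl
    whole : point U validᵁ (mixed (allFin m)) ≋ point G validᴳ s
    whole = subst (λ v → point U validᵁ v ≋ point G validᴳ s)
      (lookup-ext λ l → trans (lookup-map l inˡ s) (trans (sym (all l)) (sym (lookup∘tabulate (mix (allFin m)) l)))) (leftᵁ s)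

-- 𝔸 has no large basis and no complete square representation

module NoBasis (em : {P : Set} → Dec P) (m′ : ℕ) where

  open Structures em m′
  open ComplexAlgebra em m′
  open Structure
  open Same
  open Valid
  open Point

  sortAt : Point → Fin m → Sort
  sortAt u j = sort (str u) (lookup (tup u) j)

  labelAt : Point → Fin m → Fin m → Label
  labelAt u j l = label (str u) (lookup (tup u) j) (lookup (tup u) l)

  opaque
    last p₀ p₁ : Fin m
    last = fromℕ m₁
    p₀ = fzero
    p₁ = fsuc fzero

    toℕ-last : toℕ last ≡ m₁
    toℕ-last = Fin.toℕ-fromℕ m₁

    inject₁≢last : ∀ {c} → inject₁ c ≢ last
    inject₁≢last {c} e = Fin.fromℕ≢inject₁ {i = c} (sym e)

    p₀≢p₁ : p₀ ≢ p₁
    p₀≢p₁ ()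

    p₀≢last : p₀ ≢ last
    p₀≢last ()

    p₁≢last : p₁ ≢ last
    p₁≢last ()

    off-p₀-or-p₁ : ∀ c → inject₁ c ≢ p₀ ⊎ inject₁ c ≢ p₁
    off-p₀-or-p₁ fzero    = inj₂ λ ()
    off-p₀-or-p₁ (fsuc c) = inj₁ λ ()

  p₁≢p₀ : p₁ ≢ p₀
  p₁≢p₀ e = p₀≢p₁ (sym e)

  last≢p₀ : last ≢ p₀
  last≢p₀ e = p₀≢last (sym e)

  last≢p₁ : last ≢ p₁
  last≢p₁ e = p₁≢last (sym e)

  -- A cone of tint a over a base that allows all tints.
  sort-below : ∀ {p} → Dec (p < m₁) → ℕ → Sort
  sort-below (yes p<m₁) _ = base (fromℕ< p<m₁)
  sort-below (no _)     a = apex a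

  cone-structure : ℕ → Structure
  cone-structure a = record { sort = λ p → sort-below (p ℕ.<? m₁) a ; link = λ _ _ → true
                            ; label = λ _ _ → white fzero ; tints = λ _ _ → true }

  one-tint : ∀ {a p b} (d : Dec (p < m₁)) → sort-below d a ≡ apex b → b ≡ a
  one-tint (no _) refl = refl

  cone-valid : ∀ a → Valid (cone-structure a)
  cone-valid a = record
    { allowed = λ _ _ _ _ _ → refl
    ; nonwhite = λ {x} {z} {w} _ sz sw b<c → contradiction (trans (one-tint {a} (z ℕ.<? m₁) sz) (sym (one-tint {a} (w ℕ.<? m₁) sw))) (ℕ.<⇒≢ b<c)
    ; descend = λ {z} {w} sz sw _ b<c → contradiction (trans (one-tint {a} (z ℕ.<? m₁) sz) (sym (one-tint {a} (w ℕ.<? m₁) sw))) (ℕ.<⇒≢ b<c) }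

  κ : ℕ → Point
  κ a = point (cone-structure a) (cone-valid a) (tabulate toℕ)

  κ-tup : ∀ a j → lookup (tup (κ a)) j ≡ toℕ j
  κ-tup a j = lookup∘tabulate toℕ j

  sort-below-yes : ∀ {p} a (d : Dec (p < m₁)) (p<m₁ : p < m₁) → sort-below d a ≡ base (fromℕ< p<m₁)
  sort-below-yes a (yes _) _ = refl
  sort-below-yes a (no n)  p<m₁ = contradiction p<m₁ n

  κ-base : ∀ a c → sortAt (κ a) (inject₁ c) ≡ base c
  κ-base a c = trans (sort-below-yes a _ c<m₁) (cong base (Fin.toℕ-injective (trans (Fin.toℕ-fromℕ< c<m₁) p≡c)))
    where
    p≡c : lookup (tup (κ a)) (inject₁ c) ≡ toℕ c
    p≡c = trans (κ-tup a (inject₁ c)) (Fin.toℕ-inject₁ c)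
    c<m₁ : lookup (tup (κ a)) (inject₁ c) < m₁
    c<m₁ = subst (_< m₁) (sym p≡c) (Fin.toℕ<n c)

  sort-below-no : ∀ {p} a (d : Dec (p < m₁)) → p ≡ m₁ → sort-below d a ≡ apex a
  sort-below-no a (yes p<m₁) e = contradiction p<m₁ (ℕ.<-irrefl e)
  sort-below-no a (no _)     _ = refl

  κ-apex : ∀ a → sortAt (κ a) last ≡ apex a
  κ-apex a = sort-below-no a _ (trans (κ-tup a last) (toℕ-last))

  -- Without its apex a cone no longer shows its tint. This is what allows an apex of any tint to be
  -- demanded over the same base.
  κ∼κ : ∀ a b → κ a ∼[ last ] κ b
  κ∼κ a b = record
    { eq⇒ = λ _ _ e → e ; eq⇐ = λ _ _ e → e
    ; sort≡ = λ {j} j≢last → trans (sort-below-yes a _ (small j≢last)) (sym (sort-below-yes b _ (small j≢last)))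
    ; link≡ = λ _ _ → refl ; label≡ = λ _ _ → refl ; tints≡ = λ _ _ _ → refl }
    where
    small : ∀ {j} → j ≢ last → lookup (tup (κ a)) j < m₁
    small {j} j≢last rewrite κ-tup a j = ℕ.≤∧≢⇒< (ℕ.≤-pred (Fin.toℕ<n j))
      (λ e → j≢last (Fin.toℕ-injective (trans e (sym (toℕ-last)))))

  -- A basis for 𝔸, with atoms given by points.
  record Family (n : ℕ) (b : Vec (Fin n) m) (H : Pred (Vec (Fin n) m → Point) 0ℓ) : Set where
    field
      start  : ∀ t → ∃[ N ] (H N × N b ≋ t)
      diagonal   : ∀ {N} → H N → ∀ δ i j → let t = tup (N (δ [ i ]≔ lookup δ j)) in lookup t i ≡ lookup t j
      cylindric    : ∀ {N} → H N → ∀ δ i k → N (δ [ i ]≔ k) ∼[ i ] N δ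
      extend : ∀ {N} → H N → ∀ x i t → N x ∼[ i ] t → ∀ z → (∀ j → j ≢ i → lookup x j ≢ z) →
               ∃[ M ] (H M × (∀ y → (∀ j → lookup y j ≢ z) → M y ≋ N y) × M (x [ i ]≔ z) ≋ t)

  module Descent {n : ℕ} (m+2≤n : suc (suc m) ≤ n) where

    node : Fin m → Fin n
    node i = inject≤ i (ℕ.≤-trans (ℕ.m≤n+m m 2) m+2≤n)

    b : Vec (Fin n) m
    b = tabulate node

    b-injective : ∀ {j l} → lookup b j ≡ lookup b l → j ≡ l
    b-injective {j} {l} e = Fin.inject≤-injective _ _ j l
      (trans (sym (lookup∘tabulate node j)) (trans e (lookup∘tabulate node l)))

    toℕ-b : ∀ j → toℕ (lookup b j) ≡ toℕ j
    toℕ-b j = trans (cong toℕ (lookup∘tabulate node j)) (Fin.toℕ-inject≤ j _)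

    module _ {H} (family : Family n b H) where
      open Family family

      Outside : Fin n → Set
      Outside z = ∀ j → j ≢ last → lookup b j ≢ z

      T : Fin n → Vec (Fin n) m
      T z = b [ last ]≔ z

      Tip : (Vec (Fin n) m → Point) → Fin n → ℕ → Set
      Tip N z a = N (T z) ≋ κ a

      -- The base nodes followed by `w`, with position `p` overwritten by `z`: the edge `z w` is
      -- seen together with all base nodes except the one at `p`.
      E : Fin m → Fin n → Fin n → Vec (Fin n) m
      E p z w = T w [ p ]≔ z

      T-last : ∀ z → lookup (T z) last ≡ z
      T-last z = lookup∘update last b z

      T-≔ : ∀ z w → T z [ last ]≔ w ≡ T w
      T-≔ z w = []≔-idempotent b last

      E-≔ : ∀ {p} → p ≢ last → ∀ z w y → E p z w [ last ]≔ y ≡ E p z y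
      E-≔ {p} p≢last z w y = trans ([]≔-commutes (T w) p last p≢last) (cong (_[ p ]≔ z) (T-≔ w y))

      record Face (e : Point) (p : Fin m) (a b′ : ℕ) : Set where
        field
          apex-p    : sortAt e p ≡ apex a
          apex-last : sortAt e last ≡ apex b′
          not-white : ∀ {c} → inject₁ c ≢ p → labelAt e p last ≢ white c

      -- Off `p` the tuple agrees with the cone at `w`. Off the last position it agrees with
      -- `E p z z`, where the two copies of `z` carry the sort and the links of `z` over to position
      -- `p`.
      face : ∀ {N} → H N → ∀ {z w a b′} → Tip N z a → Tip N w b′ → a < b′ → ∀ p → p ≢ last → Face (N (E p z w)) p a b′
      face {N} N∈H {z} {w} {a} {b′} tz tw a<b p p≢last = record
        { apex-p = apex-p ; apex-last = apex-last
        ; not-white = λ c≢p → nonwhite (valid e) (trans (sort≡ e∼w c≢p) (κ-base b′ _)) apex-p apex-last a<b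
            (trans (link≡ e∼zz inject₁≢last p≢last)
              (trans (cong (link (str zz) _) zz-diag) (link≡ zz∼z c≢p last≢p)))
            (link≡ e∼w c≢p last≢p) }
        where
        e zz : Point
        e = N (E p z w)
        zz = N (E p z z)
        last≢p : last ≢ p
        last≢p q = p≢last (sym q)
        e∼w : e ∼[ p ] κ b′
        e∼w = Same-trans (cylindric N∈H (T w) p z) (≋⇒∼ (N (T w)) (κ b′) tw)
        zz∼z : zz ∼[ p ] κ a
        zz∼z = Same-trans (cylindric N∈H (T z) p z) (≋⇒∼ (N (T z)) (κ a) tz)
        zz-diag : lookup (tup zz) p ≡ lookup (tup zz) last
        zz-diag = subst (λ q → let t = tup (N (T z [ p ]≔ q)) in lookup t p ≡ lookup t last)
                    (T-last z) (diagonal N∈H (T z) p last)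
        e∼zz : e ∼[ last ] zz
        e∼zz = subst (λ δ → N δ ∼[ last ] zz) (E-≔ p≢last z z w) (cylindric N∈H (E p z z) last w)
        apex-last : sortAt e last ≡ apex b′
        apex-last = trans (sort≡ e∼w last≢p) (κ-apex b′)
        apex-p : sortAt e p ≡ apex a
        apex-p = trans (sort≡ e∼zz p≢last) (trans (cong (sort (str zz)) zz-diag) (trans (sort≡ zz∼z last≢p) (κ-apex a)))

      -- Both tuples are compared with the one that has `z` at `p₀` and at `p₁`.
      same-label : ∀ {N} → H N → ∀ z w → labelAt (N (E p₀ z w)) p₀ last ≡ labelAt (N (E p₁ z w)) p₁ last
      same-label {N} N∈H z w = trans (sym (label≡ both∼₁ p₀≢p₁ last≢p₁))
        (trans (cong (λ q → label (str both) q (lookup (tup both) last)) (sym both-diag)) (label≡ both∼₀ p₁≢p₀ last≢p₀))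
        where
        both : Point
        both = N (E p₀ z w [ p₁ ]≔ z)
        both∼₁ : both ∼[ p₁ ] N (E p₀ z w)
        both∼₁ = cylindric N∈H (E p₀ z w) p₁ z
        both∼₀ : both ∼[ p₀ ] N (E p₁ z w)
        both∼₀ = subst (λ δ → N δ ∼[ p₀ ] N (E p₁ z w)) (sym ([]≔-commutes (T w) p₀ p₁ p₀≢p₁)) (cylindric N∈H (E p₁ z w) p₀ z)
        both-diag : lookup (tup both) p₁ ≡ lookup (tup both) p₀
        both-diag = subst (λ q → let t = tup (N (E p₀ z w [ p₁ ]≔ q)) in lookup t p₁ ≡ lookup t p₀)
                      (lookup∘update p₀ (T w) z) (diagonal N∈H (E p₀ z w) p₁ p₀)

      lab : (Vec (Fin n) m → Point) → Fin n → Fin n → Label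
      lab N z w = labelAt (N (E p₀ z w)) p₀ last

      -- A tuple containing `z` and `w` omits one base node, so the white of that sort is not
      -- excluded by it. Placing `z` at `p₀` and then at `p₁` omits different base nodes, and
      -- together they exclude all whites.
      edge-red : ∀ {N} → H N → ∀ {z w a b′} → Tip N z a → Tip N w b′ → a < b′ → ∃[ p ] lab N z w ≡ red p
      edge-red N∈H {z} {w} tz tw a<b = not-white⇒red _ λ c e≡ → case off-p₀-or-p₁ c of λ
        { (inj₁ c≢p₀) → Face.not-white (face N∈H tz tw a<b p₀ p₀≢last) c≢p₀ e≡
        ; (inj₂ c≢p₁) → Face.not-white (face N∈H tz tw a<b p₁ p₁≢last) c≢p₁ (trans (sym (same-label N∈H z w)) e≡) }

      -- `Ω` shows all three apexes at once, at `p₀`, `p₁` and `last`, which takes three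
      -- coordinates. The edge `z w` reaches the positions `p₀`, `p₁` through `Ω₂`, where `w` also
      -- stands last.
      drop : ∀ {N} → H N → ∀ {z w y a b′ c p q} → Tip N z a → Tip N w b′ → Tip N y c → a < b′ → b′ < c →
             lab N z w ≡ red p → lab N w y ≡ red q → q < p
      drop {N} N∈H {z} {w} {y} tz tw ty a<b b<c zw wy =
        descend (valid Ω)
          (trans (sort≡ Ω∼₁ p₀≢p₁) (Face.apex-p (face N∈H tz ty (ℕ.<-trans a<b b<c) p₀ p₀≢last)))
          (trans (sort≡ Ω∼₀ p₁≢p₀) (Face.apex-p wy-face)) (trans (sort≡ Ω∼₀ last≢p₀) (Face.apex-last wy-face))
          a<b b<c
          (trans (label≡ Ω∼₂ p₀≢last p₁≢last) (trans (cong (label (str Ω₂) (lookup (tup Ω₂) p₀)) Ω₂-diag) (trans (label≡ Ω₂∼₁ p₀≢p₁ last≢p₁) zw)))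
          (trans (label≡ Ω∼₀ p₁≢p₀ last≢p₀) (trans (sym (same-label N∈H w y)) wy))
          (trans (label≡ Ω∼₁ p₀≢p₁ last≢p₁) (proj₂ (edge-red N∈H tz ty (ℕ.<-trans a<b b<c))))
        where
        wy-face = face N∈H tw ty b<c p₁ p₁≢last
        Ω Ω₂ : Point
        Ω = N (E p₀ z y [ p₁ ]≔ w)
        Ω₂ = N (E p₀ z w [ p₁ ]≔ w)
        Ω∼₁ : Ω ∼[ p₁ ] N (E p₀ z y)
        Ω∼₁ = cylindric N∈H (E p₀ z y) p₁ w
        Ω∼₀ : Ω ∼[ p₀ ] N (E p₁ w y)
        Ω∼₀ = subst (λ δ → N δ ∼[ p₀ ] N (E p₁ w y)) (sym ([]≔-commutes (T y) p₀ p₁ p₀≢p₁)) (cylindric N∈H (E p₁ w y) p₀ z)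
        Ω₂∼₁ : Ω₂ ∼[ p₁ ] N (E p₀ z w)
        Ω₂∼₁ = cylindric N∈H (E p₀ z w) p₁ w
        Ω₂-diag : lookup (tup Ω₂) p₁ ≡ lookup (tup Ω₂) last
        Ω₂-diag = subst (λ q → let t = tup (N (E p₀ z w [ p₁ ]≔ q)) in lookup t p₁ ≡ lookup t last)
                    (trans (lookup∘update′ {i = last} {p₀} last≢p₀ (T w) z) (T-last w)) (diagonal N∈H (E p₀ z w) p₁ last)
        Ω∼₂ : Ω ∼[ last ] Ω₂
        Ω∼₂ = subst (λ δ → N δ ∼[ last ] Ω₂)
                (trans ([]≔-commutes (E p₀ z w) p₁ last p₁≢last) (cong (_[ p₁ ]≔ w) (E-≔ p₀≢last z w y)))
                (cylindric N∈H (E p₀ z w [ p₁ ]≔ w) last y)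

      lookup-T : ∀ {z y} → Outside y → z ≢ y → ∀ j → lookup (T z) j ≢ y
      lookup-T {z} {y} y-out z≢y j with j Fin.≟ last
      ... | yes refl = λ e → z≢y (trans (sym (T-last z)) e)
      ... | no j≢last = λ e → y-out j j≢last (trans (sym (lookup∘update′ j≢last b z)) e)

      lookup-E : ∀ {z w y} → Outside y → z ≢ y → w ≢ y → ∀ j → lookup (E p₀ z w) j ≢ y
      lookup-E {z} {w} {y} y-out z≢y w≢y j with j Fin.≟ p₀
      ... | yes refl = λ e → z≢y (trans (sym (lookup∘update p₀ (T w) z)) e)
      ... | no j≢p₀ = λ e → lookup-T y-out w≢y j (trans (sym (lookup∘update′ j≢p₀ (T w) z)) e)

      next : ∀ {N} → H N → ∀ {w y a} → Outside y → w ≢ y → Tip N w a →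
             ∃[ M ] (H M × (∀ δ → (∀ j → lookup δ j ≢ y) → M δ ≋ N δ) × Tip M y (suc a))
      next {N} N∈H {w} {y} {a} y-out w≢y tw =
        let M , M∈H , old , new = extend N∈H (T w) last (κ (suc a))
              (Same-trans (≋⇒∼ (N (T w)) (κ a) tw) (κ∼κ a (suc a))) y (λ j _ → lookup-T y-out w≢y j)
        in M , M∈H , old , subst (λ δ → M δ ≋ κ (suc a)) (T-≔ w y) new

      -- A red edge z w between apexes of tints a and a + 1, and a third node y to be reused.
      Stage : ℕ → Set
      Stage p = ∀ {N} → H N → ∀ {z w y a} → Outside z → Outside w → Outside y → z ≢ w → w ≢ y → z ≢ y →
                Tip N z a → Tip N w (suc a) → ¬ lab N z w ≡ red p

      -- An apex of tint `a + 2` is placed at `y`. By `drop` the edge `w y` is red with a smaller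
      -- number, and `z` has become the spare node for the next round.
      endless : ∀ p → Stage p
      endless = <-rec Stage go
        where
        go : ∀ p → (∀ {q} → q < p → Stage q) → Stage p
        go p rec {N} N∈H {z} {w} {y} {a} z-out w-out y-out z≢w w≢y z≢y tz tw zw =
          let M , M∈H , old , ty = next N∈H y-out w≢y tw
              tz′ = Same-trans (old (T z) (lookup-T y-out z≢y)) tz
              tw′ = Same-trans (old (T w) (lookup-T y-out w≢y)) tw
              zw′ = trans (label≡ (old (E p₀ z w) (lookup-E y-out z≢y w≢y)) tt tt) zw
              q , wy = edge-red M∈H tw′ ty ℕ.≤-refl
          in rec (drop M∈H tz′ tw′ ty ℕ.≤-refl ℕ.≤-refl zw′ wy)
               M∈H w-out y-out z-out w≢y (λ e → z≢y (sym e)) (λ e → z≢w (sym e)) tw′ ty wy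

      m≤n : m ≤ n
      m≤n = ℕ.≤-trans (ℕ.m≤n+m m 2) m+2≤n

      m+1≤n : suc m ≤ n
      m+1≤n = ℕ.≤-trans (ℕ.n≤1+n _) m+2≤n

      fromℕ<-outside : ∀ {k} → m₁ ≤ k → (k<n : k < n) → Outside (fromℕ< k<n)
      fromℕ<-outside {k} m₁≤k k<n j j≢last e = j≢last (Fin.toℕ-injective
        (trans (ℕ.≤-antisym (ℕ.≤-pred (Fin.toℕ<n j)) (subst (m₁ ≤_) (sym k≡) m₁≤k)) (sym (toℕ-last))))
        where
        k≡ : toℕ j ≡ k
        k≡ = trans (sym (toℕ-b j)) (trans (cong toℕ e) (Fin.toℕ-fromℕ< k<n))

      fromℕ<-≢ : ∀ {k l} (p : k < n) (q : l < n) → k < l → fromℕ< p ≢ fromℕ< q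
      fromℕ<-≢ p q k<l e = ℕ.<⇒≢ k<l (trans (sym (Fin.toℕ-fromℕ< p)) (trans (cong toℕ e) (Fin.toℕ-fromℕ< q)))

      -- The three nodes after the `m - 1` base nodes. `z₀` is the last entry of `b`, so the first
      -- cone is given by `start`.
      z₀ z₁ z₂ : Fin n
      z₀ = fromℕ< m≤n
      z₁ = fromℕ< m+1≤n
      z₂ = fromℕ< m+2≤n

      z₀-out : Outside z₀
      z₀-out = fromℕ<-outside ℕ.≤-refl m≤n

      z₁-out : Outside z₁
      z₁-out = fromℕ<-outside (ℕ.n≤1+n _) m+1≤n

      z₂-out : Outside z₂
      z₂-out = fromℕ<-outside (ℕ.m≤n+m _ 2) m+2≤n

      z₀≢z₁ : z₀ ≢ z₁
      z₀≢z₁ = fromℕ<-≢ m≤n m+1≤n ℕ.≤-refl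

      T-z₀ : T z₀ ≡ b
      T-z₀ = trans (cong (b [ last ]≔_) (Fin.toℕ-injective
        (trans (Fin.toℕ-fromℕ< m≤n) (trans (sym (toℕ-last)) (sym (toℕ-b last)))))) ([]≔-lookup b last)

      no-family : ⊥
      no-family =
        let N , N∈H , N₀ = start (κ 0)
            t₀ = subst (λ δ → N δ ≋ κ 0) (sym T-z₀) N₀
            M , M∈H , old , t₁ = next N∈H {z₀} {z₁} {0} z₁-out z₀≢z₁ t₀
            t₀′ = Same-trans (old (T z₀) (lookup-T z₁-out z₀≢z₁)) t₀
        in endless _ M∈H {z₀} {z₁} {z₂} z₀-out z₁-out z₂-out z₀≢z₁ (fromℕ<-≢ m+1≤n m+2≤n ℕ.≤-refl)
             (fromℕ<-≢ m≤n m+2≤n (ℕ.n≤1+n _)) t₀′ t₁ (proj₂ (edge-red M∈H t₀′ t₁ ℕ.≤-refl))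

    -- An atom determines its point only up to `≋`, so the family contains every choice of points
    -- for the labels of a network in `H`.
    from-basis : ∀ {m≤n : m ≤ n} {H} → IsBasis 𝔸 n m≤n H →
                 Family n b (λ P → ∃[ N ] (H N × (∀ δ t → proj₁ (Network.⟦_⟧ N δ) t ≡ proj₁ ⟨ P δ ⟩ t)))
    from-basis {H = H} basis = record
      { start = λ t → let N , N∈H , e = atoms ⟨ t ⟩ (⟨⟩-atom t) in
          points N , (N , N∈H , points-spec N) , labels⇒≋ N (points N) (points-spec N) b t (trans (e t) (⟨⟩-self t))
      ; diagonal = λ { {P} (N , _ , e) δ i j → is⁻ (∋-of N P e (δ [ i ]≔ lookup δ j) (diagᴬ i j) (label-d N δ i j)) }
      ; cylindric = λ { {P} (N , _ , e) δ i k →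
          let δ⁺ = δ [ i ]≔ k
              u , P∼u , Nu = is⁻ (∋-of N P e δ⁺ (cylᴬ i (⟦ N ⟧ δ)) (label-c N δ i k))
          in Same-trans P∼u (≋⇒∼ u (P δ) (Same-sym (labels⇒≋ N P e δ u Nu))) }
      ; extend = λ { {P} (N , N∈H , e) x i t Px∼t z z-new →
          let M , M∈H , old , new = extend N N∈H x i ⟨ t ⟩ (⟨⟩-atom t)
                (⇒≼ (⟦ N ⟧ x) (cylᴬ i ⟨ t ⟩) (λ u Nu → cyl⟨⟩⇐ i t u
                  (Same-trans (≋⇒∼ u (P x) (Same-sym (labels⇒≋ N P e x u Nu))) Px∼t))) z z-new
          in points M , (M , M∈H , points-spec M) ,
             (λ y y-avoids → labels⇒≋ M (points M) (points-spec M) y (P y) (trans (old y y-avoids (P y)) (trans (e y (P y)) (⟨⟩-self (P y))))) ,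
             labels⇒≋ M (points M) (points-spec M) (x [ i ]≔ z) t (trans (new t) (⟨⟩-self t)) } }
      where
      open IsBasis basis
      open Network
      points : Network 𝔸 n → Vec (Fin n) m → Point
      points N δ = proj₁ (atom⇒⟨⟩ {⟦ N ⟧ δ} (proj₂ (label N δ)))
      points-spec : ∀ N δ t → proj₁ (⟦ N ⟧ δ) t ≡ proj₁ ⟨ points N δ ⟩ t
      points-spec N δ = proj₂ (atom⇒⟨⟩ {⟦ N ⟧ δ} (proj₂ (label N δ)))
      labels⇒≋ : ∀ N P → (∀ δ t → proj₁ (⟦ N ⟧ δ) t ≡ proj₁ ⟨ P δ ⟩ t) → ∀ δ t → ⟦ N ⟧ δ ∋ t → P δ ≋ t
      labels⇒≋ N P e δ t Nt = ⟨⟩∋⇒≋ (P δ) t (trans (sym (e δ t)) Nt)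
      ∋-of : ∀ N P → (∀ δ t → proj₁ (⟦ N ⟧ δ) t ≡ proj₁ ⟨ P δ ⟩ t) → ∀ δ y → CylindricStructure._≼_ 𝔸 (⟦ N ⟧ δ) y → y ∋ P δ
      ∋-of N P e δ y le = ≼⇒ {⟦ N ⟧ δ} {y} le (trans (e δ (P δ)) (⟨⟩-self (P δ)))

    module FromRepresentation (R : RelativizedRepresentation 𝔸) (complete : Complete R) (square : Square R n) where
      open RelativizedRepresentation R

      Points : Pred Element 0ℓ
      Points x = ∃[ t ] x ≡ ⟨ t ⟩

      -- The unit is the supremum of the atoms `⟨ t ⟩`, so completeness puts every tuple of `V` into
      -- the image of one of them.
      covered : ∀ {s} → s ∈ V → ∃[ t ] s ∈ f ⟨ t ⟩
      covered s∈V with proj₁ (complete Points (CylindricStructure.𝟙 𝔸) ((λ x _ → ⇒≼ x (CylindricStructure.𝟙 𝔸) (λ _ _ → refl)) ,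
        λ u up → ⇒≼ (CylindricStructure.𝟙 𝔸) u (λ t _ → ⟨⟩≼⇒∋ {u} {t} (up ⟨ t ⟩ (t , refl))))) (proj₂ f-𝟙 s∈V)
      ... | _ , (t , refl) , s∈ = t , s∈

      hits : ∀ {s} t x → s ∈ f ⟨ t ⟩ → s ∈ f x → x ∋ t
      hits {s} t x s∈t s∈x = dne λ ¬xt → proj₁ f-𝟘 (proj₁ (f-cong {⟨t⟩∧x} {CylindricStructure.𝟘 𝔸} (≈𝟘 ⟨t⟩∧x λ u both → ¬xt (clash u both)))
                                                  (proj₂ (f-∧ ⟨ t ⟩ x) (s∈t , s∈x)))
        where
        ⟨t⟩∧x = CylindricStructure._∧_ 𝔸 ⟨ t ⟩ x
        clash : ∀ u → ⟨t⟩∧x ∋ u → x ∋ t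
        clash u both with is (t ≋ u) in tu | proj₁ x u in xu
        ... | true | true = ∋-resp x {u} {t} (Same-sym (is⁻ tu)) xu

      upward : ∀ {s} t x → s ∈ f ⟨ t ⟩ → x ∋ t → s ∈ f x
      upward {s} t x s∈t xt = proj₂ (proj₁ (f-∧ ⟨ t ⟩ x) (proj₁ (f-cong (∋⇒⟨⟩≼ {x} {t} xt)) s∈t))

      in-V : ∀ {s} x → s ∈ f x → s ∈ V
      in-V x = f-⊆V x

      agree⇒∼ : ∀ {s s′} t t′ {i} → s ∈ f ⟨ t ⟩ → s′ ∈ f ⟨ t′ ⟩ → AgreeOff i s s′ → t′ ∼[ i ] t
      agree⇒∼ {s} {s′} t t′ {i} s∈t s′∈t′ off =
        cyl⟨⟩⇒ i t t′ (hits t′ (cylᴬ i ⟨ t ⟩) s′∈t′ (proj₂ (f-c i ⟨ t ⟩) (in-V ⟨ t′ ⟩ s′∈t′ , s , s∈t , off)))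

      -- A tuple of V need not be a clique, but its type is realised by one.
      Reach : Vec M m → Set
      Reach s = ∀ t → s ∈ f ⟨ t ⟩ → ∃[ x ] (x ∈ CliqueTuple R n × map (lookup x) b ∈ f ⟨ t ⟩)

      square-at : ∀ {x} → x ∈ CliqueTuple R n → ∀ t′ t {i} → map (lookup x) b ∈ f ⟨ t′ ⟩ → t′ ∼[ i ] t →
                  ∃[ y ] (y ∈ CliqueTuple R n × map (lookup y) b ∈ f ⟨ t ⟩)
      square-at {x} x∈C t′ t {i} xb t′∼t =
        let y , y∈C , _ , yb = square x x∈C ⟨ t ⟩ i b (lookup b i) (λ j j≢i e → j≢i (b-injective e))
                                 (upward t′ (cylᴬ i ⟨ t ⟩) xb (cyl⟨⟩⇐ i t t′ t′∼t))
        in y , y∈C , subst (λ δ → map (lookup y) δ ∈ f ⟨ t ⟩) ([]≔-lookup b i) yb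

      -- Every type in `𝔸` lies below the `i`th cylindrification of the diagonal `i`, `j`. Hence `V`
      -- has a tuple that agrees with `s` off `i` and repeats entry `j` there.
      fill-V : ∀ {s} → s ∈ V → ∀ i j → s [ i ]≔ lookup s j ∈ V
      fill-V {s} s∈V i j with j Fin.≟ i
      ... | yes refl = subst (_∈ V) (sym ([]≔-lookup s i)) s∈V
      ... | no j≢i =
        let t , s∈t = covered s∈V
            u = point (str t) (valid t) (tup t [ i ]≔ lookup (tup t) j)
            _ , r , r∈ , off = proj₁ (f-c i (diagᴬ i j)) (upward t (cylᴬ i (diagᴬ i j)) s∈t (is⁺ (u ,
              lookup≡⇒∼ {str t} {valid t} {valid t} {tup t} {tup u} (λ l l≢i → sym (lookup∘update′ l≢i (tup t) _)) ,
              is⁺ (trans (lookup∘update i (tup t) _) (sym (lookup∘update′ j≢i (tup t) _))))))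
        in subst (_∈ V) (lookup-ext λ l → case l Fin.≟ i of λ
             { (yes refl) → trans (proj₂ (proj₁ (f-d i j) r∈)) (trans (off j j≢i) (sym (lookup∘update i s _)))
             ; (no l≢i) → trans (off l l≢i) (sym (lookup∘update′ l≢i s _)) }) (in-V (diagᴬ i j) r∈)

      reach-step : ∀ {s} i → s ∈ V → Reach (s [ i ]≔ lookup s fzero) → Reach s
      reach-step {s} i s∈V reach t s∈t =
        let t′ , s′∈t′ = covered (fill-V s∈V i fzero)
            x , x∈C , xb = reach t′ s′∈t′
        in square-at x∈C t′ t xb (agree⇒∼ t t′ s∈t s′∈t′ (λ j j≢i → sym (lookup∘update′ j≢i s _)))

      -- Over a single point there is only one `m`-tuple, here `s` itself, and it is in `V`; so the
      -- point forms a clique.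
      constant-reach : ∀ {s} → s ∈ V → (∀ l → lookup s l ≡ lookup s fzero) → Reach s
      constant-reach {s} s∈V const t s∈t = x ,
        (λ r r∈x → subst (_∈ V) (lookup-ext λ l → trans (const l) (sym (in-x (All.lookup⁺ r∈x l)))) s∈V) ,
        subst (_∈ f ⟨ t ⟩) (lookup-ext λ l → trans (const l) (sym (trans (lookup-map l (lookup x) b) (lookup-replicate (lookup b l) _)))) s∈t
        where
        x : Vec M n
        x = replicate n (lookup s fzero)
        in-x : ∀ {p} → p ∈ᵥ x → p ≡ lookup s fzero
        in-x p∈x = trans (Any.lookup-index p∈x) (lookup-replicate (Any.index p∈x) _)

      -- The tuple is collapsed to a constant one coordinate by coordinate, inside `V`. On the way
      -- back squareness recovers the types one after the other, now on clique tuples.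
      reach-list : ∀ L {s} → s ∈ V → (∀ l → l ∈ₗ L ⊎ lookup s l ≡ lookup s fzero) → Reach s
      reach-list [] s∈V const = constant-reach s∈V λ l → case const l of λ { (inj₂ e) → e }
      reach-list (i ∷ L) {s} s∈V const = reach-step i s∈V (reach-list L (fill-V s∈V i fzero) λ l → case l Fin.≟ i of λ
        { (yes refl) → inj₂ (trans (lookup∘update l s _) (sym (at-zero l)))
        ; (no l≢i) → case const l of λ
          { (inj₁ (here e)) → contradiction e l≢i
          ; (inj₁ (there l∈L)) → inj₁ l∈L
          ; (inj₂ e) → inj₂ (trans (lookup∘update′ l≢i s _) (trans e (sym (at-zero i)))) } })
        where
        at-zero : ∀ i → lookup (s [ i ]≔ lookup s fzero) fzero ≡ lookup s fzero
        at-zero fzero = lookup∘update fzero s _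
        at-zero (fsuc i) = lookup∘update′ {i = fzero} {fsuc i} (λ ()) s (lookup s fzero)

      family : Family n b (λ N → ∃[ x ] (x ∈ CliqueTuple R n × (∀ δ → map (lookup x) δ ∈ f ⟨ N δ ⟩)))
      family = record
        { start = λ t →
            let s , s∈t = realised t
                x , x∈C , xb = reach-list (allFin m) (in-V ⟨ t ⟩ s∈t) (λ l → inj₁ (∈-allFin l)) t s∈t
            in net x∈C , (x , x∈C , net-spec x∈C) , same (net x∈C b) t (net-spec x∈C b) xb
        ; diagonal = λ { {N} (x , x∈C , N-spec) δ i j →
            is⁻ (hits (N (δ [ i ]≔ lookup δ j)) (diagᴬ i j) (N-spec _) (proj₂ (f-d i j)
              (in-V ⟨ N (δ [ i ]≔ lookup δ j) ⟩ (N-spec _) , map-lookup-copies (lookup x) δ i j))) }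
        ; cylindric = λ { {N} (x , x∈C , N-spec) δ i k → agree⇒∼ (N δ) (N (δ [ i ]≔ k)) (N-spec δ) (N-spec _)
            (map-lookup-off (lookup x) δ i k) }
        ; extend = λ { {N} (x , x∈C , N-spec) δ i t Nδ∼t z z-new →
            let y , y∈C , off , y∈t = square x x∈C ⟨ t ⟩ i δ z z-new (upward (N δ) (cylᴬ i ⟨ t ⟩) (N-spec δ) (cyl⟨⟩⇐ i t (N δ) Nδ∼t))
            in net y∈C , (y , y∈C , net-spec y∈C) ,
               (λ ε ε-avoids → same (net y∈C ε) (N ε) (net-spec y∈C ε) (subst (_∈ f ⟨ N ε ⟩) (lookup-ext λ j →
                 trans (lookup-map j (lookup x) ε) (trans (sym (off (lookup ε j) (ε-avoids j))) (sym (lookup-map j (lookup y) ε)))) (N-spec ε))) ,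
               same (net y∈C (δ [ i ]≔ z)) t (net-spec y∈C (δ [ i ]≔ z)) y∈t } }
        where
        in-clique : ∀ {x} → x ∈ CliqueTuple R n → ∀ δ → map (lookup x) δ ∈ V
        in-clique {x} x∈C δ = x∈C _ (All.lookup⁻ λ j → subst (_∈ᵥ x) (sym (lookup-map j (lookup x) δ)) (∈-lookup _ x))
        net : ∀ {x} → x ∈ CliqueTuple R n → Vec (Fin n) m → Point
        net x∈C δ = proj₁ (covered (in-clique x∈C δ))
        net-spec : ∀ {x} (x∈C : x ∈ CliqueTuple R n) δ → map (lookup x) δ ∈ f ⟨ net x∈C δ ⟩
        net-spec x∈C δ = proj₂ (covered (in-clique x∈C δ))
        same : ∀ {s} t u → s ∈ f ⟨ t ⟩ → s ∈ f ⟨ u ⟩ → t ≋ u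
        same t u s∈t s∈u = Same-sym (⟨⟩∋⇒≋ u t (hits t ⟨ u ⟩ s∈t s∈u))
        realised : ∀ t → ∃[ s ] s ∈ f ⟨ t ⟩
        realised t = dne λ none → proj₁ (⟨⟩-atom t) (injective ((λ {s} s∈ → contradiction (s , s∈) none) , λ s∈ → contradiction (proj₁ f-𝟘 s∈) (λ ())))

-- Enumerating constants, formulas and requests

module Coding where

  step : ℕ × ℕ → ℕ × ℕ
  step (a , zero)  = 0 , suc a
  step (a , suc b) = suc a , b

  -- Cantor's enumeration of pairs along the diagonals.
  walk : ℕ → ℕ × ℕ
  walk zero    = 0 , 0
  walk (suc n) = step (walk n)

  walk-along : ∀ a b n → walk n ≡ (0 , a + b) → ∃[ n′ ] walk n′ ≡ (a , b)
  walk-along zero    b n e = n , e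
  walk-along (suc a) b n e with walk-along a (suc b) n (trans e (cong (0 ,_) (sym (ℕ.+-suc a b))))
  ... | n′ , e′ = suc n′ , cong step e′

  walk-start : ∀ s → ∃[ n ] walk n ≡ (0 , s)
  walk-start zero = 0 , refl
  walk-start (suc s) with walk-start s
  ... | n , e with walk-along s 0 n (trans e (cong (0 ,_) (sym (ℕ.+-identityʳ s))))
  ...   | n′ , e′ = suc n′ , cong step e′

  walk-surjective : ∀ a b → ∃[ n ] walk n ≡ (a , b)
  walk-surjective a b with walk-start (a + b)
  ... | n , e = walk-along a b n e

  walk-bound : ∀ n → proj₁ (walk n) + proj₂ (walk n) ≤ n
  walk-bound zero = z≤n
  walk-bound (suc n) with walk n | walk-bound n
  ... | a , zero  | le = s≤s (subst (_≤ n) (ℕ.+-identityʳ a) le)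
  ... | a , suc b | le = ℕ.≤-trans (ℕ.≤-reflexive (sym (ℕ.+-suc a b))) (ℕ.≤-trans le (ℕ.n≤1+n n))

  data Tree : Set where
    leaf : ℕ → Tree
    _⟨⟩_ : Tree → Tree → Tree

  mutual
    -- The first argument bounds the depth of the tree, which makes the decoding structurally
    -- recursive.
    treeAt : ℕ → ℕ → Tree
    treeAt zero    n = leaf n
    treeAt (suc d) n = build d (walk n)

    build : ℕ → ℕ × ℕ → Tree
    build d (zero  , n) = leaf n
    build d (suc _ , n) = treeAt d (proj₁ (walk n)) ⟨⟩ treeAt d (proj₂ (walk n))

  -- All larger bounds are included because the two subtrees of a node are decoded with a common
  -- bound.
  treeAt-surjective : ∀ t → ∃[ d ] (∀ e → ∃[ n ] treeAt (d + e) n ≡ t)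
  treeAt-surjective (leaf k) = 0 , λ
    { zero    → k , refl
    ; (suc e) → let n , w = walk-surjective 0 k in n , cong (build e) w }
  treeAt-surjective (l ⟨⟩ r) with treeAt-surjective l | treeAt-surjective r
  ... | dl , fl | dr , fr = suc (dl + dr) , λ e →
    let nl , el = fl (dr + e)
        nr , er = fr (dl + e)
        n , w   = walk-surjective nl nr
        n′ , w′ = walk-surjective 1 n
    in n′ , trans (cong (build (dl + dr + e)) w′) (cong₂ _⟨⟩_
         (trans (cong₂ treeAt (ℕ.+-assoc dl dr e) (cong proj₁ w)) el)
         (trans (cong₂ treeAt (trans (cong (_+ e) (ℕ.+-comm dl dr)) (ℕ.+-assoc dr dl e)) (cong proj₂ w)) er))

  tree : ℕ → Tree
  tree n = treeAt (proj₁ (walk n)) (proj₂ (walk n))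

  tree-surjective : ∀ t → ∃[ n ] tree n ≡ t
  tree-surjective t with treeAt-surjective t
  ... | d , f with f 0
  ...   | k , e with walk-surjective d k
  ...     | n , w = n , trans (cong₂ treeAt (trans (cong proj₁ w) (sym (ℕ.+-identityʳ d))) (cong proj₂ w)) e

  record Coded (X : Set) : Set where
    field
      decode     : Tree → X
      surjective : ∀ x → ∃[ t ] decode t ≡ x

  open Coded

  module _ {X : Set} (C : Coded X) where
    decodeVec : ∀ n → Tree → Vec X n
    decodeVec zero    _        = []
    decodeVec (suc n) (leaf k) = decode C (leaf k) ∷ decodeVec n (leaf k)
    decodeVec (suc n) (l ⟨⟩ r) = decode C l ∷ decodeVec n r

    codedVec : ∀ n → Coded (Vec X n)
    codedVec n = record { decode = decodeVec n ; surjective = onto }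
      where
      onto : ∀ {n} (v : Vec X n) → ∃[ t ] decodeVec n t ≡ v
      onto []      = leaf 0 , refl
      onto (x ∷ v) = let l , el = surjective C x ; r , er = onto v in (l ⟨⟩ r) , cong₂ _∷_ el er

  codedℕ : Coded ℕ
  codedℕ = record { decode = decodeℕ ; surjective = λ n → leaf n , refl }
    where
    decodeℕ : Tree → ℕ
    decodeℕ (leaf n)  = n
    decodeℕ (_ ⟨⟩ _) = 0

  codedPair : ∀ {X Y} → Coded X → Coded Y → Coded (X × Y)
  codedPair {X} {Y} C D = record
    { decode = decodePair
    ; surjective = λ (x , y) → let l , el = surjective C x ; r , er = surjective D y in (l ⟨⟩ r) , cong₂ _,_ el er }
    where
    decodePair : Tree → X × Y
    decodePair (leaf n)  = decode C (leaf n) , decode D (leaf n)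
    decodePair (l ⟨⟩ r) = decode C l , decode D r

  decodeFin : ∀ {n} → ℕ → Fin (suc n)
  decodeFin {n} k with k <? suc n
  ... | yes k<n = fromℕ< k<n
  ... | no _    = fzero

  decodeFin-toℕ : ∀ {n} (i : Fin (suc n)) → decodeFin (toℕ i) ≡ i
  decodeFin-toℕ {n} i with toℕ i <? suc n
  ... | yes i<n = Fin.fromℕ<-toℕ i i<n
  ... | no i≮n  = contradiction (Fin.toℕ<n i) i≮n

  codedFin : ∀ {n} → Coded (Fin (suc n))
  codedFin = record { decode = λ t → decodeFin (decode codedℕ t) ; surjective = λ i → leaf (toℕ i) , decodeFin-toℕ i }

  -- The elements of the model to be built: terms in constants gen j and constants typ s,
  -- the latter standing for the atom satisfied by the tuple s of nodes.
  data Const (m : ℕ) : Set where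
    gen      : ℕ → Const m
    typ      : Vec ℕ m → Const m
    _∨ᶜ_ _∧ᶜ_ : Const m → Const m → Const m
    -ᶜ_      : Const m → Const m
    𝟙ᶜ 𝟘ᶜ    : Const m
    cᶜ       : Fin m → Const m → Const m
    dᶜ       : Fin m → Fin m → Const m

  Instance : ℕ → Set
  Instance m = Σ[ k ∈ ℕ ] (Formula m k × Vec (Const m) k)

  module _ {m₁ : ℕ} where
    private
      m = suc m₁

      fin : Tree → Fin m
      fin = decode codedFin

    decodeConst : Tree → Const m
    decodeConst (leaf n) = gen n
    decodeConst (leaf 0 ⟨⟩ v) = typ (decodeVec codedℕ m v)
    decodeConst (leaf 1 ⟨⟩ (x ⟨⟩ y)) = decodeConst x ∨ᶜ decodeConst y
    decodeConst (leaf 2 ⟨⟩ (x ⟨⟩ y)) = decodeConst x ∧ᶜ decodeConst y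
    decodeConst (leaf 3 ⟨⟩ x) = -ᶜ decodeConst x
    decodeConst (leaf 4 ⟨⟩ _) = 𝟙ᶜ
    decodeConst (leaf 5 ⟨⟩ _) = 𝟘ᶜ
    decodeConst (leaf 6 ⟨⟩ (i ⟨⟩ x)) = cᶜ (fin i) (decodeConst x)
    decodeConst (leaf 7 ⟨⟩ (i ⟨⟩ j)) = dᶜ (fin i) (fin j)
    decodeConst _ = 𝟙ᶜ

    codedConst : Coded (Const m)
    codedConst = record { decode = decodeConst ; surjective = onto }
      where
      onto : ∀ x → ∃[ t ] decodeConst t ≡ x
      onto (gen j)  = leaf j , refl
      onto (typ s)  = let t , e = surjective (codedVec codedℕ m) s in (leaf 0 ⟨⟩ t) , cong typ e
      onto (x ∨ᶜ y) = let t , e = onto x ; u , e′ = onto y in (leaf 1 ⟨⟩ (t ⟨⟩ u)) , cong₂ _∨ᶜ_ e e′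
      onto (x ∧ᶜ y) = let t , e = onto x ; u , e′ = onto y in (leaf 2 ⟨⟩ (t ⟨⟩ u)) , cong₂ _∧ᶜ_ e e′
      onto (-ᶜ x)   = let t , e = onto x in (leaf 3 ⟨⟩ t) , cong -ᶜ_ e
      onto 𝟙ᶜ       = (leaf 4 ⟨⟩ leaf 0) , refl
      onto 𝟘ᶜ       = (leaf 5 ⟨⟩ leaf 0) , refl
      onto (cᶜ i x) = let t , e = surjective codedFin i ; u , e′ = onto x in (leaf 6 ⟨⟩ (t ⟨⟩ u)) , cong₂ cᶜ e e′
      onto (dᶜ i j) = let t , e = surjective codedFin i ; u , e′ = surjective codedFin j in (leaf 7 ⟨⟩ (t ⟨⟩ u)) , cong₂ dᶜ e e′

    decodeVar : ∀ k → ℕ → Term m k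
    decodeVar k n with n <? k
    ... | yes n<k = var (fromℕ< n<k)
    ... | no _    = one

    decodeVar-toℕ : ∀ {k} (x : Fin k) → decodeVar k (toℕ x) ≡ var x
    decodeVar-toℕ {k} x with toℕ x <? k
    ... | yes x<k = cong var (Fin.fromℕ<-toℕ x x<k)
    ... | no x≮k  = contradiction (Fin.toℕ<n x) x≮k

    decodeTerm : ∀ k → Tree → Term m k
    decodeTerm k (leaf n) = decodeVar k n
    decodeTerm k (leaf 1 ⟨⟩ (x ⟨⟩ y)) = join (decodeTerm k x) (decodeTerm k y)
    decodeTerm k (leaf 2 ⟨⟩ (x ⟨⟩ y)) = meet (decodeTerm k x) (decodeTerm k y)
    decodeTerm k (leaf 3 ⟨⟩ x) = compl (decodeTerm k x)
    decodeTerm k (leaf 4 ⟨⟩ _) = one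
    decodeTerm k (leaf 5 ⟨⟩ _) = zero
    decodeTerm k (leaf 6 ⟨⟩ (i ⟨⟩ x)) = cyl (fin i) (decodeTerm k x)
    decodeTerm k (leaf 7 ⟨⟩ (i ⟨⟩ j)) = diag (fin i) (fin j)
    decodeTerm k _ = one

    decodeTerm-surjective : ∀ {k} (s : Term m k) → ∃[ t ] decodeTerm k t ≡ s
    decodeTerm-surjective (var x)    = leaf (toℕ x) , decodeVar-toℕ x
    decodeTerm-surjective (join r s) = let t , e = decodeTerm-surjective r ; u , e′ = decodeTerm-surjective s in (leaf 1 ⟨⟩ (t ⟨⟩ u)) , cong₂ join e e′
    decodeTerm-surjective (meet r s) = let t , e = decodeTerm-surjective r ; u , e′ = decodeTerm-surjective s in (leaf 2 ⟨⟩ (t ⟨⟩ u)) , cong₂ meet e e′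
    decodeTerm-surjective (compl s)  = let t , e = decodeTerm-surjective s in (leaf 3 ⟨⟩ t) , cong compl e
    decodeTerm-surjective one        = (leaf 4 ⟨⟩ leaf 0) , refl
    decodeTerm-surjective zero       = (leaf 5 ⟨⟩ leaf 0) , refl
    decodeTerm-surjective (cyl i s)  = let t , e = surjective codedFin i ; u , e′ = decodeTerm-surjective s in (leaf 6 ⟨⟩ (t ⟨⟩ u)) , cong₂ cyl e e′
    decodeTerm-surjective (diag i j) = let t , e = surjective codedFin i ; u , e′ = surjective codedFin j in (leaf 7 ⟨⟩ (t ⟨⟩ u)) , cong₂ diag e e′

    decodeFormula : ∀ k → Tree → Formula m k
    decodeFormula k (leaf 0 ⟨⟩ (s ⟨⟩ t)) = decodeTerm k s ≃ decodeTerm k t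
    decodeFormula k (leaf 1 ⟨⟩ φ) = neg (decodeFormula k φ)
    decodeFormula k (leaf 2 ⟨⟩ (φ ⟨⟩ ψ)) = and (decodeFormula k φ) (decodeFormula k ψ)
    decodeFormula k (leaf 3 ⟨⟩ φ) = ex (decodeFormula (suc k) φ)
    decodeFormula k _ = one ≃ one

    decodeFormula-surjective : ∀ {k} (φ : Formula m k) → ∃[ t ] decodeFormula k t ≡ φ
    decodeFormula-surjective (r ≃ s)   = let t , e = decodeTerm-surjective r ; u , e′ = decodeTerm-surjective s in (leaf 0 ⟨⟩ (t ⟨⟩ u)) , cong₂ _≃_ e e′
    decodeFormula-surjective (neg φ)   = let t , e = decodeFormula-surjective φ in (leaf 1 ⟨⟩ t) , cong neg e
    decodeFormula-surjective (and φ ψ) = let t , e = decodeFormula-surjective φ ; u , e′ = decodeFormula-surjective ψ in (leaf 2 ⟨⟩ (t ⟨⟩ u)) , cong₂ and e e′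
    decodeFormula-surjective (ex φ)    = let t , e = decodeFormula-surjective φ in (leaf 3 ⟨⟩ t) , cong ex e

    decodeInstance : Tree → Instance m
    decodeInstance (leaf k ⟨⟩ (φ ⟨⟩ ρ)) = k , decodeFormula k φ , decodeVec codedConst k ρ
    decodeInstance _ = 0 , (one ≃ one) , []

    codedInstance : Coded (Instance m)
    codedInstance = record
      { decode = decodeInstance
      ; surjective = λ (k , φ , ρ) →
          let t , e = decodeFormula-surjective φ ; u , e′ = surjective (codedVec codedConst k) ρ
          in (leaf k ⟨⟩ (t ⟨⟩ u)) , cong₂ (λ φ ρ → k , φ , ρ) e e′ }

    opaque
      instanceAt : ℕ → Instance m
      instanceAt n = decodeInstance (tree n)

      instanceAt-surjective : ∀ e → ∃[ n ] instanceAt n ≡ e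
      instanceAt-surjective e with surjective codedInstance e
      ... | t , te with tree-surjective t
      ...   | n , nt = n , trans (cong decodeInstance nt) te

    Request : Set
    Request = Vec ℕ m × Fin m × ℕ

    codedRequest : Coded Request
    codedRequest = codedPair (codedVec codedℕ m) (codedPair codedFin codedℕ)

    opaque
      -- Only the first component of the pair coded by `p` is read, so that each request recurs at
      -- arbitrarily large `p`.
      requestAt : ℕ → Request
      requestAt p = decode codedRequest (tree (proj₁ (walk p)))

      requestAt-cofinal : ∀ r b → ∃[ p ] (b ≤ p × requestAt p ≡ r)
      requestAt-cofinal r b with surjective codedRequest r
      ... | t , tr with tree-surjective t
      ...   | n , nt with walk-surjective n b
      ...     | p , w = p ,
        ℕ.≤-trans (ℕ.≤-reflexive (sym (cong proj₂ w))) (ℕ.≤-trans (ℕ.m≤n+m _ (proj₁ (walk p))) (walk-bound p)) ,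
        trans (cong (λ k → decode codedRequest (tree k)) (cong proj₁ w)) (trans (cong (decode codedRequest) nt) tr)

  module _ {m : ℕ} (𝔄 : CylindricStructure m) where
    open CylindricStructure 𝔄

    eval-cong : ∀ {k} {ρ ρ′ : Vec Carrier k} → (∀ x → lookup ρ x ≈ lookup ρ′ x) → ∀ t → eval 𝔄 ρ t ≈ eval 𝔄 ρ′ t
    eval-cong e (var x)    = e x
    eval-cong e (join s t) = ∨-cong (eval-cong e s) (eval-cong e t)
    eval-cong e (meet s t) = ∧-cong (eval-cong e s) (eval-cong e t)
    eval-cong e (compl t)  = -‿cong (eval-cong e t)
    eval-cong e one        = IsEquivalence.refl isEquivalence
    eval-cong e zero       = IsEquivalence.refl isEquivalence
    eval-cong e (cyl i t)  = c-cong i (eval-cong e t)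
    eval-cong e (diag i j) = IsEquivalence.refl isEquivalence

    Sat-cong : ∀ {k} {ρ ρ′ : Vec Carrier k} → (∀ x → lookup ρ x ≈ lookup ρ′ x) → ∀ φ → Sat 𝔄 ρ φ → Sat 𝔄 ρ′ φ
    Sat-cong e (s ≃ t) p = IsEquivalence.trans isEquivalence (IsEquivalence.sym isEquivalence (eval-cong e s))
                             (IsEquivalence.trans isEquivalence p (eval-cong e t))
    Sat-cong e (neg φ) p q = p (Sat-cong (λ x → IsEquivalence.sym isEquivalence (e x)) φ q)
    Sat-cong e (and φ ψ) (p , q) = Sat-cong e φ p , Sat-cong e ψ q
    Sat-cong e (ex φ) (a , p) = a , Sat-cong (λ { fzero → IsEquivalence.refl isEquivalence ; (fsuc x) → e x }) φ p

-- Plays with a reserve of moves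

module Plays (em : {P : Set} → Dec P) (m′ : ℕ) where

  open Structures em m′
  open Extensions em m′
  open ComplexAlgebra em m′
  open Coding
  open Structure
  open Point

  -- An interpretation of the constants: elements of 𝔸 for the gen j, and a network.
  record State : Set where
    constructor state
    field
      val   : ℕ → Element
      world : Structure
      ok    : Valid world

  open State

  at : State → Vec ℕ m → Point
  at σ s = point (world σ) (ok σ) s

  interp : State → Const m → Element
  interp σ (gen j)  = val σ j
  interp σ (typ s)  = ⟨ at σ s ⟩
  interp σ (x ∨ᶜ y) = CylindricStructure._∨_ 𝔸 (interp σ x) (interp σ y)
  interp σ (x ∧ᶜ y) = CylindricStructure._∧_ 𝔸 (interp σ x) (interp σ y)
  interp σ (-ᶜ x)   = CylindricStructure.-_ 𝔸 (interp σ x)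
  interp σ 𝟙ᶜ       = CylindricStructure.𝟙 𝔸
  interp σ 𝟘ᶜ       = CylindricStructure.𝟘 𝔸
  interp σ (cᶜ i x) = cylᴬ i (interp σ x)
  interp σ (dᶜ i j) = diagᴬ i j

  Below : ℕ → Vec ℕ m → Set
  Below b s = ∀ l → lookup s l < b

  record Near (b : ℕ) (σ σ′ : State) : Set where
    field
      val≡  : ∀ {j} → j < b → val σ j ≡ val σ′ j
      agree : Agree (_< b) (world σ) (world σ′)
  open Near

  Near-refl : ∀ {b σ} → Near b σ σ
  Near-refl = record { val≡ = λ _ → refl ; agree = Agree-refl }

  Near-sym : ∀ {b σ σ′} → Near b σ σ′ → Near b σ′ σ
  Near-sym n = record { val≡ = λ j<b → sym (val≡ n j<b) ; agree = Agree-sym (agree n) }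

  Near-trans : ∀ {b σ σ′ σ″} → Near b σ σ′ → Near b σ′ σ″ → Near b σ σ″
  Near-trans n o = record { val≡ = λ j<b → trans (val≡ n j<b) (val≡ o j<b) ; agree = Agree-trans (agree n) (agree o) }

  Near-weaken : ∀ {b c σ σ′} → b ≤ c → Near c σ σ′ → Near b σ σ′
  Near-weaken b≤c n = record { val≡ = λ j<b → val≡ n (ℕ.<-≤-trans j<b b≤c) ; agree = Agree-weaken (λ p<b → ℕ.<-≤-trans p<b b≤c) (agree n) }

  near-type : ∀ {b σ σ′} → Near b σ σ′ → ∀ s → Below b s → at σ s ≋ at σ′ s
  near-type n s s<b = Agree⇒Same s s<b (agree n)

  -- Node p is the answer to the request (s , i , j): if the type of s lies below c i of
  -- the element gen j, then a type below gen j is to be found at s [ i ]≔ p. The answer has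
  -- to be a new node only if gen j cannot be reached along an old one.
  Pending : ℕ → State → Set
  Pending p σ = let s , i , j = requestAt p in
    Below p s × j < p ×
    ∃[ t ] (val σ j ∋ t × at σ s ∼[ i ] t × (∀ l → l ≢ i → lookup (tup t) l ≢ lookup (tup t) i))

  Honoured : ℕ → State → Set
  Honoured p σ = let s , i , j = requestAt p in Pending p σ → val σ j ∋ at σ (s [ i ]≔ p)

  -- The requests below `J` are settled, and `good` is the reserve for `k` more moves.
  record Partial (J k : ℕ) (σ : State) : Set where
    field
      good     : Good (world σ) k
      fresh    : Fresh (world σ) J
      honoured : ∀ p → p < J → Honoured p σ

  below-update : ∀ {b} s i {p} → Below b s → p < b → Below b (s [ i ]≔ p)
  below-update {b} s i {p} s<b p<b l with l Fin.≟ i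
  ... | yes refl = subst (_< b) (sym (lookup∘update i s p)) p<b
  ... | no l≢i = subst (_< b) (sym (lookup∘update′ l≢i s p)) (s<b l)

  Below-mono : ∀ {b c} s → b ≤ c → Below b s → Below c s
  Below-mono s b≤c s<b l = ℕ.<-≤-trans (s<b l) b≤c

  -- Everything that request `p` speaks of is numbered below `p`, by the first two clauses of
  -- `Pending`, and the answer is `p` itself. So what happens from `J` on cannot disturb it.
  Honoured-near : ∀ {J σ σ′ p} → p < J → Near J σ σ′ → Honoured p σ → Honoured p σ′
  Honoured-near {J} {σ} {σ′} {p} p<J n hon (s<p , j<p , t , jt , s∼t , proper) =
    subst (_∋ at σ′ (s [ i ]≔ p)) (val≡ n j<J)
      (∋-resp (val σ j) {at σ (s [ i ]≔ p)} {at σ′ (s [ i ]≔ p)} (near-type n (s [ i ]≔ p) (below-update s i (Below-mono s (ℕ.<⇒≤ p<J) s<p) p<J))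
        (hon (s<p , j<p , t , subst (_∋ t) (sym (val≡ n j<J)) jt ,
          Same-trans (≋⇒∼ (at σ s) (at σ′ s) (near-type n s (Below-mono s (ℕ.<⇒≤ p<J) s<p))) s∼t , proper)))
    where
    s = proj₁ (requestAt {m₁} p)
    i = proj₁ (proj₂ (requestAt {m₁} p))
    j = proj₂ (proj₂ (requestAt {m₁} p))
    j<J : j < J
    j<J = ℕ.<-trans j<p p<J

  -- Request `J` is settled at the price of one unit of reserve, whether it is answered by node `J`
  -- or turns out not to be pending.
  advance : ∀ {J k σ} → Partial J (suc k) σ → ∃[ σ′ ] (Partial (suc J) k σ′ × Near J σ σ′ × val σ′ ≡ val σ)
  advance {J} {k} {σ} part with em {Pending J σ}
  ... | no idle = σ , record
    { good = Good-pred {world σ} (Partial.good part)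
    ; fresh = λ p q J<p → Partial.fresh part p q (ℕ.<⇒≤ J<p)
    ; honoured = λ p p<1+J → case ℕ.m<1+n⇒m<n∨m≡n p<1+J of λ
        { (inj₁ p<J) → Partial.honoured part p p<J
        ; (inj₂ refl) → λ pending → contradiction pending idle } } , Near-refl , refl
  ... | yes (s<J , j<J , t , jt , s∼t , proper)
    with Extend.extend (world σ) (ok σ) k (Partial.good part) J (Partial.fresh part) (proj₁ (requestAt {m₁} J)) s<J
           (proj₁ (proj₂ (requestAt {m₁} J))) (str t) (valid t) (tup t) s∼t proper
  ...   | G⁺ , valid⁺ , good⁺ , fresh⁺ , agree⁺ , same⁺ = σ⁺ , record
    { good = good⁺ ; fresh = fresh⁺
    ; honoured = λ p p<1+J → case ℕ.m<1+n⇒m<n∨m≡n p<1+J of λ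
        { (inj₁ p<J) → Honoured-near p<J near (Partial.honoured part p p<J)
        ; (inj₂ refl) → λ _ → ∋-resp (val σ _) {t} {at σ⁺ _} (Same-sym same⁺) jt } } , near , refl
    where
    σ⁺ : State
    σ⁺ = state (val σ) G⁺ valid⁺
    near : Near J σ σ⁺
    near = record { val≡ = λ _ → refl ; agree = Agree-weaken ℕ.<⇒≢ agree⁺ }

  advance* : ∀ d {J k σ} → Partial J (d + k) σ → ∃[ σ′ ] (Partial (d + J) k σ′ × Near J σ σ′)
  advance* zero    part = _ , part , Near-refl
  advance* (suc d) {J} {k} part with advance part
  ... | σ′ , part′ , near , _ with advance* d part′
  ...   | σ″ , part″ , near′ = σ″ , subst (λ n → Partial n k σ″) (ℕ.+-suc d J) part″ , Near-trans near (Near-weaken (ℕ.n≤1+n J) near′)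

-- The Henkin theory and its term model 𝔹

module Limit (em : {P : Set} → Dec P) (m′ : ℕ) where

  open Structures em m′
  open ComplexAlgebra em m′
  open Coding
  open Plays em m′
  open Structure
  open State
  open Near

  open CylindricStructure 𝔸 using (_≈_)

  vec-bound : ∀ {n} (s : Vec ℕ n) → ∃[ b ] (∀ l → lookup s l < b)
  vec-bound []      = 0 , λ ()
  vec-bound (p ∷ s) = let b , s<b = vec-bound s in suc p ⊔ b , λ
    { fzero    → ℕ.m≤m⊔n (suc p) b
    ; (fsuc l) → ℕ.<-≤-trans (s<b l) (ℕ.m≤n⊔m (suc p) b) }

  const-bound : ∀ x → ∃[ b ] (∀ {σ σ′} → Near b σ σ′ → interp σ x ≈ interp σ′ x)
  const-bound (gen j)  = suc j , λ n t → cong (λ x → proj₁ x t) (val≡ n ℕ.≤-refl)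
  const-bound (typ s)  = let b , s<b = vec-bound s in b , λ {σ} {σ′} n → ≋⇒≈ {at σ s} {at σ′ s} (near-type n s s<b)
  const-bound (x ∨ᶜ y) = let b , f = const-bound x ; c , g = const-bound y in
    b ⊔ c , λ n t → cong₂ _∨_ (f (Near-weaken (ℕ.m≤m⊔n b c) n) t) (g (Near-weaken (ℕ.m≤n⊔m b c) n) t)
  const-bound (x ∧ᶜ y) = let b , f = const-bound x ; c , g = const-bound y in
    b ⊔ c , λ n t → cong₂ _∧_ (f (Near-weaken (ℕ.m≤m⊔n b c) n) t) (g (Near-weaken (ℕ.m≤n⊔m b c) n) t)
  const-bound (-ᶜ x)   = let b , f = const-bound x in b , λ n t → cong not (f n t)
  const-bound 𝟙ᶜ       = 0 , λ _ _ → refl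
  const-bound 𝟘ᶜ       = 0 , λ _ _ → refl
  const-bound (cᶜ i x) = let b , f = const-bound x in
    b , λ {σ} {σ′} n → CylindricStructure.c-cong 𝔸 i {interp σ x} {interp σ′ x} (f n)
  const-bound (dᶜ i j) = 0 , λ _ _ → refl

  env-bound : ∀ {k} (ρ : Vec (Const m) k) → ∃[ b ] (∀ {σ σ′} → Near b σ σ′ → ∀ x → interp σ (lookup ρ x) ≈ interp σ′ (lookup ρ x))
  env-bound []      = 0 , λ _ ()
  env-bound (y ∷ ρ) = let b , f = const-bound y ; c , g = env-bound ρ in b ⊔ c , λ n → λ
    { fzero    → f (Near-weaken (ℕ.m≤m⊔n b c) n)
    ; (fsuc x) → g (Near-weaken (ℕ.m≤n⊔m b c) n) x }

  Holds : Instance m → State → Set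
  Holds (k , φ , ρ) σ = Sat 𝔸 (map (interp σ) ρ) φ

  env-cong : ∀ {k} {ρ : Vec (Const m) k} {σ σ′} → (∀ x → interp σ (lookup ρ x) ≈ interp σ′ (lookup ρ x)) →
             ∀ x → lookup (map (interp σ) ρ) x ≈ lookup (map (interp σ′) ρ) x
  env-cong {ρ = ρ} {σ} {σ′} f x rewrite lookup-map x (interp σ) ρ | lookup-map x (interp σ′) ρ = f x

  Supported : ℕ → (State → Set) → Set
  Supported b X = ∀ {σ σ′} → Near b σ σ′ → X σ → X σ′

  holds-supported : ∀ {k} (φ : Formula m k) ρ {b} → proj₁ (env-bound ρ) ≤ b → Supported b (Holds (k , φ , ρ))
  holds-supported φ ρ le n = Sat-cong 𝔸 (env-cong {ρ = ρ} (proj₂ (env-bound ρ) (Near-weaken le n))) φ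

  -- `X` is a finite condition on states, independent of everything numbered from `N` on. `rich`
  -- takes the part of consistency, and the play it provides may depend on `k`.
  record Stage : Set₁ where
    field
      X         : State → Set
      N         : ℕ
      supported : Supported N X
      rich      : ∀ k → ∃[ σ ] (Partial N k σ × X σ)

  open Stage

  -- The play is taken with `J ∸ N S` additional moves in reserve, which are spent on the requests
  -- in between.
  raise : ∀ S {J} → N S ≤ J → ∀ k → ∃[ σ ] (Partial J k σ × X S σ)
  raise S {J} N≤J k =
    let σ , part , xσ = rich S ((J ∸ N S) + k)
        σ′ , part′ , near = advance* (J ∸ N S) part
    in σ′ , subst (λ n → Partial n k σ′) (ℕ.m∸n+n≡m N≤J) part′ , supported S near xσ

  Partial-weaken : ∀ {J} d {k σ} → Partial J (d + k) σ → Partial J k σ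
  Partial-weaken zero    part = part
  Partial-weaken (suc d) {σ = σ} part = Partial-weaken d (record
    { good = Good-pred {world σ} (Partial.good part) ; fresh = Partial.fresh part ; honoured = Partial.honoured part })

  Witnessed : Instance m → (State → Set) → Set
  Witnessed (k , ex φ , ρ) X = ∃[ j ] (∀ σ → X σ → Holds (suc k , φ , gen j ∷ ρ) σ)
  Witnessed _              _ = ⊤

  record Refinement (S : Stage) (e : Instance m) : Set₁ where
    field
      next    : Stage
      shrink  : ∀ {σ} → X next σ → X S σ
      decided : ((∀ {σ} → X next σ → Holds e σ) × Witnessed e (X next)) ⊎ (∀ {σ} → X next σ → ¬ Holds e σ)

  update : (ℕ → Element) → ℕ → Element → ℕ → Element
  update v B a j = case j ℕ.≟ B of λ { (yes _) → a ; (no _) → v j }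

  update-new : ∀ v B a → update v B a B ≡ a
  update-new v B a with B ℕ.≟ B
  ... | yes _ = refl
  ... | no B≢B = contradiction refl B≢B

  update-old : ∀ v B a {j} → j < B → update v B a j ≡ v j
  update-old v B a {j} j<B with j ℕ.≟ B
  ... | yes refl = contradiction j<B (ℕ.<-irrefl refl)
  ... | no _ = refl

  module Refine (S : Stage) {k : ℕ} (φ : Formula m k) (ρ : Vec (Const m) k) where
    e : Instance m
    e = k , φ , ρ

    B : ℕ
    B = N S ⊔ proj₁ (env-bound ρ)

    N≤B : N S ≤ B
    N≤B = ℕ.m≤m⊔n (N S) _

    e-supported : Supported B (Holds e)
    e-supported = holds-supported φ ρ (ℕ.m≤n⊔m (N S) _)

    S-supported : Supported B (X S)
    S-supported n = supported S (Near-weaken N≤B n)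

    -- Some reserve `k₀` is incompatible with `e`, and then so is every larger one, since reserves
    -- can be lowered. The plays of `S` with reserve `k + k₀` therefore all refute `e`.
    negative : ¬ (∀ k → ∃[ σ ] (Partial B k σ × X S σ × Holds e σ)) → Refinement S e
    negative poor = record
      { next = record
        { X = λ σ → X S σ × ¬ Holds e σ ; N = B
        ; supported = λ n (xσ , ¬e) → S-supported n xσ , λ h → ¬e (e-supported (Near-sym n) h)
        ; rich = λ k → let σ , part , xσ = raise S N≤B (k + k₀) in
            σ , Partial-weaken k₀ (subst (λ n → Partial B n σ) (ℕ.+-comm k k₀) part) , xσ ,
            λ h → k₀-poor (σ , Partial-weaken k part , xσ , h) }
      ; shrink = proj₁
      ; decided = inj₂ proj₂ }
      where
      bad : ∃[ k ] ¬ (∃[ σ ] (Partial B k σ × X S σ × Holds e σ))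
      bad = dne λ none → poor λ k → dne λ n → none (k , n)
      k₀ = proj₁ bad
      k₀-poor = proj₂ bad

    positive : (∀ k → ∃[ σ ] (Partial B k σ × X S σ × Holds e σ)) → Stage
    positive r = record
      { X = λ σ → X S σ × Holds e σ ; N = B
      ; supported = λ n (xσ , h) → S-supported n xσ , e-supported n h ; rich = r }

  -- The constant gen B, and the nodes from B on, may still be interpreted at will.
  witness : ∀ S {k} (φ : Formula m (suc k)) ρ → (let open Refine S (ex φ) ρ) →
            (∀ k → ∃[ σ ] (Partial B k σ × X S σ × Holds e σ)) → Refinement S e
  witness S {k} φ ρ r = record
    { next = record
      { X = λ σ → X S σ × Holds (suc k , φ , gen B ∷ ρ) σ ; N = suc B
      ; supported = λ n (xσ , h) → S-supported (Near-weaken (ℕ.n≤1+n B) n) xσ ,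
          holds-supported φ (gen B ∷ ρ) (ℕ.⊔-lub ℕ.≤-refl (ℕ.≤-trans (ℕ.m≤n⊔m (N S) _) (ℕ.n≤1+n B))) n h
      -- The bound grows to `suc B`, so request `B` has to be settled as well, which costs one unit
      -- of reserve.
      ; rich = λ l → go l (r (suc l)) }
    ; shrink = proj₁
    ; decided = inj₁ ((λ {σ} (xσ , h) → interp σ (gen B) , h) , B , λ σ → proj₂) }
    where
    open Refine S (ex φ) ρ
    go : ∀ l → ∃[ σ ] (Partial B (suc l) σ × X S σ × Holds e σ) →
         ∃[ σ ] (Partial (suc B) l σ × X S σ × Holds (suc k , φ , gen B ∷ ρ) σ)
    go l (σ , part , xσ , a , h) =
      let σ″ , part″ , near , val≡″ = advance part′
          near″ = Near-trans near′ near
      in σ″ , part″ , S-supported near″ xσ ,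
         Sat-cong 𝔸 (λ { fzero t → cong (λ x → proj₁ x t) (sym (trans (cong (λ v → v B) val≡″) (update-new (val σ) B a)))
                       ; (fsuc x) → env-cong {ρ = ρ} {σ} {σ″} (proj₂ (env-bound ρ) (Near-weaken (ℕ.m≤n⊔m (N S) _) near″)) x }) φ h
      where
      σ′ : State
      σ′ = state (update (val σ) B a) (world σ) (ok σ)
      near′ : Near B σ σ′
      near′ = record { val≡ = λ j<B → sym (update-old (val σ) B a j<B) ; agree = Agree-refl }
      part′ : Partial B (suc l) σ′
      part′ = record { good = Partial.good part ; fresh = Partial.fresh part
                     ; honoured = λ p p<B → Honoured-near p<B near′ (Partial.honoured part p p<B) }

  refine : ∀ S e → Refinement S e
  refine S (k , φ , ρ) = by-cases φ ρ em
    where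
    by-cases : ∀ {k} (φ : Formula m k) ρ → (let open Refine S φ ρ) →
               Dec (∀ k → ∃[ σ ] (Partial B k σ × X S σ × Holds e σ)) → Refinement S e
    by-cases φ ρ (no poor) = Refine.negative S φ ρ poor
    by-cases φ@(_ ≃ _)   ρ (yes r) = record { next = Refine.positive S φ ρ r ; shrink = proj₁ ; decided = inj₁ (proj₂ , tt) }
    by-cases φ@(neg _)   ρ (yes r) = record { next = Refine.positive S φ ρ r ; shrink = proj₁ ; decided = inj₁ (proj₂ , tt) }
    by-cases φ@(and _ _) ρ (yes r) = record { next = Refine.positive S φ ρ r ; shrink = proj₁ ; decided = inj₁ (proj₂ , tt) }
    by-cases (ex φ)      ρ (yes r) = witness S φ ρ r

  isolated : Structure
  isolated = record { sort = λ _ → base fzero ; link = λ _ _ → false ; label = λ _ _ → white fzero ; tints = λ _ _ → false }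

  isolated-valid : Valid isolated
  isolated-valid = record
    { allowed = λ { F z a _ (cone () _) }
    ; nonwhite = λ { _ () }
    ; descend = λ { () } }

  initial : Stage
  initial = record
    { X = λ _ → ⊤ ; N = 0 ; supported = λ _ _ → tt
    ; rich = λ k → state (λ _ → CylindricStructure.𝟘 𝔸) isolated isolated-valid ,
        record { good = λ F _ → inj₁ (λ a ()) ; fresh = λ _ _ _ → refl , refl ; honoured = λ p () } , tt }

  chain : ℕ → Stage
  chain zero    = initial
  chain (suc n) = Refinement.next (refine (chain n) (instanceAt n))

  chain-shrinks : ∀ d n {σ} → X (chain (d + n)) σ → X (chain n) σ
  chain-shrinks zero    n x = x
  chain-shrinks (suc d) n x = chain-shrinks d n (Refinement.shrink (refine (chain (d + n)) (instanceAt (d + n))) x)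

  chain-mono : ∀ {n n′ σ} → n ≤ n′ → X (chain n′) σ → X (chain n) σ
  chain-mono {n} {n′} {σ} n≤n′ x = chain-shrinks (n′ ∸ n) n (subst (λ l → X (chain l) σ) (sym (ℕ.m∸n+n≡m n≤n′)) x)

  Γ : Instance m → Set
  Γ e = ∃[ n ] (∀ {σ} → X (chain n) σ → Holds e σ)

  common : ∀ n J → ∃[ σ ] (X (chain n) σ × ∃[ J′ ] (J ≤ J′ × Partial J′ 0 σ))
  common n J =
    let σ , part , xσ = raise (chain n) {N (chain n) ⊔ J} (ℕ.m≤m⊔n _ J) 0
    in σ , xσ , _ , ℕ.m≤n⊔m (N (chain n)) J , part

  Decided : Instance m → Set
  Decided e = (Γ e × ∃[ n ] Witnessed e (X (chain n))) ⊎ (∃[ n ] (∀ {σ} → X (chain n) σ → ¬ Holds e σ))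

  opaque
    decide : ∀ e → Decided e
    decide e = let n , n≡ = instanceAt-surjective e in
      subst Decided n≡ (case Refinement.decided (refine (chain n) (instanceAt n)) of λ
        { (inj₁ (pos , w)) → inj₁ ((suc n , λ {σ} → pos {σ}) , suc n , w)
        ; (inj₂ refutes)   → inj₂ (suc n , λ {σ} → refutes {σ}) })

  -- Stages do not mention plays, yet `e` may be concluded from what holds once many requests are
  -- settled: were `e` refuted instead, a sufficiently advanced play at a common later stage would
  -- contradict the refutation.
  infer : ∀ n J e → (∀ {σ J′} → J ≤ J′ → Partial J′ 0 σ → X (chain n) σ → Holds e σ) → Γ e
  infer n J e h with decide e
  ... | inj₁ (γ , _) = γ
  ... | inj₂ (n′ , refutes) =
    let σ , xσ , J′ , J≤J′ , part = common (n ⊔ n′) J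
    in contradiction (h J≤J′ part (chain-mono (ℕ.m≤m⊔n n n′) xσ)) (refutes (chain-mono (ℕ.m≤n⊔m n n′) xσ))

  Γ-valid : ∀ e → (∀ σ → Holds e σ) → Γ e
  Γ-valid e h = infer 0 0 e (λ {σ} _ _ _ → h σ)

  Γ-map : ∀ e e′ → (∀ σ → Holds e σ → Holds e′ σ) → Γ e → Γ e′
  Γ-map e e′ f (n , γ) = n , λ {σ} x → f σ (γ x)

  Γ-map₂ : ∀ e e′ e″ → (∀ σ → Holds e σ → Holds e′ σ → Holds e″ σ) → Γ e → Γ e′ → Γ e″
  Γ-map₂ e e′ e″ f (n , γ) (n′ , γ′) =
    n ⊔ n′ , λ {σ} x → f σ (γ (chain-mono (ℕ.m≤m⊔n n n′) x)) (γ′ (chain-mono (ℕ.m≤n⊔m n n′) x))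

  Γ-consistent : ∀ e e′ → (∀ σ → Holds e σ → ¬ Holds e′ σ) → Γ e → ¬ Γ e′
  Γ-consistent e e′ f (n , γ) (n′ , γ′) =
    let σ , xσ , _ = common (n ⊔ n′) 0
    in f σ (γ (chain-mono (ℕ.m≤m⊔n n n′) xσ)) (γ′ (chain-mono (ℕ.m≤n⊔m n n′) xσ))

  Γ-neg : ∀ {k} (φ : Formula m k) ρ → ¬ Γ (k , φ , ρ) → Γ (k , neg φ , ρ)
  Γ-neg φ ρ ¬γ with decide (_ , φ , ρ)
  ... | inj₁ (γ , _) = contradiction γ ¬γ
  ... | inj₂ r = r

  Γ-ex : ∀ {k} (φ : Formula m (suc k)) ρ → Γ (k , ex φ , ρ) → ∃[ j ] Γ (suc k , φ , gen j ∷ ρ)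
  Γ-ex φ ρ (n , γ) with decide (_ , ex φ , ρ)
  ... | inj₁ (_ , n′ , j , w) = j , n′ , λ {σ} → w σ
  ... | inj₂ (n′ , refutes) =
    let σ , xσ , _ = common (n ⊔ n′) 0
    in contradiction (γ (chain-mono (ℕ.m≤m⊔n n n′) xσ)) (refutes (chain-mono (ℕ.m≤n⊔m n n′) xσ))

  _≃ᶜ_ : Const m → Const m → Instance m
  x ≃ᶜ y = 2 , (var fzero ≃ var (fsuc fzero)) , x ∷ y ∷ []

  -- The term model of the theory `Γ`.
  𝔹 : CylindricStructure m
  𝔹 = record
    { Carrier = Const m
    ; _≈_ = λ x y → Γ (x ≃ᶜ y)
    ; _∨_ = _∨ᶜ_ ; _∧_ = _∧ᶜ_ ; -_ = -ᶜ_ ; 𝟙 = 𝟙ᶜ ; 𝟘 = 𝟘ᶜ ; c = cᶜ ; d = dᶜ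
    ; isEquivalence = record
      { refl = λ {x} → Γ-valid (x ≃ᶜ x) (λ _ _ → refl)
      ; sym = λ {x} {y} → Γ-map (x ≃ᶜ y) (y ≃ᶜ x) (λ _ e t → sym (e t))
      ; trans = λ {x} {y} {z} → Γ-map₂ (x ≃ᶜ y) (y ≃ᶜ z) (x ≃ᶜ z) (λ _ e f t → trans (e t) (f t)) }
    ; ∨-cong = λ {x} {x′} {y} {y′} → Γ-map₂ (x ≃ᶜ x′) (y ≃ᶜ y′) ((x ∨ᶜ y) ≃ᶜ (x′ ∨ᶜ y′)) (λ _ e f t → cong₂ _∨_ (e t) (f t))
    ; ∧-cong = λ {x} {x′} {y} {y′} → Γ-map₂ (x ≃ᶜ x′) (y ≃ᶜ y′) ((x ∧ᶜ y) ≃ᶜ (x′ ∧ᶜ y′)) (λ _ e f t → cong₂ _∧_ (e t) (f t))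
    ; -‿cong = λ {x} {y} → Γ-map (x ≃ᶜ y) ((-ᶜ x) ≃ᶜ (-ᶜ y)) (λ _ e t → cong not (e t))
    ; c-cong = λ i {x} {y} → Γ-map (x ≃ᶜ y) (cᶜ i x ≃ᶜ cᶜ i y) (λ σ → CylindricStructure.c-cong 𝔸 i {interp σ x} {interp σ y}) }

  interp-eval : ∀ {k} σ (ρ : Vec (Const m) k) t → interp σ (eval 𝔹 ρ t) ≡ eval 𝔸 (map (interp σ) ρ) t
  interp-eval σ ρ (var x)    = sym (lookup-map x (interp σ) ρ)
  interp-eval σ ρ (join s t) = cong₂ (CylindricStructure._∨_ 𝔸) (interp-eval σ ρ s) (interp-eval σ ρ t)
  interp-eval σ ρ (meet s t) = cong₂ (CylindricStructure._∧_ 𝔸) (interp-eval σ ρ s) (interp-eval σ ρ t)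
  interp-eval σ ρ (compl t)  = cong (CylindricStructure.-_ 𝔸) (interp-eval σ ρ t)
  interp-eval σ ρ one        = refl
  interp-eval σ ρ zero       = refl
  interp-eval σ ρ (cyl i t)  = cong (cylᴬ i) (interp-eval σ ρ t)
  interp-eval σ ρ (diag i j) = refl

  -- The truth lemma, with both directions proved together because negation exchanges them.
  -- Completeness enters as `Γ-neg`, the Henkin witnesses as `Γ-ex`.
  truth⇒ : ∀ {k} (φ : Formula m k) ρ → Sat 𝔹 ρ φ → Γ (k , φ , ρ)
  truth⇐ : ∀ {k} (φ : Formula m k) ρ → Γ (k , φ , ρ) → Sat 𝔹 ρ φ

  truth⇒ (s ≃ t) ρ   = Γ-map (eval 𝔹 ρ s ≃ᶜ eval 𝔹 ρ t) (_ , (s ≃ t) , ρ) (λ σ → subst₂ _≈_ (interp-eval σ ρ s) (interp-eval σ ρ t))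
  truth⇒ (neg φ) ρ ¬φ = Γ-neg φ ρ (λ γ → ¬φ (truth⇐ φ ρ γ))
  truth⇒ (and φ ψ) ρ (p , q) = Γ-map₂ (_ , φ , ρ) (_ , ψ , ρ) (_ , and φ ψ , ρ) (λ _ → _,_) (truth⇒ φ ρ p) (truth⇒ ψ ρ q)
  truth⇒ (ex φ) ρ (x , p) = Γ-map (_ , φ , x ∷ ρ) (_ , ex φ , ρ) (λ σ h → interp σ x , h) (truth⇒ φ (x ∷ ρ) p)

  truth⇐ (s ≃ t) ρ   = Γ-map (_ , (s ≃ t) , ρ) (eval 𝔹 ρ s ≃ᶜ eval 𝔹 ρ t) (λ σ → subst₂ _≈_ (sym (interp-eval σ ρ s)) (sym (interp-eval σ ρ t)))
  truth⇐ (neg φ) ρ γ p = Γ-consistent (_ , neg φ , ρ) (_ , φ , ρ) (λ _ → id) γ (truth⇒ φ ρ p)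
  truth⇐ (and φ ψ) ρ γ = truth⇐ φ ρ (Γ-map (_ , and φ ψ , ρ) (_ , φ , ρ) (λ _ → proj₁) γ) ,
                         truth⇐ ψ ρ (Γ-map (_ , and φ ψ , ρ) (_ , ψ , ρ) (λ _ → proj₂) γ)
  truth⇐ (ex φ) ρ γ    = let j , δ = Γ-ex φ ρ γ in gen j , truth⇐ φ (gen j ∷ ρ) δ

  -- A sentence contains no constants, so whether it holds in a state does not depend on the state:
  -- `Γ` contains every sentence true in `𝔸`.
  equivalent : ∀ (φ : Sentence m) → Sat 𝔹 [] φ → Sat 𝔸 [] φ
  equivalent φ p = dne λ ¬φ → Γ-consistent (0 , φ , []) (0 , neg φ , []) (λ _ h n → n h) (truth⇒ φ [] p)
                     (Γ-valid (0 , neg φ , []) (λ _ → ¬φ))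

-- The full set representation of 𝔹 on tuples of numbers

module Forcing (em : {P : Set} → Dec P) (m′ : ℕ) where

  open Structures em m′
  open ComplexAlgebra em m′
  open Coding
  open Plays em m′
  open Limit em m′
  open Structure
  open Point
  open State
  open Stage
  open Same

  open CylindricStructure 𝔹 using (_≈_; _≼_)

  infix 4 _⊩_
  -- Since `typ s` is always interpreted by the atom of the tuple `s`, this says that the theory
  -- puts the type of `s` into `x`. The record keeps `s` and `x` visible to unification.
  record _⊩_ (s : Vec ℕ m) (x : Const m) : Set where
    constructor forced
    field
      claim : typ s ≼ x
  open _⊩_

  ⊩⇒ : ∀ s x σ → Holds (typ s ≃ᶜ (typ s ∧ᶜ x)) σ → interp σ x ∋ at σ s
  ⊩⇒ s x σ h = ⟨⟩≼⇒∋ {interp σ x} {at σ s} h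

  ⊩⇐ : ∀ s x σ → interp σ x ∋ at σ s → Holds (typ s ≃ᶜ (typ s ∧ᶜ x)) σ
  ⊩⇐ s x σ h = ∋⇒⟨⟩≼ {interp σ x} {at σ s} h

  Claim : Vec ℕ m → Const m → Instance m
  Claim s x = typ s ≃ᶜ (typ s ∧ᶜ x)

  ⊩-map : ∀ {s t} x y → (∀ σ → interp σ x ∋ at σ s → interp σ y ∋ at σ t) → s ⊩ x → t ⊩ y
  ⊩-map {s} {t} x y f h = forced (Γ-map (Claim s x) (Claim t y) (λ σ h → ⊩⇐ t y σ (f σ (⊩⇒ s x σ h))) (claim h))

  ⊩-map₂ : ∀ {s t u} x y z → (∀ σ → interp σ x ∋ at σ s → interp σ y ∋ at σ t → interp σ z ∋ at σ u) → s ⊩ x → t ⊩ y → u ⊩ z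
  ⊩-map₂ {s} {t} {u} x y z f h k = forced (Γ-map₂ (Claim s x) (Claim t y) (Claim u z)
    (λ σ h k → ⊩⇐ u z σ (f σ (⊩⇒ s x σ h) (⊩⇒ t y σ k))) (claim h) (claim k))

  ⊩-valid : ∀ s x → (∀ σ → interp σ x ∋ at σ s) → s ⊩ x
  ⊩-valid s x f = forced (Γ-valid (Claim s x) (λ σ → ⊩⇐ s x σ (f σ)))

  ⊩-consistent : ∀ {s t} x y → (∀ σ → interp σ x ∋ at σ s → ¬ interp σ y ∋ at σ t) → s ⊩ x → ¬ t ⊩ y
  ⊩-consistent {s} {t} x y f h k = Γ-consistent (Claim s x) (Claim t y) (λ σ h k → f σ (⊩⇒ s x σ h) (⊩⇒ t y σ k)) (claim h) (claim k)

  ⊩-refutes : ∀ {s x} → ¬ s ⊩ x → ∃[ n ] (∀ {σ} → X (chain n) σ → ¬ interp σ x ∋ at σ s)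
  ⊩-refutes {s} {x} ¬sx with decide (Claim s x)
  ... | inj₁ (γ , _) = contradiction (forced γ) ¬sx
  ... | inj₂ (n , refutes) = n , λ {σ} xσ h → refutes xσ (⊩⇐ s x σ h)

  ⊩-𝟙 : ∀ s → s ⊩ 𝟙ᶜ
  ⊩-𝟙 s = ⊩-valid s 𝟙ᶜ (λ _ → refl)

  ⊩-𝟘 : ∀ {s} → ¬ s ⊩ 𝟘ᶜ
  ⊩-𝟘 h = ⊩-consistent 𝟘ᶜ 𝟘ᶜ (λ _ ()) h h

  ⊩-∧ : ∀ {s x y} → s ⊩ x → s ⊩ y → s ⊩ (x ∧ᶜ y)
  ⊩-∧ {x = x} {y} = ⊩-map₂ x y (x ∧ᶜ y) (λ _ → cong₂ _∧_)

  ⊩-∧ˡ : ∀ {s x y} → s ⊩ (x ∧ᶜ y) → s ⊩ x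
  ⊩-∧ˡ {x = x} {y} = ⊩-map (x ∧ᶜ y) x (λ σ → left)
    where
    left : ∀ {b b′} → b ∧ b′ ≡ true → b ≡ true
    left {true} _ = refl

  ⊩-∧ʳ : ∀ {s x y} → s ⊩ (x ∧ᶜ y) → s ⊩ y
  ⊩-∧ʳ {x = x} {y} = ⊩-map (x ∧ᶜ y) y (λ σ → right)
    where
    right : ∀ {b b′} → b ∧ b′ ≡ true → b′ ≡ true
    right {true} e = e

  ⊩-- : ∀ {s x} → ¬ s ⊩ x → s ⊩ (-ᶜ x)
  ⊩-- {s} {x} ¬sx =
    let n , refutes = ⊩-refutes ¬sx
    in forced (infer n 0 (Claim s (-ᶜ x)) (λ {σ} _ _ xσ → ⊩⇐ s (-ᶜ x) σ (flip (refutes xσ))))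
    where
    flip : ∀ {b} → ¬ b ≡ true → not b ≡ true
    flip {true}  n = contradiction refl n
    flip {false} _ = refl

  ⊩-¬ : ∀ {s x} → s ⊩ (-ᶜ x) → ¬ s ⊩ x
  ⊩-¬ {x = x} = ⊩-consistent (-ᶜ x) x (λ σ e e′ → case trans (sym e) (cong not e′) of λ ())

  ⊩-∨ˡ : ∀ {s x y} → s ⊩ x → s ⊩ (x ∨ᶜ y)
  ⊩-∨ˡ {x = x} {y} = ⊩-map x (x ∨ᶜ y) (λ σ e → cong (_∨ _) e)

  ⊩-∨ʳ : ∀ {s x y} → s ⊩ y → s ⊩ (x ∨ᶜ y)
  ⊩-∨ʳ {x = x} {y} = ⊩-map y (x ∨ᶜ y) (λ σ e → trans (cong (_ ∨_) e) (Bool.∨-zeroʳ _))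

  ⊩-∨ : ∀ {s x y} → s ⊩ (x ∨ᶜ y) → s ⊩ x ⊎ s ⊩ y
  ⊩-∨ {s} {x} {y} h with em {s ⊩ x}
  ... | yes sx = inj₁ sx
  ... | no ¬sx = inj₂ (⊩-map₂ (x ∨ᶜ y) (-ᶜ x) y (λ σ → other) h (⊩-- ¬sx))
    where
    other : ∀ {b b′} → b ∨ b′ ≡ true → not b ≡ true → b′ ≡ true
    other {false} e _ = e

  ⊩-d : ∀ {s i j} → lookup s i ≡ lookup s j → s ⊩ dᶜ i j
  ⊩-d {s} {i} {j} e = ⊩-valid s (dᶜ i j) (λ _ → is⁺ e)

  ⊩-d⁻ : ∀ {s i j} → s ⊩ dᶜ i j → lookup s i ≡ lookup s j
  ⊩-d⁻ {s} {i} {j} h = dne λ s≢ → ⊩-consistent (dᶜ i j) (dᶜ i j) (λ _ e _ → s≢ (is⁻ e)) h h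

  ⊩-c : ∀ {s t i x} → AgreeOff i t s → t ⊩ x → s ⊩ cᶜ i x
  ⊩-c {s} {t} {i} {x} off = ⊩-map x (cᶜ i x) (λ σ e → is⁺ (at σ t ,
    lookup≡⇒∼ {world σ} {ok σ} {ok σ} {s} {t} (λ j j≢i → sym (off j j≢i)) , e))

  ⊩-resp : ∀ {s} x y → x ≈ y → s ⊩ x → s ⊩ y
  ⊩-resp {s} x y e h = forced (Γ-map₂ (x ≃ᶜ y) (Claim s x) (Claim s y)
    (λ σ e h → ⊩⇐ s y σ (trans (sym (e (at σ s))) (⊩⇒ s x σ h))) e (claim h))

  uniform : ∀ {n} (P : Fin n → ℕ → Set) → (∀ {l a b} → a ≤ b → P l a → P l b) → (∀ l → ∃[ a ] P l a) → ∃[ a ] (∀ l → P l a)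
  uniform {zero}  P mono f = 0 , λ ()
  uniform {suc n} P mono f =
    let a , p = f fzero
        b , q = uniform (λ l → P (fsuc l)) mono (λ l → f (fsuc l))
    in a ⊔ b , λ { fzero → mono (ℕ.m≤m⊔n a b) p ; (fsuc l) → mono (ℕ.m≤n⊔m a b) (q l) }

  -- The improper extensions of a type repeat one of its nodes.
  repeat-type : ∀ σ s i (t : Point) l → l ≢ i → at σ s ∼[ i ] t → lookup (tup t) l ≡ lookup (tup t) i →
                t ≋ at σ (s [ i ]≔ lookup s l)
  repeat-type σ s i t l l≢i s∼t tl≡ti = record
    { eq⇒ = λ {j} {j′} _ _ e → trans (s⁺≡ j) (trans (eq⇐ s∼t (r≢i j) (r≢i j′) (trans (sym (t≡ j)) (trans e (t≡ j′)))) (sym (s⁺≡ j′)))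
    ; eq⇐ = λ {j} {j′} _ _ e → trans (t≡ j) (trans (eq⇒ s∼t (r≢i j) (r≢i j′) (trans (sym (s⁺≡ j)) (trans e (s⁺≡ j′)))) (sym (t≡ j′)))
    ; sort≡ = λ {j} _ → trans (cong (sort (str t)) (t≡ j)) (trans (sym (sort≡ s∼t (r≢i j))) (cong (sort (world σ)) (sym (s⁺≡ j))))
    ; link≡ = λ {j} {j′} _ _ → trans (cong₂ (link (str t)) (t≡ j) (t≡ j′))
        (trans (sym (link≡ s∼t (r≢i j) (r≢i j′))) (cong₂ (link (world σ)) (sym (s⁺≡ j)) (sym (s⁺≡ j′))))
    ; label≡ = λ {j} {j′} _ _ → trans (cong₂ (label (str t)) (t≡ j) (t≡ j′))
        (trans (sym (label≡ s∼t (r≢i j) (r≢i j′))) (cong₂ (label (world σ)) (sym (s⁺≡ j)) (sym (s⁺≡ j′))))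
    ; tints≡ = λ v _ a → trans (cong (λ F → tints (str t) F a) (lookup-ext λ c →
          trans (lookup-map c (lookup (tup t)) v) (trans (t≡ (lookup v c)) (sym (trans (lookup-map c (lookup (tup t)) (map r v)) (cong (lookup (tup t)) (lookup-map c r v)))))))
        (trans (sym (tints≡ s∼t (map r v) (λ c e → r≢i (lookup v c) (trans (sym (lookup-map c r v)) e)) a))
          (cong (λ F → tints (world σ) F a) (lookup-ext λ c →
            trans (trans (lookup-map c (lookup s) (map r v)) (cong (lookup s) (lookup-map c r v)))
              (sym (trans (lookup-map c (lookup (s [ i ]≔ lookup s l)) v) (s⁺≡ (lookup v c))))))) }
    where
    r : Fin m → Fin m
    r j = case j Fin.≟ i of λ { (yes _) → l ; (no _) → j }
    r≢i : ∀ j → r j ≢ i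
    r≢i j with j Fin.≟ i
    ... | yes _ = l≢i
    ... | no j≢i = j≢i
    t≡ : ∀ j → lookup (tup t) j ≡ lookup (tup t) (r j)
    t≡ j with j Fin.≟ i
    ... | yes refl = sym tl≡ti
    ... | no _ = refl
    s⁺≡ : ∀ j → lookup (s [ i ]≔ lookup s l) j ≡ lookup s (r j)
    s⁺≡ j with j Fin.≟ i
    ... | yes refl = lookup∘update i s _
    ... | no j≢i = lookup∘update′ j≢i s _

  -- Requests refer to generators only. A generator for `x` is the Henkin witness of the statement
  -- that something equals `x`.
  named : ∀ x → ∃[ j ] gen j ≈ x
  named x = Γ-ex (var fzero ≃ var (fsuc fzero)) (x ∷ []) (Γ-valid (1 , ex (var fzero ≃ var (fsuc fzero)) , x ∷ []) (λ σ → interp σ x , λ _ → refl))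

  -- If no repetition of another entry of `s` works, some stage refutes them all. At that stage a
  -- type witnessing the cylindrification is proper, by `repeat-type`; so a request made after the
  -- generator and the nodes of `s` is pending, and its own node is the answer.
  ⊩-witness : ∀ {s i x} → s ⊩ cᶜ i x → ∃[ p ] s [ i ]≔ p ⊩ x
  ⊩-witness {s} {i} {x} sx with em {∃[ l ] (l ≢ i × s [ i ]≔ lookup s l ⊩ x)}
  ... | yes (l , _ , h) = lookup s l , h
  ... | no none = p , ⊩-resp (gen j) x gen≈x (forced (infer n (suc p) (Claim s⁺ (gen j)) λ {σ} J≤J′ part xσ →
      ⊩⇐ s⁺ (gen j) σ (answer σ (Partial.honoured part p J≤J′) xσ)))
    where
    j = proj₁ (named x)
    gen≈x = proj₂ (named x)
    b = proj₁ (vec-bound s)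
    found = requestAt-cofinal (s , i , j) (suc j ⊔ b)
    p = proj₁ found
    p-large = proj₁ (proj₂ found)
    p-request = proj₂ (proj₂ found)
    s⁺ = s [ i ]≔ p
    Refuted : Fin m → ℕ → Set
    Refuted l n = ∀ {σ} → X (chain n) σ → l ≢ i → ¬ interp σ x ∋ at σ (s [ i ]≔ lookup s l)
    refuted : ∃[ n ] (∀ l → Refuted l n)
    refuted = uniform Refuted (λ a≤b f {σ} xσ → f {σ} (chain-mono a≤b xσ)) λ l → case l Fin.≟ i of λ
      { (yes refl) → 0 , λ {σ} _ l≢l → contradiction refl l≢l
      ; (no l≢i) → let n , r = ⊩-refutes {s [ i ]≔ lookup s l} {x} (λ h → none (l , l≢i , h)) in n , λ {σ} xσ _ → r {σ} xσ }
    n₁ = proj₁ refuted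
    n₂ = proj₁ (claim sx)
    n₃ = proj₁ gen≈x
    n = n₁ ⊔ (n₂ ⊔ n₃)
    answer : ∀ σ → Honoured p σ → X (chain n) σ → val σ j ∋ at σ s⁺
    answer σ hon xσ =
      let x∋t = is⁻ (⊩⇒ s (cᶜ i x) σ (proj₂ (claim sx) (chain-mono (ℕ.≤-trans (ℕ.m≤m⊔n n₂ n₃) (ℕ.m≤n⊔m n₁ _)) xσ)))
          t , s∼t , xt = x∋t
          gen≡ = proj₂ gen≈x {σ} (chain-mono (ℕ.≤-trans (ℕ.m≤n⊔m n₂ n₃) (ℕ.m≤n⊔m n₁ _)) xσ)
      in subst (λ r → Honouring r) p-request hon
           ( (λ l → ℕ.<-≤-trans (proj₂ (vec-bound s) l) (ℕ.≤-trans (ℕ.m≤n⊔m (suc j) b) p-large))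
           , ℕ.≤-trans (ℕ.m≤m⊔n (suc j) b) p-large
           , t , trans (gen≡ t) xt , s∼t
           , λ l l≢i e → proj₂ refuted l (chain-mono (ℕ.m≤m⊔n n₁ _) xσ) l≢i
               (∋-resp (interp σ x) {t} {at σ (s [ i ]≔ lookup s l)} (repeat-type σ s i t l l≢i s∼t e) xt))
      where
      Honouring : Vec ℕ m × Fin m × ℕ → Set
      Honouring (s , i , j) = Below p s × j < p ×
        ∃[ t ] (val σ j ∋ t × at σ s ∼[ i ] t × (∀ l → l ≢ i → lookup (tup t) l ≢ lookup (tup t) i)) → val σ j ∋ at σ (s [ i ]≔ p)

  ⊩-c⁻ : ∀ {s i x} → s ⊩ cᶜ i x → ∃[ t ] (t ⊩ x × AgreeOff i t s)
  ⊩-c⁻ {s} {i} h = let p , h′ = ⊩-witness h in s [ i ]≔ p , h′ , λ j j≢i → lookup∘update′ j≢i s p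

  cylsᶜ : List (Fin m) → Const m → Const m
  cylsᶜ []      x = x
  cylsᶜ (i ∷ L) x = cᶜ i (cylsᶜ L x)

  interp-cyls : ∀ σ L x → interp σ (cylsᶜ L x) ≡ cyls L (interp σ x)
  interp-cyls σ []      x = refl
  interp-cyls σ (i ∷ L) x = cong (cylᴬ i) (interp-cyls σ L x)

  ⊩-cyls : ∀ L {s x} → s ⊩ cylsᶜ L x → ∃[ t ] t ⊩ x
  ⊩-cyls []      {s} h = s , h
  ⊩-cyls (i ∷ L) h = let p , h′ = ⊩-witness h in ⊩-cyls L h′

  -- In the states of some stage `x` and `y` differ, so the symmetric difference `z` is nonzero and,
  -- by `simple`, its closure under all cylindrifications is the unit. Any tuple forces that
  -- closure, for instance the zero tuple, and `⊩-witness` strips off the cylindrifications one by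
  -- one.
  separate : ∀ {x y} → ¬ x ≈ y → ∃[ s ] (s ⊩ ((x ∧ᶜ (-ᶜ y)) ∨ᶜ ((-ᶜ x) ∧ᶜ y)))
  separate {x} {y} x≉y with decide (x ≃ᶜ y)
  ... | inj₁ (γ , _) = contradiction γ x≉y
  ... | inj₂ (n , refutes) = ⊩-cyls (allFin m) (forced (infer n 0 (Claim s₀ (cylsᶜ (allFin m) z)) λ {σ} _ _ xσ →
      ⊩⇐ s₀ (cylsᶜ (allFin m) z) σ (subst (_∋ at σ s₀) (sym (interp-cyls σ (allFin m) z))
        (simple (interp σ z) (differ σ (refutes xσ)) (at σ s₀)))))
    where
    z = (x ∧ᶜ (-ᶜ y)) ∨ᶜ ((-ᶜ x) ∧ᶜ y)
    s₀ = replicate m 0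
    xor : ∀ b b′ → ¬ (b ∧ not b′) ∨ (not b ∧ b′) ≡ true → b ≡ b′
    xor true  true  _ = refl
    xor true  false n = contradiction refl n
    xor false true  n = contradiction refl n
    xor false false _ = refl
    differ : ∀ σ → ¬ Holds (x ≃ᶜ y) σ → ∃[ t ] interp σ z ∋ t
    differ σ x≉y = dne λ none → x≉y λ t → xor _ _ λ h → none (t , h)

  extensional : ∀ {x y} → (∀ s → s ⊩ x → s ⊩ y) → (∀ s → s ⊩ y → s ⊩ x) → x ≈ y
  extensional {x} {y} f g = dne λ x≉y → let s , h = separate x≉y in case ⊩-∨ h of λ
    { (inj₁ k) → ⊩-¬ (⊩-∧ʳ k) (f s (⊩-∧ˡ k))
    ; (inj₂ k) → ⊩-¬ (⊩-∧ˡ k) (g s (⊩-∧ʳ k)) }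

  -- The Boolean laws hold in every interpretation. Those with cylindrifications or diagonals are
  -- taken from the set algebra on all `m`-tuples, by `extensional`.
  cylindric : IsCylindricAlgebra 𝔹
  cylindric = record
    { isBooleanAlgebra = record
      { isDistributiveLattice = record
        { isLattice = record
          { isEquivalence = CylindricStructure.isEquivalence 𝔹
          ; ∨-comm = λ x y → Γ-valid ((x ∨ᶜ y) ≃ᶜ (y ∨ᶜ x)) (λ σ t → Bool.∨-comm (e σ t x) (e σ t y))
          ; ∨-assoc = λ x y z → Γ-valid (((x ∨ᶜ y) ∨ᶜ z) ≃ᶜ (x ∨ᶜ (y ∨ᶜ z))) (λ σ t → Bool.∨-assoc (e σ t x) (e σ t y) (e σ t z))
          ; ∨-cong = λ {x} {y} {u} {v} → CylindricStructure.∨-cong 𝔹 {x} {y} {u} {v}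
          ; ∧-comm = λ x y → Γ-valid ((x ∧ᶜ y) ≃ᶜ (y ∧ᶜ x)) (λ σ t → Bool.∧-comm (e σ t x) (e σ t y))
          ; ∧-assoc = λ x y z → Γ-valid (((x ∧ᶜ y) ∧ᶜ z) ≃ᶜ (x ∧ᶜ (y ∧ᶜ z))) (λ σ t → Bool.∧-assoc (e σ t x) (e σ t y) (e σ t z))
          ; ∧-cong = λ {x} {y} {u} {v} → CylindricStructure.∧-cong 𝔹 {x} {y} {u} {v}
          ; absorptive = (λ x y → Γ-valid ((x ∨ᶜ (x ∧ᶜ y)) ≃ᶜ x) (λ σ t → Bool.∨-abs-∧ (e σ t x) (e σ t y)))
                       , (λ x y → Γ-valid ((x ∧ᶜ (x ∨ᶜ y)) ≃ᶜ x) (λ σ t → Bool.∧-abs-∨ (e σ t x) (e σ t y))) }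
        ; ∨-distrib-∧ = (λ x y z → Γ-valid ((x ∨ᶜ (y ∧ᶜ z)) ≃ᶜ ((x ∨ᶜ y) ∧ᶜ (x ∨ᶜ z))) (λ σ t → Bool.∨-distribˡ-∧ (e σ t x) (e σ t y) (e σ t z)))
                      , (λ x y z → Γ-valid (((y ∧ᶜ z) ∨ᶜ x) ≃ᶜ ((y ∨ᶜ x) ∧ᶜ (z ∨ᶜ x))) (λ σ t → Bool.∨-distribʳ-∧ (e σ t x) (e σ t y) (e σ t z)))
        ; ∧-distrib-∨ = (λ x y z → Γ-valid ((x ∧ᶜ (y ∨ᶜ z)) ≃ᶜ ((x ∧ᶜ y) ∨ᶜ (x ∧ᶜ z))) (λ σ t → Bool.∧-distribˡ-∨ (e σ t x) (e σ t y) (e σ t z)))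
                      , (λ x y z → Γ-valid (((y ∨ᶜ z) ∧ᶜ x) ≃ᶜ ((y ∧ᶜ x) ∨ᶜ (z ∧ᶜ x))) (λ σ t → Bool.∧-distribʳ-∨ (e σ t x) (e σ t y) (e σ t z))) }
      ; ∨-complement = (λ x → Γ-valid (((-ᶜ x) ∨ᶜ x) ≃ᶜ 𝟙ᶜ) (λ σ t → Bool.∨-inverseˡ (e σ t x)))
                     , (λ x → Γ-valid ((x ∨ᶜ (-ᶜ x)) ≃ᶜ 𝟙ᶜ) (λ σ t → Bool.∨-inverseʳ (e σ t x)))
      ; ∧-complement = (λ x → Γ-valid (((-ᶜ x) ∧ᶜ x) ≃ᶜ 𝟘ᶜ) (λ σ t → Bool.∧-inverseˡ (e σ t x)))
                     , (λ x → Γ-valid ((x ∧ᶜ (-ᶜ x)) ≃ᶜ 𝟘ᶜ) (λ σ t → Bool.∧-inverseʳ (e σ t x)))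
      ; ¬-cong = λ {x} {y} → CylindricStructure.-‿cong 𝔹 {x} {y} }
    ; c-𝟘 = λ i → extensional (λ s h → let t , k , _ = ⊩-c⁻ h in contradiction k ⊩-𝟘) (λ s h → contradiction h ⊩-𝟘)
    ; c-increasing = λ i x → extensional {x} {x ∧ᶜ cᶜ i x} (λ s h → ⊩-∧ h (⊩-c (λ _ _ → refl) h)) (λ s → ⊩-∧ˡ)
    ; c-∧ = λ i x y → extensional {cᶜ i (x ∧ᶜ cᶜ i y)} {cᶜ i x ∧ᶜ cᶜ i y}
        (λ s h → let t , k , off = ⊩-c⁻ h ; u , k′ , off′ = ⊩-c⁻ (⊩-∧ʳ k) in
          ⊩-∧ (⊩-c off (⊩-∧ˡ k)) (⊩-c (λ j j≢i → trans (off′ j j≢i) (off j j≢i)) k′))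
        (λ s h → let t , k , off = ⊩-c⁻ (⊩-∧ˡ h) ; u , k′ , off′ = ⊩-c⁻ (⊩-∧ʳ h) in
          ⊩-c off (⊩-∧ k (⊩-c (λ j j≢i → trans (off′ j j≢i) (sym (off j j≢i))) k′)))
    ; c-comm = λ i j x → extensional {cᶜ i (cᶜ j x)} {cᶜ j (cᶜ i x)} (λ s → swap i j) (λ s → swap j i)
    ; d-refl = λ i → extensional (λ s _ → ⊩-𝟙 s) (λ s _ → ⊩-d refl)
    ; d-trans = λ i j k k≢i k≢j → extensional {dᶜ i j} {cᶜ k (dᶜ i k ∧ᶜ dᶜ k j)}
        (λ s h → let p = lookup s i ; s⁺ = s [ k ]≔ p
                     i≢k = λ e → k≢i (sym e) ; j≢k = λ e → k≢j (sym e) in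
          ⊩-c {s} {s⁺} (λ l l≢k → lookup∘update′ l≢k s p)
            (⊩-∧ (⊩-d {s⁺} {i} {k} (trans (lookup∘update′ i≢k s p) (sym (lookup∘update k s p))))
                 (⊩-d {s⁺} {k} {j} (trans (lookup∘update k s p) (trans (⊩-d⁻ h) (sym (lookup∘update′ j≢k s p)))))))
        (λ s h → let t , k′ , off = ⊩-c⁻ h in
          ⊩-d (trans (sym (off i (λ e → k≢i (sym e)))) (trans (⊩-d⁻ (⊩-∧ˡ k′))
            (trans (⊩-d⁻ (⊩-∧ʳ k′)) (off j (λ e → k≢j (sym e)))))))
    ; d-subst = λ i j x i≢j → extensional {cᶜ i (dᶜ i j ∧ᶜ x) ∧ᶜ cᶜ i (dᶜ i j ∧ᶜ (-ᶜ x))} {𝟘ᶜ}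
        (λ s h → let t , k , off = ⊩-c⁻ (⊩-∧ˡ h)
                     u , k′ , off′ = ⊩-c⁻ (⊩-∧ʳ h)
                     j≢i = λ e → i≢j (sym e)
                     t≡u = lookup-ext λ l → case l Fin.≟ i of λ
                       { (yes refl) → trans (⊩-d⁻ (⊩-∧ˡ k)) (trans (off j j≢i)
                           (trans (sym (off′ j j≢i)) (sym (⊩-d⁻ (⊩-∧ˡ k′)))))
                       ; (no l≢i) → trans (off l l≢i) (sym (off′ l l≢i)) }
                 in contradiction (subst (_⊩ x) t≡u (⊩-∧ʳ k)) (⊩-¬ (⊩-∧ʳ k′)))
        (λ s h → contradiction h ⊩-𝟘) }
    where
    e : State → Point → Const m → Bool
    e σ t x = proj₁ (interp σ x) t
    swap : ∀ i j {s x} → s ⊩ cᶜ i (cᶜ j x) → s ⊩ cᶜ j (cᶜ i x)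
    swap i j {s} {x} h =
      let t , k , off = ⊩-c⁻ h
          u , k′ , off′ = ⊩-c⁻ k
          v = s [ j ]≔ lookup u j
      in ⊩-c {s} {v} (λ l l≢j → lookup∘update′ l≢j s _) (⊩-c {v} {u} (λ l l≢i → case l Fin.≟ j of λ
           { (yes refl) → sym (lookup∘update l s _)
           ; (no l≢j) → trans (off′ l l≢j) (trans (off l l≢i) (sym (lookup∘update′ l≢j s _))) }) k′)

-- 𝔹 is in both classes and 𝔸 in neither

module Membership (em : {P : Set} → Dec P) (m′ : ℕ) where

  open Structures em m′
  open ComplexAlgebra em m′
  open NoBasis em m′
  open Coding
  open Plays em m′
  open Limit em m′
  open Forcing em m′

  open CylindricStructure 𝔹 using (_≈_; _≼_; IsAtom; Atomic)
  open _⊩_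

  ≈-refl : ∀ x → x ≈ x
  ≈-refl x = extensional {x} {x} (λ _ h → h) (λ _ h → h)

  ≡⇒≈ : ∀ {x y} → x ≡ y → x ≈ y
  ≡⇒≈ {x} refl = ≈-refl x

  ≈-sym : ∀ x y → x ≈ y → y ≈ x
  ≈-sym x y e = extensional (λ _ → ⊩-resp y x (sym′ e)) (λ _ → ⊩-resp x y e)
    where
    sym′ : x ≈ y → y ≈ x
    sym′ = Γ-map (x ≃ᶜ y) (y ≃ᶜ x) (λ _ e t → sym (e t))

  ⊩-self : ∀ s → s ⊩ typ s
  ⊩-self s = ⊩-valid s (typ s) (λ σ → ⟨⟩-self (at σ s))

  ⊩-≼ : ∀ {s} x y → x ≼ y → s ⊩ x → s ⊩ y
  ⊩-≼ {s} x y x≼y h = ⊩-∧ʳ {x = x} (⊩-resp x (x ∧ᶜ y) x≼y h)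

  ≼-⊩ : ∀ x y → (∀ s → s ⊩ x → s ⊩ y) → x ≼ y
  ≼-⊩ x y f = extensional (λ s h → ⊩-∧ h (f s h)) (λ s → ⊩-∧ˡ)

  ⊩-typ-sym : ∀ {s t} → s ⊩ typ t → t ⊩ typ s
  ⊩-typ-sym {s} {t} = ⊩-map (typ t) (typ s) (λ σ e → is⁺ (Same-sym (⟨⟩∋⇒≋ (at σ t) (at σ s) e)))

  typ-atom : ∀ s → IsAtom (typ s)
  typ-atom s = (λ typ≈𝟘 → ⊩-𝟘 (⊩-resp (typ s) 𝟘ᶜ typ≈𝟘 (⊩-self s))) , λ x x≼s → case em {s ⊩ x} of λ
    { (yes sx) → inj₂ (extensional (λ _ → ⊩-≼ x (typ s) x≼s) (λ _ → ⊩-≼ (typ s) x (claim sx)))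
    ; (no ¬sx) → inj₁ (extensional (λ t tx → contradiction (⊩-≼ (typ t) x (claim tx) (⊩-typ-sym (⊩-≼ x (typ s) x≼s tx))) ¬sx)
                                   (λ _ h → contradiction h ⊩-𝟘)) }

  realise : ∀ x → ¬ x ≈ 𝟘ᶜ → ∃[ s ] s ⊩ x
  realise x x≉𝟘 = dne λ none → x≉𝟘 (extensional (λ s h → contradiction (s , h) none) (λ _ h → contradiction h ⊩-𝟘))

  atom≈typ : ∀ {s} a → IsAtom a → s ⊩ a → typ s ≈ a
  atom≈typ {s} a (_ , min) sa = case min (typ s) (claim sa) of λ
    { (inj₁ e) → contradiction e (proj₁ (typ-atom s))
    ; (inj₂ e) → e }

  atomic : Atomic
  atomic x x≉𝟘 = let s , sx = realise x x≉𝟘 in typ s , typ-atom s , claim sx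

  map-update : ∀ {n} (ν : Vec ℕ n) {z p} (y : Vec (Fin n) m) → (∀ j → lookup y j ≢ z) →
               map (lookup (ν [ z ]≔ p)) y ≡ map (lookup ν) y
  map-update ν {z} {p} y y≢z = lookup-ext λ j → trans (lookup-map j _ y)
    (trans (lookup∘update′ (y≢z j) ν p) (sym (lookup-map j (lookup ν) y)))

  map-update-at : ∀ {n} (ν : Vec ℕ n) {z p} (x : Vec (Fin n) m) i → (∀ j → j ≢ i → lookup x j ≢ z) →
                  map (lookup (ν [ z ]≔ p)) (x [ i ]≔ z) ≡ map (lookup ν) x [ i ]≔ p
  map-update-at ν {z} {p} x i x≢z = lookup-ext λ j → trans (lookup-map j _ (x [ i ]≔ z)) (case j Fin.≟ i of λ
    { (yes refl) → trans (cong (lookup (ν [ z ]≔ p)) (lookup∘update i x z)) (trans (lookup∘update z ν p) (sym (lookup∘update i (map (lookup ν) x) p)))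
    ; (no j≢i) → trans (cong (lookup (ν [ z ]≔ p)) (lookup∘update′ j≢i x z))
        (trans (lookup∘update′ (x≢z j j≢i) ν p) (trans (sym (lookup-map j (lookup ν) x)) (sym (lookup∘update′ j≢i (map (lookup ν) x) p)))) })

  module _ {n : ℕ} where
    -- Every `n`-tuple of numbers induces a network, and all of these together form the basis.
    network : Vec ℕ n → Network 𝔹 n
    network ν = record
      { label = λ δ → typ (map (lookup ν) δ) , typ-atom (map (lookup ν) δ)
      ; label-d = λ δ i j → claim (⊩-d (map-lookup-copies (lookup ν) δ i j))
      ; label-c = λ δ i k → claim (⊩-c (map-lookup-off (lookup ν) δ i k) (⊩-self (map (lookup ν) δ))) }
    in-CAB : (m≤n : m ≤ n) → 𝔹 ∈ CAB m n m≤n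
    in-CAB m≤n = cylindric , atomic , (λ N → ∃[ ν ] N ≡ network ν) , record
      { atoms = λ a a-atom → let s , sa = realise a (proj₁ a-atom) in network (pad s) , (pad s , refl) ,
          subst (λ v → typ v ≈ a) (sym (padded s)) (atom≈typ a a-atom sa)
      ; extend = λ { _ (ν , refl) x i a a-atom x≼ca z z-new →
          let p , h = ⊩-witness (⊩-≼ (typ (map (lookup ν) x)) (cᶜ i a) x≼ca (⊩-self (map (lookup ν) x))) in
          network (ν [ z ]≔ p) , (ν [ z ]≔ p , refl) , (λ y y≢z → ≡⇒≈ (cong typ (map-update ν y y≢z))) ,
          subst (λ v → typ v ≈ a) (sym (map-update-at ν x i z-new)) (atom≈typ a a-atom h) } }
      where
      entry : Vec ℕ m → ∀ {k} → Dec (toℕ {n} k < m) → ℕ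
      entry s (yes k<m) = lookup s (fromℕ< k<m)
      entry s (no _)    = 0
      pad : Vec ℕ m → Vec ℕ n
      pad s = tabulate (λ k → entry s {k} (toℕ k <? m))
      entry-inject : ∀ s i (d : Dec (toℕ (inject≤ i m≤n) < m)) → entry s {inject≤ i m≤n} d ≡ lookup s i
      entry-inject s i (yes i<m) = cong (lookup s) (Fin.toℕ-injective (trans (Fin.toℕ-fromℕ< i<m) (Fin.toℕ-inject≤ i m≤n)))
      entry-inject s i (no i≮m)  = contradiction (subst (_< m) (sym (Fin.toℕ-inject≤ i m≤n)) (Fin.toℕ<n i)) i≮m
      padded : ∀ s → map (lookup (pad s)) (tabulate (λ i → inject≤ i m≤n)) ≡ s
      padded s = lookup-ext λ i → trans (lookup-map i (lookup (pad s)) (tabulate (λ i → inject≤ i m≤n)))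
        (trans (cong (lookup (pad s)) (lookup∘tabulate (λ i → inject≤ i m≤n) i))
          (trans (lookup∘tabulate (λ k → entry s {k} (toℕ k <? m)) (inject≤ i m≤n)) (entry-inject s i (toℕ (inject≤ i m≤n) <? m))))

  representation : RelativizedRepresentation 𝔹
  representation = record
    { M = ℕ
    ; V = λ _ → ⊤
    ; covers = λ x → replicate m x , tt , Any.here refl
    ; f = λ x s → s ⊩ x
    ; f-⊆V = λ _ _ → tt
    ; f-cong = λ {x} {y} x≈y → ⊩-resp x y x≈y , ⊩-resp y x (≈-sym x y x≈y)
    ; f-∨ = λ x y → ⊩-∨ , λ { (inj₁ h) → ⊩-∨ˡ h ; (inj₂ h) → ⊩-∨ʳ h }
    ; f-∧ = λ x y → (λ h → ⊩-∧ˡ h , ⊩-∧ʳ h) , λ (h , k) → ⊩-∧ h k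
    ; f-- = λ x → (λ h → tt , ⊩-¬ h) , λ (_ , h) → ⊩-- h
    ; f-𝟙 = (λ _ → tt) , λ {s} _ → ⊩-𝟙 s
    ; f-𝟘 = (λ h → ⊩-𝟘 h) , λ ()
    ; f-c = λ i x → (λ h → tt , ⊩-c⁻ h) , λ (_ , t , h , off) → ⊩-c off h
    ; f-d = λ i j → (λ h → tt , ⊩-d⁻ h) , λ (_ , e) → ⊩-d e
    ; injective = λ {x} {y} (h , k) → extensional {x} {y} (λ _ → h) (λ _ → k)
    }

  -- If `t` forced `s` but no member of `X`, the atom `typ t` could be removed from the supremum and
  -- an upper bound would remain.
  complete : Complete representation
  complete X s (upper , least-upper) =
    (λ {t} ts → dne λ none →
      let s≼ = least-upper (s ∧ᶜ (-ᶜ typ t)) λ x x∈X → ≼-⊩ x (s ∧ᶜ (-ᶜ typ t)) λ u ux →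
                 ⊩-∧ (⊩-≼ x s (upper x x∈X) ux) (⊩-- λ ut → none (x , x∈X , ⊩-≼ (typ u) x (claim ux) (⊩-typ-sym ut)))
      in ⊩-¬ (⊩-∧ʳ (⊩-≼ s (s ∧ᶜ (-ᶜ typ t)) s≼ ts)) (⊩-self t)) ,
    λ (x , x∈X , tx) → ⊩-≼ x s (upper x x∈X) tx

  -- Since `V` is everything, all tuples are clique tuples; clique-guarded quantifiers are ordinary
  -- ones and commute.
  in-CAF : ∀ n → 𝔹 ∈ CAF m n
  in-CAF n = cylindric , representation , complete , square , flat
    where
    square : Square representation n
    square x _ a i l k l≢k h =
      let p , h′ = ⊩-witness h in x [ k ]≔ p , (λ _ _ → tt) , (λ j j≢k → lookup∘update′ j≢k x p) ,
      subst (_⊩ a) (sym (map-update-at x l i l≢k)) h′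
    commute : ∀ φ x i j → CliqueSat representation x (ex i (ex j φ)) → CliqueSat representation x (ex {n = n} j (ex i φ))
    commute φ x i j (y , _ , off , z , _ , off′ , h) =
      x [ j ]≔ lookup z j , (λ _ _ → tt) , (λ l l≢j → lookup∘update′ l≢j x _) , z , (λ _ _ → tt) ,
      (λ l l≢i → case l Fin.≟ j of λ
        { (yes refl) → sym (lookup∘update l x _)
        ; (no l≢j) → trans (off′ l l≢j) (trans (off l l≢i) (sym (lookup∘update′ l≢j x _))) }) , h
    flat : ∀ φ x → x ∈ CliqueTuple representation n → ∀ i j →
           CliqueSat representation x (ex i (ex j φ)) ⇔ CliqueSat representation x (ex j (ex i φ))
    flat φ x _ i j = mk⇔ (commute φ x i j) (commute φ x j i)

  𝔸∉CAB : ∀ {n} (m≤n : m ≤ n) → suc (suc m) ≤ n → ¬ 𝔸 ∈ CAB m n m≤n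
  𝔸∉CAB m≤n m+2≤n (_ , _ , _ , basis) = Descent.no-family m+2≤n (Descent.from-basis m+2≤n {m≤n} basis)

  𝔸∉CAF : ∀ {n} → suc (suc m) ≤ n → ¬ 𝔸 ∈ CAF m n
  𝔸∉CAF m+2≤n (_ , R , R-complete , R-square , _) =
    Descent.no-family m+2≤n (Descent.FromRepresentation.family m+2≤n R R-complete R-square)

  not-elementary : ∀ (K : Class m) → 𝔹 ∈ K → ¬ 𝔸 ∈ K → ¬ Elementary K
  not-elementary K 𝔹∈K 𝔸∉K (T , axiomatises) = 𝔸∉K (Equivalence.from (axiomatises 𝔸)
    λ φ φ∈T → equivalent φ (Equivalence.to (axiomatises 𝔹) 𝔹∈K φ φ∈T))

theorem8p4 : (∀ {ℓ} → ExcludedMiddle ℓ) →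
    ∀ (m : ℕ) → 2 < m →
    (∀ (n : ℕ) (m+3≤n : m + 3 ≤ n) → ¬ Elementary (CAB m n (≤-trans (m≤m+n m 3) m+3≤n)))
    × (∀ (n : ℕ) → m + 3 ≤ n → ¬ Elementary (CAF m n))
theorem8p4 em (suc (suc (suc m′))) (s≤s (s≤s (s≤s _))) =
  (λ n m+3≤n → not-elementary (CAB m n _) (in-CAB _) (𝔸∉CAB _ (m+2≤ m+3≤n))) ,
  (λ n m+3≤n → not-elementary (CAF m n) (in-CAF n) (𝔸∉CAF (m+2≤ m+3≤n)))
  where
  open Structures em m′ using (m)
  open Membership em m′
  m+2≤ : ∀ {n} → m + 3 ≤ n → suc (suc m) ≤ n
  m+2≤ m+3≤n = ≤-trans (ℕ.≤-trans (ℕ.n≤1+n _) (ℕ.≤-reflexive (ℕ.+-comm 3 m))) m+3≤n
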